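{- Let $P \subseteq \mathbb{R}^n$ be a polyhedron, and let $P = Q + C$ denote the Minkowski sum $\{q + c \mid q \in Q, c \in C\}$. (1) If $P$ is an L$^\natural$-convex polyhedron, then $P = Q + C$ for some bounded L$^\natural$-convex polyhedron $Q$ and some L$^\natural$-convex cone $C$. (2) If $P$ is an L$^\natural_2$-convex polyhedron, then $P = Q + C$ for some bounded L$^\natural_2$-convex polyhedron $Q$ and some L$^\natural_2$-convex cone $C$. (3) If $P$ is an M$^\natural$-convex polyhedron, then $P = Q + C$ for some bounded M$^\natural$-convex polyhedron $Q$ and some M$^\natural$-convex cone $C$. Similarly, if $P$ is an M-convex polyhedron, then $P = Q + C$ for some bounded M-convex polyhedron $Q$ and some M-convex cone $C$. (4) If $P$ is an M$^\natural_2$-convex polyhedron, then $P = Q + C$ for some bounded M$^\natural_2$-convex polyhedron $Q$ and some M$^\natural_2$-convex cone $C$. Similarly, if $P$ is an M$_2$-convex polyhedron, then $P = Q + C$ for some bounded M$_2$-convex polyhedron $Q$ and some M$_2$-convex cone $C$. (5) If $P$ is a multimodular polyhedron, then $P = Q + C$ for some bounded multimodular polyhedron $Q$ and some multimodular cone $C$.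
   Context: All sets below are nonempty; $e_i$ denotes the $i$-th unit vector, and $\lceil\cdot\rceil$, $\lfloor\cdot\rfloor$ act componentwise. A set $S \subseteq \mathbb{Z}^n$ is L$^\natural$-convex if for all $p,q \in S$ both $\lceil (p+q)/2 \rceil$ and $\lfloor (p+q)/2 \rfloor$ belong to $S$. A set is L$^\natural_2$-convex if it is the Minkowski sum of two L$^\natural$-convex sets. A set $S \subseteq \mathbb{Z}^n$ is M$^\natural$-convex if for all $x,y \in S$ and every $i$ with $x_i > y_i$, either ($x - e_i \in S$ and $y + e_i \in S$) or there exists $j$ with $x_j < y_j$ such that $x - e_i + e_j \in S$ and $y + e_i - e_j \in S$. A set $S \subseteq \mathbb{Z}^n$ is M-convex if for all $x,y \in S$ and every $i$ with $x_i > y_i$ there exists $j$ with $x_j < y_j$ such that $x - e_i + e_j \in S$ and $y + e_i - e_j \in S$. A set is M$^\natural_2$-convex (resp. M$_2$-convex) if it is the intersection of two M$^\natural$-convex (resp. M-convex) sets. A set $S \subseteq \mathbb{Z}^n$ is multimodular if $S = \{Dy \mid y \in T\}$ for some L$^\natural$-convex set $T$, where $D$ is the $n\times n$ matrix with $D_{ii} = 1$, $D_{i+1,i} = -1$ and all other entries $0$. For each such class "A" (L$^\natural$, L$^\natural_2$, M$^\natural$, M, M$^\natural_2$, M$_2$, multimodular), an A-convex polyhedron is the convex hull of an A-convex set, and an A-convex cone is an A-convex polyhedron that is a cone (a set closed under multiplication by nonnegative scalars).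
   Formalization: The polyhedra P, Q and the cone C are subsets of rational n-space instead of real n-space: the defining inequalities, the convex-combination weights and the nonnegative scalars for cones are all rational. -}

module Defs where

open import Level using (Level; _⊔_) renaming (suc to lsuc; zero to lzero)
open import Data.Nat using (ℕ; zero; suc)
open import Data.Fin using (Fin; _≟_)
open import Data.Integer as ℤ using (ℤ; +_)
open import Data.Rational as ℚ using (ℚ; 0ℚ; 1ℚ; floor; ceiling)
open import Data.Vec using (Vec; []; _∷_; lookup; tabulate; zipWith; map)
open import Data.List as List using (List)
open import Data.List.Relation.Unary.All using (All)
open import Data.Product using (Σ; ∃; ∃-syntax; _×_; _,_; proj₁; proj₂)
open import Data.Sum using (_⊎_)
open import Relation.Nullary using (does)
open import Relation.Binary.PropositionalEquality using (_≡_)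
open import Data.Bool using (if_then_else_)
open import Function.Bundles using (_⇔_)

-- Points.  Integer points are Vec ℤ n; points of the ambient space are
-- modelled by rational points Vec ℚ n.

ZSet : ℕ → Set₁
ZSet n = Vec ℤ n → Set

QSet : ℕ → Set₁
QSet n = Vec ℚ n → Set

NonemptyZ : ∀ {n} → ZSet n → Set
NonemptyZ S = ∃[ x ] S x

_≐_ : ∀ {n} {A : Set} → (Vec A n → Set) → (Vec A n → Set) → Set
P ≐ Q = ∀ x → P x ⇔ Q x

_+ᶻ_ : ∀ {n} → Vec ℤ n → Vec ℤ n → Vec ℤ n
_+ᶻ_ = zipWith ℤ._+_

_-ᶻ_ : ∀ {n} → Vec ℤ n → Vec ℤ n → Vec ℤ n
_-ᶻ_ = zipWith ℤ._-_

e : ∀ {n} → Fin n → Vec ℤ n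
e i = tabulate (λ k → if does (k ≟ i) then + 1 else + 0)

toℚ : ℤ → ℚ
toℚ z = z ℚ./ 1

ceilMid : ∀ {n} → Vec ℤ n → Vec ℤ n → Vec ℤ n
ceilMid = zipWith (λ a b → ceiling ((a ℤ.+ b) ℚ./ 2))

floorMid : ∀ {n} → Vec ℤ n → Vec ℤ n → Vec ℤ n
floorMid = zipWith (λ a b → floor ((a ℤ.+ b) ℚ./ 2))

-- Discrete convexity classes of integer sets (nonemptiness is imposed
-- separately wherever a set is required to be nonempty).

IsLNat : ∀ {n} → ZSet n → Set₁
IsLNat S = ∀ p q → S p → S q → Level.Lift (lsuc lzero) (S (ceilMid p q) × S (floorMid p q))

IsLNat2 : ∀ {n} → ZSet n → Set₁
IsLNat2 {n} S = Σ (ZSet n) λ S₁ → Σ (ZSet n) λ S₂ →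
  NonemptyZ S₁ × IsLNat S₁ × NonemptyZ S₂ × IsLNat S₂ ×
  Level.Lift (lsuc lzero) (S ≐ (λ x → ∃[ a ] ∃[ b ] (S₁ a × S₂ b × x ≡ a +ᶻ b)))

IsMNat : ∀ {n} → ZSet n → Set₁
IsMNat {n} S = ∀ x y (i : Fin n) → S x → S y → lookup y i ℤ.< lookup x i →
  Level.Lift (lsuc lzero)
   ((S (x -ᶻ e i) × S (y +ᶻ e i)) ⊎
    (∃[ j ] (lookup x j ℤ.< lookup y j ×
             S ((x -ᶻ e i) +ᶻ e j) × S ((y +ᶻ e i) -ᶻ e j))))

IsM : ∀ {n} → ZSet n → Set₁
IsM {n} S = ∀ x y (i : Fin n) → S x → S y → lookup y i ℤ.< lookup x i →
  Level.Lift (lsuc lzero)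
    (∃[ j ] (lookup x j ℤ.< lookup y j ×
             S ((x -ᶻ e i) +ᶻ e j) × S ((y +ᶻ e i) -ᶻ e j)))

IsMNat2 : ∀ {n} → ZSet n → Set₁
IsMNat2 {n} S = Σ (ZSet n) λ S₁ → Σ (ZSet n) λ S₂ →
  NonemptyZ S₁ × IsMNat S₁ × NonemptyZ S₂ × IsMNat S₂ ×
  Level.Lift (lsuc lzero) (S ≐ (λ x → S₁ x × S₂ x))

IsM2 : ∀ {n} → ZSet n → Set₁
IsM2 {n} S = Σ (ZSet n) λ S₁ → Σ (ZSet n) λ S₂ →
  NonemptyZ S₁ × IsM S₁ × NonemptyZ S₂ × IsM S₂ ×
  Level.Lift (lsuc lzero) (S ≐ (λ x → S₁ x × S₂ x))

private
  Dgo : ∀ {n} → ℤ → Vec ℤ n → Vec ℤ n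
  Dgo prev [] = []
  Dgo prev (z ∷ zs) = (z ℤ.- prev) ∷ Dgo z zs

D : ∀ {n} → Vec ℤ n → Vec ℤ n
D [] = []
D (y ∷ ys) = y ∷ Dgo y ys

IsMultimodular : ∀ {n} → ZSet n → Set₁
IsMultimodular {n} S = Σ (ZSet n) λ T →
  NonemptyZ T × IsLNat T × Level.Lift (lsuc lzero) (S ≐ (λ x → ∃[ y ] (T y × x ≡ D y)))

_+ᵠ_ : ∀ {n} → Vec ℚ n → Vec ℚ n → Vec ℚ n
_+ᵠ_ = zipWith ℚ._+_

_·ᵠ_ : ∀ {n} → ℚ → Vec ℚ n → Vec ℚ n
c ·ᵠ x = map (c ℚ.*_) x

0ᵠ : ∀ {n} → Vec ℚ n
0ᵠ = tabulate (λ _ → 0ℚ)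

dot : ∀ {n} → Vec ℚ n → Vec ℚ n → ℚ
dot [] [] = 0ℚ
dot (a ∷ as) (x ∷ xs) = a ℚ.* x ℚ.+ dot as xs

IsPolyhedron : ∀ {n} → QSet n → Set
IsPolyhedron {n} P = ∃[ m ] Σ (Vec (Vec ℚ n) m) λ A → Σ (Vec ℚ m) λ b →
  P ≐ (λ x → ∀ (k : Fin m) → dot (lookup A k) x ℚ.≤ lookup b k)

combo : ∀ {n} → List (ℚ × Vec ℤ n) → Vec ℚ n
combo = List.foldr (λ wp acc → (proj₁ wp ·ᵠ map toℚ (proj₂ wp)) +ᵠ acc) 0ᵠ

weightSum : ∀ {n} → List (ℚ × Vec ℤ n) → ℚ
weightSum = List.foldr (λ wp acc → proj₁ wp ℚ.+ acc) 0ℚ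

conv : ∀ {n} → ZSet n → QSet n
conv S x = ∃[ ws ] (All (λ wp → 0ℚ ℚ.≤ proj₁ wp × S (proj₂ wp)) ws ×
                    weightSum ws ≡ 1ℚ × x ≡ combo ws)

IsClassPolyhedron : ∀ {n} → (ZSet n → Set₁) → QSet n → Set₁
IsClassPolyhedron {n} A P = Σ (ZSet n) λ S →
  NonemptyZ S × A S × Level.Lift (lsuc lzero) (P ≐ conv S)

IsCone : ∀ {n} → QSet n → Set
IsCone P = ∀ x (c : ℚ) → 0ℚ ℚ.≤ c → P x → P (c ·ᵠ x)

IsBounded : ∀ {n} → QSet n → Set
IsBounded {n} Q = ∃[ B ] (∀ x → Q x → ∀ (i : Fin n) → ℚ.∣ lookup x i ∣ ℚ.≤ B)

IsMinkowskiSum : ∀ {n} → QSet n → QSet n → QSet n → Set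
IsMinkowskiSum P Q C = P ≐ (λ x → ∃[ q ] ∃[ c ] (Q q × C c × x ≡ q +ᵠ c))

HasDecomposition : ∀ {n} → (ZSet n → Set₁) → QSet n → Set₁
HasDecomposition {n} A P = Σ (QSet n) λ Q → Σ (QSet n) λ C →
  IsClassPolyhedron A Q × Level.Lift (lsuc lzero) (IsBounded Q) ×
  IsClassPolyhedron A C × Level.Lift (lsuc lzero) (IsCone C) ×
  Level.Lift (lsuc lzero) (IsMinkowskiSum P Q C)

-- Every point of the polyhedron P = {x : A x ≤ b} is a convex combination of finitely many vertices plus a vector
-- of the recession cone K = {d : A d ≤ 0} (double description). If P is the convex hull of S, let Q be the convex
-- hull of a bounded part of S, cut out by a box large enough to span all vertices; boxes preserve each class.
-- Then P = Q + K, and it remains to see that K is a cone of the right class.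
--
-- L♮: S is closed under d whenever dᵤ ≤ dᵥ holds for all pairs (u , v) for which xᵤ − xᵥ is bounded on S (with
-- x₀ = 0), because S, made translation invariant, is a lattice and membership is decided by pairs of coordinates.
-- M♮: the sets X for which x(X) is bounded on S form a ring family; the cone {d : d(X) ≤ 0 for these X} has the
-- exchange property, hence every d in it is a sum of vectors eᵤ − eᵥ of the cone, and tight sets show that S is
-- closed under these. So K is cut out by the functionals bounded on S. For intersections the functionals of both
-- sets are used together, for Minkowski sums the two cones are added, and multimodular sets are linear images.
module Submission where

open import Defs
open import Level using (lift; lower; 0ℓ)
open import Data.Nat as ℕ using (ℕ; zero; suc)
import Data.Nat.Properties as ℕ
open import Data.Bool as Bool using (Bool; true; false; not; if_then_else_) renaming (_∨_ to _∨ᵇ_; _∧_ to _∧ᵇ_)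
open import Data.Bool.Properties using (not-involutive; ∨-zeroʳ; ∧-zeroʳ)
open import Data.Fin using (Fin; zero; suc; _≟_)
open import Data.Fin.Subset using (Subset; ∁; _∪_; _∩_) renaming (⊤ to full; ⊥ to empty)
open import Data.Integer as ℤ using (ℤ; +_; -[1+_])
import Data.Integer.Properties as ℤ
import Data.Integer.DivMod as ℤ
open import Data.Rational as ℚ using (ℚ; 0ℚ; 1ℚ)
import Data.Rational.Properties as ℚ
import Data.Rational.Unnormalised as ℚᵘ
import Data.Rational.Unnormalised.Properties as ℚᵘ
open import Data.Integer.Tactic.RingSolver using () renaming (ring to ringℤ)
open import Data.Vec using (Vec; []; _∷_; head; tail; lookup; tabulate; zipWith; map)
open import Data.Vec.Properties using (lookup-zipWith; lookup-map; lookup∘tabulate; tabulate∘lookup; tabulate-cong; lookup-replicate; zipWith-assoc; zipWith-comm; zipWith-idem; ≡-dec)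
open import Data.List as List using (List; []; _∷_; _++_)
open import Data.List.Relation.Unary.All as All using (All; []; _∷_)
import Data.List.Relation.Unary.All.Properties as All
open import Data.List.Relation.Unary.Any as Any using (Any; here; there)
open import Data.List.Properties using (map-++)
open import Data.List.Membership.Propositional using (_∈_; find; lose)
open import Data.List.Membership.Propositional.Properties using (∈-++⁺ˡ; ∈-++⁺ʳ; ∈-++⁻; ∈-map⁺; ∈-map⁻; ∈-filter⁺; ∈-filter⁻; ∈-cartesianProductWith⁺; ∈-cartesianProductWith⁻; ∈-allFin)
open import Data.Product using (Σ; ∃; ∃-syntax; _×_; _,_; proj₁; proj₂)
open import Data.Sum using (_⊎_; inj₁; inj₂)
open import Data.Maybe using (just; nothing)
open import Data.Empty using (⊥; ⊥-elim)
open import Relation.Binary.Definitions using (tri<; tri≈; tri>)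
open import Relation.Nullary using (¬_; Dec; yes; no; does)
open import Relation.Nullary.Decidable using (_×-dec_; map′; decidable-stable; ¬¬-excluded-middle; dec-true; dec-false)
open import Relation.Binary.PropositionalEquality using (_≡_; _≢_; refl; sym; trans; cong; cong₂; subst; subst₂)
open import Function using (_∘_; id; case_of_)
open import Function.Bundles using (mk⇔; Equivalence)
open import Tactic.RingSolver using (solve-∀)
open import Tactic.RingSolver.Core.AlmostCommutativeRing using (AlmostCommutativeRing; fromCommutativeRing)

-- The obstacle is constructive. `S` is an arbitrary predicate: neither membership in `S` nor
-- boundedness of a functional on `S` can be decided, yet both summands must be exhibited. Only the
-- rows of `P` are decidable. So the cone is not read off from `S` but searched for in a finite list
-- of cones that belong to the class by construction, built from sets of pairs or from ring
-- families. What is known of `S` holds up to double negation and serves to refute that the search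
-- fails. Translates `s + k d` known in this weak sense suffice, because membership in `P` is
-- stable. An extra index 0 makes a bound on one coordinate a bound on a difference, and an exchange
-- without partner an exchange with 0. For set functionals the coordinate 0 takes the value that
-- makes the total 0; sets containing 0 are then handled by complement and negation. For sums of L♮
-- sets the cone is not given by rows; there a pair of candidates is tested on the generators of the
-- recession cone.

ringℚ : AlmostCommutativeRing 0ℓ 0ℓ
ringℚ = fromCommutativeRing ℚ.+-*-commutativeRing isZero
  where
  isZero : ∀ x → _
  isZero x with 0ℚ ℚ.≟ x
  ... | yes p = just p
  ... | no _  = nothing

-- Order arithmetic in ℚ

p≤q⇒0≤q-p : ∀ {p q} → p ℚ.≤ q → 0ℚ ℚ.≤ q ℚ.- p
p≤q⇒0≤q-p {p} {q} p≤q = subst (ℚ._≤ q ℚ.- p) (ℚ.+-inverseʳ p) (ℚ.+-monoˡ-≤ (ℚ.- p) p≤q)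

≤-from-difference : ∀ {p q r} → 0ℚ ℚ.≤ r → q ≡ p ℚ.+ r → p ℚ.≤ q
≤-from-difference {p} {q} {r} 0≤r q≡p+r =
  subst₂ ℚ._≤_ (ℚ.+-identityʳ p) (sym q≡p+r) (ℚ.+-monoʳ-≤ p 0≤r)

*-monoˡ-≤ : ∀ {c p q} → 0ℚ ℚ.≤ c → p ℚ.≤ q → c ℚ.* p ℚ.≤ c ℚ.* q
*-monoˡ-≤ {c} 0≤c = ℚ.*-monoˡ-≤-nonNeg c {{ℚ.nonNegative 0≤c}}

0≤p*q : ∀ {p q} → 0ℚ ℚ.≤ p → 0ℚ ℚ.≤ q → 0ℚ ℚ.≤ p ℚ.* q
0≤p*q {p} {q} 0≤p 0≤q = subst (λ z → z ℚ.≤ p ℚ.* q) (ℚ.*-zeroʳ p) (*-monoˡ-≤ 0≤p 0≤q)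

0≤p+q : ∀ {p q} → 0ℚ ℚ.≤ p → 0ℚ ℚ.≤ q → 0ℚ ℚ.≤ p ℚ.+ q
0≤p+q 0≤p 0≤q = ℚ.+-mono-≤ 0≤p 0≤q

0≤1 : 0ℚ ℚ.≤ 1ℚ
0≤1 = ℚ.<⇒≤ (ℚ.positive⁻¹ 1ℚ)

reciprocal : ∀ {p} → 0ℚ ℚ.< p → ∃[ r ] (0ℚ ℚ.< r × r ℚ.* p ≡ 1ℚ)
reciprocal {p} 0<p = ℚ.1/ p , ℚ.positive⁻¹ (ℚ.1/ p) {{ℚ.1/pos⇒pos p}} , ℚ.*-inverseˡ p
  where instance
    p-positive : ℚ.Positive p
    p-positive = ℚ.positive 0<p
    p-nonZero : ℚ.NonZero p
    p-nonZero = ℚ.pos⇒nonZero p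

≤0-cancel : ∀ {c p} → 0ℚ ℚ.< c → c ℚ.* p ℚ.≤ 0ℚ → p ℚ.≤ 0ℚ
≤0-cancel {c} 0<c h =
  ℚ.*-cancelˡ-≤-pos c {{ℚ.positive 0<c}} (subst (c ℚ.* _ ℚ.≤_) (sym (ℚ.*-zeroʳ c)) h)

c*p≤0 : ∀ {c p} → 0ℚ ℚ.≤ c → p ℚ.≤ 0ℚ → c ℚ.* p ℚ.≤ 0ℚ
c*p≤0 {c} {p} 0≤c p≤0 = subst (c ℚ.* p ℚ.≤_) (ℚ.*-zeroʳ c) (*-monoˡ-≤ 0≤c p≤0)

p<0⇒0<-p : ∀ {p} → p ℚ.< 0ℚ → 0ℚ ℚ.< ℚ.- p
p<0⇒0<-p = ℚ.neg-antimono-<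

vec-ext : ∀ {n} {A : Set} {x y : Vec A n} → (∀ i → lookup x i ≡ lookup y i) → x ≡ y
vec-ext {x = x} {y} h = trans (sym (tabulate∘lookup x)) (trans (tabulate-cong h) (tabulate∘lookup y))

-- Linear algebra over ℚ

dot-+ : ∀ {n} (a x y : Vec ℚ n) → dot a (x +ᵠ y) ≡ dot a x ℚ.+ dot a y
dot-+ [] [] [] = refl
dot-+ (a ∷ as) (x ∷ xs) (y ∷ ys) rewrite dot-+ as xs ys = lemma a x y (dot as xs) (dot as ys)
  where
  lemma : ∀ a x y u v → a ℚ.* (x ℚ.+ y) ℚ.+ (u ℚ.+ v) ≡ (a ℚ.* x ℚ.+ u) ℚ.+ (a ℚ.* y ℚ.+ v)
  lemma = solve-∀ ringℚ

dot-· : ∀ {n} (a : Vec ℚ n) c x → dot a (c ·ᵠ x) ≡ c ℚ.* dot a x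
dot-· [] c [] = sym (ℚ.*-zeroʳ c)
dot-· (a ∷ as) c (x ∷ xs) rewrite dot-· as c xs = lemma a c x (dot as xs)
  where
  lemma : ∀ a c x u → a ℚ.* (c ℚ.* x) ℚ.+ c ℚ.* u ≡ c ℚ.* (a ℚ.* x ℚ.+ u)
  lemma = solve-∀ ringℚ

dot-0 : ∀ {n} (a : Vec ℚ n) → dot a 0ᵠ ≡ 0ℚ
dot-0 [] = refl
dot-0 (a ∷ as) rewrite dot-0 as = lemma a
  where
  lemma : ∀ a → a ℚ.* 0ℚ ℚ.+ 0ℚ ≡ 0ℚ
  lemma = solve-∀ ringℚ

dot-comm : ∀ {n} (a x : Vec ℚ n) → dot a x ≡ dot x a
dot-comm [] [] = refl
dot-comm (a ∷ as) (x ∷ xs) = cong₂ ℚ._+_ (ℚ.*-comm a x) (dot-comm as xs)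

dot-·ˡ : ∀ {n} c (a x : Vec ℚ n) → dot (c ·ᵠ a) x ≡ c ℚ.* dot a x
dot-·ˡ c a x = trans (dot-comm (c ·ᵠ a) x) (trans (dot-· x c a) (cong (c ℚ.*_) (dot-comm x a)))

dot-0ˡ : ∀ {n} (x : Vec ℚ n) → dot 0ᵠ x ≡ 0ℚ
dot-0ˡ x = trans (dot-comm 0ᵠ x) (dot-0 x)

+ᵠ-identityˡ : ∀ {n} (x : Vec ℚ n) → 0ᵠ +ᵠ x ≡ x
+ᵠ-identityˡ [] = refl
+ᵠ-identityˡ (x ∷ xs) = cong₂ _∷_ (ℚ.+-identityˡ x) (+ᵠ-identityˡ xs)

+ᵠ-identityʳ : ∀ {n} (x : Vec ℚ n) → x +ᵠ 0ᵠ ≡ x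
+ᵠ-identityʳ [] = refl
+ᵠ-identityʳ (x ∷ xs) = cong₂ _∷_ (ℚ.+-identityʳ x) (+ᵠ-identityʳ xs)

+ᵠ-assoc : ∀ {n} (x y z : Vec ℚ n) → (x +ᵠ y) +ᵠ z ≡ x +ᵠ (y +ᵠ z)
+ᵠ-assoc = zipWith-assoc ℚ.+-assoc

+ᵠ-comm : ∀ {n} (x y : Vec ℚ n) → x +ᵠ y ≡ y +ᵠ x
+ᵠ-comm = zipWith-comm ℚ.+-comm

+ᵠ-swap : ∀ {n} (x y z : Vec ℚ n) → x +ᵠ (y +ᵠ z) ≡ y +ᵠ (x +ᵠ z)
+ᵠ-swap x y z = trans (sym (+ᵠ-assoc x y z)) (trans (cong (_+ᵠ z) (+ᵠ-comm x y)) (+ᵠ-assoc y x z))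

+ᵠ-interchange : ∀ {n} (w x y z : Vec ℚ n) → (w +ᵠ x) +ᵠ (y +ᵠ z) ≡ (w +ᵠ y) +ᵠ (x +ᵠ z)
+ᵠ-interchange w x y z =
  trans (+ᵠ-assoc w x _) (trans (cong (w +ᵠ_) (+ᵠ-swap x y z)) (sym (+ᵠ-assoc w y _)))

·ᵠ-distribˡ : ∀ {n} c (x y : Vec ℚ n) → c ·ᵠ (x +ᵠ y) ≡ (c ·ᵠ x) +ᵠ (c ·ᵠ y)
·ᵠ-distribˡ c [] [] = refl
·ᵠ-distribˡ c (x ∷ xs) (y ∷ ys) = cong₂ _∷_ (ℚ.*-distribˡ-+ c x y) (·ᵠ-distribˡ c xs ys)

·ᵠ-assoc : ∀ {n} c d (x : Vec ℚ n) → c ·ᵠ (d ·ᵠ x) ≡ (c ℚ.* d) ·ᵠ x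
·ᵠ-assoc c d [] = refl
·ᵠ-assoc c d (x ∷ xs) = cong₂ _∷_ (sym (ℚ.*-assoc c d x)) (·ᵠ-assoc c d xs)

·ᵠ-identity : ∀ {n} (x : Vec ℚ n) → 1ℚ ·ᵠ x ≡ x
·ᵠ-identity [] = refl
·ᵠ-identity (x ∷ xs) = cong₂ _∷_ (ℚ.*-identityˡ x) (·ᵠ-identity xs)

·ᵠ-zeroˡ : ∀ {n} (x : Vec ℚ n) → 0ℚ ·ᵠ x ≡ 0ᵠ
·ᵠ-zeroˡ [] = refl
·ᵠ-zeroˡ (x ∷ xs) = cong₂ _∷_ (ℚ.*-zeroˡ x) (·ᵠ-zeroˡ xs)

·ᵠ-zeroʳ : ∀ {n} c → c ·ᵠ 0ᵠ {n} ≡ 0ᵠ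
·ᵠ-zeroʳ {zero} c = refl
·ᵠ-zeroʳ {suc n} c = cong₂ _∷_ (ℚ.*-zeroʳ c) (·ᵠ-zeroʳ c)

-- Polyhedral cones and their generators

HCone : ∀ {n} → List (Vec ℚ n) → QSet n
HCone A x = All (λ a → dot a x ℚ.≤ 0ℚ) A

HCone? : ∀ {n} (A : List (Vec ℚ n)) x → Dec (HCone A x)
HCone? A x = All.all? (λ a → dot a x ℚ.≤? 0ℚ) A

HCone-+ : ∀ {n} (A : List (Vec ℚ n)) {x y} → HCone A x → HCone A y → HCone A (x +ᵠ y)
HCone-+ A {x} {y} Ax Ay = All.zipWith
  (λ { {a} (p , q) → subst (ℚ._≤ 0ℚ) (sym (dot-+ a x y)) (ℚ.+-mono-≤ p q) }) (Ax , Ay)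

HCone-· : ∀ {n} (A : List (Vec ℚ n)) {c x} → 0ℚ ℚ.≤ c → HCone A x → HCone A (c ·ᵠ x)
HCone-· A {c} {x} 0≤c = All.map λ {a} p → subst (ℚ._≤ 0ℚ) (sym (dot-· a c x)) (c*p≤0 0≤c p)

HCone-0 : ∀ {n} (A : List (Vec ℚ n)) → HCone A 0ᵠ
HCone-0 A = All.universal (λ a → ℚ.≤-reflexive (dot-0 a)) A

data Cone {n} (G : QSet n) : QSet n where
  zero-cone : Cone G 0ᵠ
  add-ray   : ∀ {c g x} → 0ℚ ℚ.≤ c → G g → Cone G x → Cone G ((c ·ᵠ g) +ᵠ x)

Cone-mono : ∀ {n} {G H : QSet n} → (∀ g → G g → H g) → ∀ {x} → Cone G x → Cone H x
Cone-mono G⊆H zero-cone = zero-cone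
Cone-mono G⊆H (add-ray 0≤c g x) = add-ray 0≤c (G⊆H _ g) (Cone-mono G⊆H x)

Cone-+ : ∀ {n} {G : QSet n} {x y} → Cone G x → Cone G y → Cone G (x +ᵠ y)
Cone-+ {G = G} {y = y} zero-cone q = subst (Cone G) (sym (+ᵠ-identityˡ y)) q
Cone-+ {G = G} {y = y} (add-ray {c} {g} {x} 0≤c Gg p) q =
  subst (Cone G) (sym (+ᵠ-assoc (c ·ᵠ g) x y)) (add-ray 0≤c Gg (Cone-+ p q))

Cone-ray : ∀ {n} {G : QSet n} {c g} → 0ℚ ℚ.≤ c → G g → Cone G (c ·ᵠ g)
Cone-ray {G = G} 0≤c Gg = subst (Cone G) (+ᵠ-identityʳ _) (add-ray 0≤c Gg zero-cone)

Cone⊆HCone : ∀ {n} {G : QSet n} A → (∀ g → G g → HCone A g) → ∀ {x} → Cone G x → HCone A x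
Cone⊆HCone A G⊆A zero-cone = HCone-0 A
Cone⊆HCone A G⊆A (add-ray 0≤c Gg p) =
  HCone-+ A (HCone-· A 0≤c (G⊆A _ Gg)) (Cone⊆HCone A G⊆A p)

-- A nonnegative multiple of p ∈ B is cancelled against the generators of a vector of Cone C, one after
-- the other, through the rays (β q)·p + (α p)·q; whatever survives lies on one side only.
module Elimination {n} (B C Z : QSet n) (α β : Vec ℚ n → ℚ)
  (α>0 : ∀ p → B p → 0ℚ ℚ.< α p) (β>0 : ∀ q → C q → 0ℚ ℚ.< β q)
  (ray : ∀ p q → B p → C q → Z ((β q ·ᵠ p) +ᵠ (α p ·ᵠ q))) where

  OneSided : QSet n
  OneSided x = ∃[ z ] ∃[ y ] (Cone Z z × (Cone B y ⊎ Cone C y) × x ≡ z +ᵠ y)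

  private
    -- Two ways to spend the ray b p + a q: with t = c / b it uses up all of c p, and with t = μ /
    -- a, in `cancel-q`, all of μ q.
    cancel-p : ∀ {m} (p q y : Vec ℚ m) c μ t b a → t ℚ.* b ≡ c →
      (c ·ᵠ p) +ᵠ ((μ ·ᵠ q) +ᵠ y) ≡ (t ·ᵠ ((b ·ᵠ p) +ᵠ (a ·ᵠ q))) +ᵠ (((μ ℚ.- t ℚ.* a) ·ᵠ q) +ᵠ y)
    cancel-p [] [] [] _ _ _ _ _ _ = refl
    cancel-p (p ∷ ps) (q ∷ qs) (y ∷ ys) _ μ t b a refl =
      cong₂ _∷_ (heads p q y μ t b a) (cancel-p ps qs ys _ μ t b a refl)
      where
      heads : ∀ p q y μ t b a → t ℚ.* b ℚ.* p ℚ.+ (μ ℚ.* q ℚ.+ y) ≡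
        t ℚ.* (b ℚ.* p ℚ.+ a ℚ.* q) ℚ.+ ((μ ℚ.- t ℚ.* a) ℚ.* q ℚ.+ y)
      heads = solve-∀ ringℚ

    cancel-q : ∀ {m} (p q y : Vec ℚ m) c μ t b a → t ℚ.* a ≡ μ →
      (c ·ᵠ p) +ᵠ ((μ ·ᵠ q) +ᵠ y) ≡ (t ·ᵠ ((b ·ᵠ p) +ᵠ (a ·ᵠ q))) +ᵠ (((c ℚ.- t ℚ.* b) ·ᵠ p) +ᵠ y)
    cancel-q [] [] [] _ _ _ _ _ _ = refl
    cancel-q (p ∷ ps) (q ∷ qs) (y ∷ ys) c _ t b a refl =
      cong₂ _∷_ (heads p q y c t b a) (cancel-q ps qs ys c _ t b a refl)
      where
      heads : ∀ p q y c t b a → c ℚ.* p ℚ.+ (t ℚ.* a ℚ.* q ℚ.+ y) ≡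
        t ℚ.* (b ℚ.* p ℚ.+ a ℚ.* q) ℚ.+ ((c ℚ.- t ℚ.* b) ℚ.* p ℚ.+ y)
      heads = solve-∀ ringℚ

  private
    -- Here a' = 1 / a and b' = 1 / b. Which of the two vectors is exhausted first is decided by
    -- comparing c / b with μ / a; this restates the comparison as nonnegativity of the coefficient
    -- left on p.
    scaled-back : ∀ {c μ a b a' b'} → 0ℚ ℚ.≤ a' → 0ℚ ℚ.≤ b → b' ℚ.* b ≡ 1ℚ → a' ℚ.* a ≡ 1ℚ →
      μ ℚ.≤ c ℚ.* b' ℚ.* a → μ ℚ.* a' ℚ.* b ℚ.≤ c
    scaled-back {c} {μ} {a} {b} {a'} {b'} 0≤a' 0≤b b'b a'a h =
      subst₂ ℚ._≤_ (lhs μ a' b)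
        (trans (rhs a' b c b' a) (trans (cong₂ (λ u v → c ℚ.* u ℚ.* v) b'b a'a)
          (trans (ℚ.*-identityʳ _) (ℚ.*-identityʳ c))))
        (*-monoˡ-≤ {a' ℚ.* b} (0≤p*q 0≤a' 0≤b) h)
      where
      lhs : ∀ m a b → a ℚ.* b ℚ.* m ≡ m ℚ.* a ℚ.* b
      lhs = solve-∀ ringℚ
      rhs : ∀ a b c b' a' → a ℚ.* b ℚ.* (c ℚ.* b' ℚ.* a') ≡ c ℚ.* (b' ℚ.* b) ℚ.* (a ℚ.* a')
      rhs = solve-∀ ringℚ

    *-cancel : ∀ c {r p} → r ℚ.* p ≡ 1ℚ → c ℚ.* r ℚ.* p ≡ c
    *-cancel c {r} {p} rp≡1 = trans (ℚ.*-assoc c r p) (trans (cong (c ℚ.*_) rp≡1) (ℚ.*-identityʳ c))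

  eliminate : ∀ {c p y} → 0ℚ ℚ.≤ c → B p → Cone C y → OneSided ((c ·ᵠ p) +ᵠ y)
  eliminate {c} {p} 0≤c Bp zero-cone =
    0ᵠ , (c ·ᵠ p) , zero-cone , inj₁ (Cone-ray 0≤c Bp) , trans (+ᵠ-identityʳ _) (sym (+ᵠ-identityˡ _))
  eliminate {c} {p} 0≤c Bp (add-ray {μ} {q} {y} 0≤μ Cq Cy) =
    go (reciprocal (β>0 q Cq)) (reciprocal (α>0 p Bp))
    where
    go : (∃[ r ] (0ℚ ℚ.< r × r ℚ.* β q ≡ 1ℚ)) → (∃[ r ] (0ℚ ℚ.< r × r ℚ.* α p ≡ 1ℚ)) →
      OneSided ((c ·ᵠ p) +ᵠ ((μ ·ᵠ q) +ᵠ y))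
    go (b' , 0<b' , b'b) (a' , 0<a' , a'a) = compare (ℚ.≤-total (c ℚ.* b' ℚ.* α p) μ)
      where
      compare : (c ℚ.* b' ℚ.* α p ℚ.≤ μ) ⊎ (μ ℚ.≤ c ℚ.* b' ℚ.* α p) → OneSided ((c ·ᵠ p) +ᵠ ((μ ·ᵠ q) +ᵠ y))
      -- q outweighs p: all of p goes into the ray, and a nonnegative multiple of q is left over.
      compare (inj₁ h) =
        ((c ℚ.* b') ·ᵠ ((β q ·ᵠ p) +ᵠ (α p ·ᵠ q))) , (((μ ℚ.- c ℚ.* b' ℚ.* α p) ·ᵠ q) +ᵠ y) ,
        Cone-ray (0≤p*q 0≤c (ℚ.<⇒≤ 0<b')) (ray p q Bp Cq) ,
        inj₂ (add-ray (p≤q⇒0≤q-p h) Cq Cy) ,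
        cancel-p p q y c μ (c ℚ.* b') (β q) (α p) (*-cancel c b'b)
      -- p outweighs q: q is exhausted, and what is left of p meets the remaining generators.
      compare (inj₂ h) =
        restore (eliminate {c ℚ.- μ ℚ.* a' ℚ.* β q} {p} {y}
          (p≤q⇒0≤q-p (scaled-back {c} {μ} {α p} {β q} (ℚ.<⇒≤ 0<a') (ℚ.<⇒≤ (β>0 q Cq)) b'b a'a h)) Bp Cy)
        where
        restore : OneSided (((c ℚ.- μ ℚ.* a' ℚ.* β q) ·ᵠ p) +ᵠ y) → OneSided ((c ·ᵠ p) +ᵠ ((μ ·ᵠ q) +ᵠ y))
        restore (z , y' , Zz , side , eq) =
          (((μ ℚ.* a') ·ᵠ ((β q ·ᵠ p) +ᵠ (α p ·ᵠ q))) +ᵠ z) , y' ,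
          add-ray (0≤p*q 0≤μ (ℚ.<⇒≤ 0<a')) (ray p q Bp Cq) Zz , side ,
          trans (cancel-q p q y c μ (μ ℚ.* a') (β q) (α p) (*-cancel μ a'a))
            (trans (cong (((μ ℚ.* a') ·ᵠ ((β q ·ᵠ p) +ᵠ (α p ·ᵠ q))) +ᵠ_) eq)
              (sym (+ᵠ-assoc _ z y')))

Cone-dot-≥0 : ∀ {n} {G : QSet n} a → (∀ g → G g → 0ℚ ℚ.≤ dot a g) → ∀ {x} → Cone G x → 0ℚ ℚ.≤ dot a x
Cone-dot-≥0 a G≥0 zero-cone = ℚ.≤-reflexive (sym (dot-0 a))
Cone-dot-≥0 a G≥0 (add-ray {c} {g} {x} 0≤c Gg p) =
  subst (0ℚ ℚ.≤_) (sym (trans (dot-+ a (c ·ᵠ g) x) (cong (ℚ._+ dot a x) (dot-· a c g))))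
    (0≤p+q (0≤p*q 0≤c (G≥0 g Gg)) (Cone-dot-≥0 a G≥0 p))

+≤0⇒≤0 : ∀ {p q} → 0ℚ ℚ.≤ p → p ℚ.+ q ℚ.≤ 0ℚ → q ℚ.≤ 0ℚ
+≤0⇒≤0 {p} {q} 0≤p h = ℚ.≤-trans (subst (ℚ._≤ p ℚ.+ q) (ℚ.+-identityˡ q) (ℚ.+-monoˡ-≤ q 0≤p)) h

-- All terms of `dot a x` are nonnegative, so their sum can be at most 0 only if every coefficient
-- vanishes.
Cone-positive-≡0 : ∀ {n} {G : QSet n} a → (∀ g → G g → 0ℚ ℚ.< dot a g) →
  ∀ {x} → Cone G x → dot a x ℚ.≤ 0ℚ → x ≡ 0ᵠ
Cone-positive-≡0 a G>0 zero-cone h = refl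
Cone-positive-≡0 a G>0 (add-ray {c} {g} {x} 0≤c Gg p) h =
  trans (cong₂ (λ u v → (u ·ᵠ g) +ᵠ v) c≡0 (Cone-positive-≡0 a G>0 p ax≤0))
    (trans (+ᵠ-identityʳ _) (·ᵠ-zeroˡ g))
  where
  0≤ax : 0ℚ ℚ.≤ dot a x
  0≤ax = Cone-dot-≥0 a (λ g Gg → ℚ.<⇒≤ (G>0 g Gg)) p
  sum≤0 : c ℚ.* dot a g ℚ.+ dot a x ℚ.≤ 0ℚ
  sum≤0 = subst (ℚ._≤ 0ℚ) (trans (dot-+ a (c ·ᵠ g) x) (cong (ℚ._+ dot a x) (dot-· a c g))) h
  ax≤0 : dot a x ℚ.≤ 0ℚ
  ax≤0 = +≤0⇒≤0 (0≤p*q 0≤c (ℚ.<⇒≤ (G>0 g Gg))) sum≤0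
  c≡0 : c ≡ 0ℚ
  c≡0 = ℚ.≤-antisym
    (≤0-cancel (G>0 g Gg) (subst (ℚ._≤ 0ℚ) (ℚ.*-comm c (dot a g))
      (+≤0⇒≤0 0≤ax (subst (ℚ._≤ 0ℚ) (ℚ.+-comm (c ℚ.* dot a g) (dot a x)) sum≤0))))
    0≤c

-- One step of double description: from generators `L` of a cone to generators of its part with
-- `dot a x` at most 0. A generator of positive value survives only combined with one of negative
-- value, in the ratio that gives 0.
module CutCone {n} (a : Vec ℚ n) (L : List (Vec ℚ n)) where

  ray : Vec ℚ n → Vec ℚ n → Vec ℚ n
  ray p q = ((ℚ.- dot a q) ·ᵠ p) +ᵠ (dot a p ·ᵠ q)

  positive? : ∀ g → Dec (0ℚ ℚ.< dot a g)
  positive? g = 0ℚ ℚ.<? dot a g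
  negative? : ∀ g → Dec (dot a g ℚ.< 0ℚ)
  negative? g = dot a g ℚ.<? 0ℚ
  zero? : ∀ g → Dec (dot a g ≡ 0ℚ)
  zero? g = dot a g ℚ.≟ 0ℚ

  positives negatives zeros cutRays cutGenerators : List (Vec ℚ n)
  positives = List.filter positive? L
  negatives = List.filter negative? L
  zeros     = List.filter zero? L
  cutRays   = zeros ++ List.cartesianProductWith ray positives negatives
  cutGenerators = negatives ++ cutRays

  ray-zero : ∀ p q → dot a (ray p q) ≡ 0ℚ
  ray-zero p q = trans (dot-+ a _ _) (trans (cong₂ ℚ._+_ (dot-· a (ℚ.- dot a q) p) (dot-· a (dot a p) q)) (lemma (dot a p) (dot a q)))
    where
    lemma : ∀ u v → (ℚ.- v) ℚ.* u ℚ.+ u ℚ.* v ≡ 0ℚ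
    lemma = solve-∀ ringℚ

  cutRays-zero : ∀ g → g ∈ cutRays → dot a g ≡ 0ℚ
  cutRays-zero g g∈ with ∈-++⁻ zeros g∈
  ... | inj₁ g∈zeros = proj₂ (∈-filter⁻ zero? {xs = L} g∈zeros)
  ... | inj₂ g∈rays with ∈-cartesianProductWith⁻ ray positives negatives g∈rays
  ...   | p , q , _ , _ , refl = ray-zero p q

  positive : ∀ p → p ∈ positives → 0ℚ ℚ.< dot a p
  positive p p∈ = proj₂ (∈-filter⁻ positive? {xs = L} p∈)

  negative : ∀ q → q ∈ negatives → dot a q ℚ.< 0ℚ
  negative q q∈ = proj₂ (∈-filter⁻ negative? {xs = L} q∈)

  ray∈ : ∀ p q → p ∈ positives → q ∈ negatives → ray p q ∈ cutRays
  ray∈ p q p∈ q∈ = ∈-++⁺ʳ zeros (∈-cartesianProductWith⁺ ray p∈ q∈)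

  private
    module P = Elimination (_∈ positives) (_∈ negatives) (_∈ cutRays) (dot a) (λ q → ℚ.- dot a q)
      positive (λ q q∈ → p<0⇒0<-p (negative q q∈)) ray∈
    -- The same elimination with the sides exchanged, for adding a negative generator to a positive
    -- rest.
    module N = Elimination (_∈ negatives) (_∈ positives) (_∈ cutRays) (λ q → ℚ.- dot a q) (dot a)
      (λ q q∈ → p<0⇒0<-p (negative q q∈)) positive
      (λ q p q∈ p∈ → subst (_∈ cutRays) (+ᵠ-comm _ _) (ray∈ p q p∈ q∈))

  swap-sides : ∀ {x} → N.OneSided x → P.OneSided x
  swap-sides (z , y , Zz , inj₁ s , eq) = z , y , Zz , inj₂ s , eq
  swap-sides (z , y , Zz , inj₂ s , eq) = z , y , Zz , inj₁ s , eq

  add-zeros : ∀ {x y z} → Cone (_∈ cutRays) z → x ≡ z +ᵠ y → P.OneSided y → P.OneSided x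
  add-zeros {z = z} Zz eq (z' , y' , Zz' , side , eq') =
    (z +ᵠ z') , y' , Cone-+ Zz Zz' , side , trans eq (trans (cong (z +ᵠ_) eq') (sym (+ᵠ-assoc z z' y')))

  split : ∀ {x} → Cone (_∈ L) x → P.OneSided x
  split zero-cone = 0ᵠ , 0ᵠ , zero-cone , inj₁ zero-cone , sym (+ᵠ-identityˡ _)
  split (add-ray {c} {g} {x} 0≤c g∈L Lx) = step (split Lx) (ℚ.<-cmp (dot a g) 0ℚ)
    where
    step : P.OneSided x → _ → P.OneSided ((c ·ᵠ g) +ᵠ x)
    step (z , y , Zz , side , eq) (tri≈ _ g≡0 _) =
      ((c ·ᵠ g) +ᵠ z) , y , add-ray 0≤c (∈-++⁺ˡ (∈-filter⁺ zero? g∈L g≡0)) Zz , side ,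
      trans (cong ((c ·ᵠ g) +ᵠ_) eq) (sym (+ᵠ-assoc _ z y))
    step (z , y , Zz , side , eq) (tri< g<0 _ _) =
      add-zeros Zz (trans (cong ((c ·ᵠ g) +ᵠ_) eq) (+ᵠ-swap _ z y)) (add side)
      where
      g∈ : g ∈ negatives
      g∈ = ∈-filter⁺ negative? g∈L g<0
      add : Cone (_∈ positives) y ⊎ Cone (_∈ negatives) y → P.OneSided ((c ·ᵠ g) +ᵠ y)
      add (inj₁ By) = swap-sides (N.eliminate 0≤c g∈ By)
      add (inj₂ Cy) = 0ᵠ , ((c ·ᵠ g) +ᵠ y) , zero-cone , inj₂ (add-ray 0≤c g∈ Cy) , sym (+ᵠ-identityˡ _)
    step (z , y , Zz , side , eq) (tri> _ _ 0<g) =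
      add-zeros Zz (trans (cong ((c ·ᵠ g) +ᵠ_) eq) (+ᵠ-swap _ z y)) (add side)
      where
      g∈ : g ∈ positives
      g∈ = ∈-filter⁺ positive? g∈L 0<g
      add : Cone (_∈ positives) y ⊎ Cone (_∈ negatives) y → P.OneSided ((c ·ᵠ g) +ᵠ y)
      add (inj₁ By) = 0ᵠ , ((c ·ᵠ g) +ᵠ y) , zero-cone , inj₁ (add-ray 0≤c g∈ By) , sym (+ᵠ-identityˡ _)
      add (inj₂ Cy) = P.eliminate 0≤c g∈ Cy

  -- After `split` the rest lies on one side. Negative generators are kept. The rays have value 0,
  -- so a positive rest has the value of `x`, which is at most 0, and therefore vanishes.
  cut-spans : ∀ {x} → Cone (_∈ L) x → dot a x ℚ.≤ 0ℚ → Cone (_∈ cutGenerators) x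
  cut-spans {x} Lx ax≤0 = from-split (split Lx)
    where
    Z⊆ : ∀ {z} → Cone (_∈ cutRays) z → Cone (_∈ cutGenerators) z
    Z⊆ = Cone-mono (λ g g∈ → ∈-++⁺ʳ negatives g∈)
    from-split : P.OneSided x → Cone (_∈ cutGenerators) x
    from-split (z , y , Zz , inj₂ Cy , eq) =
      subst (Cone (_∈ cutGenerators)) (sym eq) (Cone-+ (Z⊆ Zz) (Cone-mono (λ g g∈ → ∈-++⁺ˡ g∈) Cy))
    from-split (z , y , Zz , inj₁ By , eq) =
      subst (Cone (_∈ cutGenerators)) (sym (trans eq (trans (cong (z +ᵠ_) y≡0) (+ᵠ-identityʳ z)))) (Z⊆ Zz)
      where
      y≡0 : y ≡ 0ᵠ
      y≡0 = Cone-positive-≡0 a positive By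
        (+≤0⇒≤0 (Cone-dot-≥0 a (λ g g∈ → ℚ.≤-reflexive (sym (cutRays-zero g g∈))) Zz)
          (subst (ℚ._≤ 0ℚ) (trans (cong (dot a) eq) (dot-+ a z y)) ax≤0))

  cut-generators⊆ : ∀ A → (∀ g → g ∈ L → HCone A g) → ∀ g → g ∈ cutGenerators → HCone (a ∷ A) g
  cut-generators⊆ A L⊆A g g∈ with ∈-++⁻ negatives g∈
  ... | inj₁ g∈neg = ℚ.<⇒≤ (negative g g∈neg) ∷ L⊆A g (proj₁ (∈-filter⁻ negative? {xs = L} g∈neg))
  ... | inj₂ g∈cut = ℚ.≤-reflexive (cutRays-zero g g∈cut) ∷ in-A (∈-++⁻ zeros g∈cut)
    where
    in-A : (g ∈ zeros) ⊎ (g ∈ List.cartesianProductWith ray positives negatives) → HCone A g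
    in-A (inj₁ g∈z) = L⊆A g (proj₁ (∈-filter⁻ zero? {xs = L} g∈z))
    in-A (inj₂ g∈r) with ∈-cartesianProductWith⁻ ray positives negatives g∈r
    ... | p , q , p∈ , q∈ , refl = HCone-+ A
      (HCone-· A (ℚ.<⇒≤ (p<0⇒0<-p (negative q q∈)))
        (L⊆A p (proj₁ (∈-filter⁻ positive? {xs = L} p∈))))
      (HCone-· A (ℚ.<⇒≤ (positive p p∈))
        (L⊆A q (proj₁ (∈-filter⁻ negative? {xs = L} q∈))))

spanning : ∀ n → List (Vec ℚ n)
spanning zero = []
spanning (suc n) = (1ℚ ∷ 0ᵠ) ∷ (ℚ.- 1ℚ ∷ 0ᵠ) ∷ List.map (0ℚ ∷_) (spanning n)

Cone-prepend-0 : ∀ {n} {L : List (Vec ℚ n)} {L' : List (Vec ℚ (suc n))} → (∀ g → g ∈ L → (0ℚ ∷ g) ∈ L') →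
  ∀ {x} → Cone (_∈ L) x → Cone (_∈ L') (0ℚ ∷ x)
Cone-prepend-0 L⊆L' zero-cone = zero-cone
Cone-prepend-0 {L' = L'} L⊆L' (add-ray {c} {g} {x} 0≤c g∈ Lx) =
  subst (λ t → Cone (_∈ L') (t ∷ ((c ·ᵠ g) +ᵠ x))) (trans (ℚ.+-identityʳ _) (ℚ.*-zeroʳ c))
    (add-ray 0≤c (L⊆L' g g∈) (Cone-prepend-0 L⊆L' Lx))

spanning-spans : ∀ {n} (x : Vec ℚ n) → Cone (_∈ spanning n) x
spanning-spans [] = zero-cone
spanning-spans {suc n} (x ∷ xs) =
  sign (ℚ.≤-total 0ℚ x)
  where
  rest : Cone (_∈ spanning (suc n)) (0ℚ ∷ xs)
  rest = Cone-prepend-0 (λ g g∈ → there (there (∈-map⁺ (0ℚ ∷_) g∈))) (spanning-spans xs)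
  plus : ∀ x → x ℚ.* 1ℚ ℚ.+ 0ℚ ≡ x
  plus = solve-∀ ringℚ
  minus : ∀ x → (ℚ.- x) ℚ.* (ℚ.- 1ℚ) ℚ.+ 0ℚ ≡ x
  minus = solve-∀ ringℚ
  tail≡ : ∀ c → (c ·ᵠ 0ᵠ) +ᵠ xs ≡ xs
  tail≡ c = trans (cong (_+ᵠ xs) (·ᵠ-zeroʳ c)) (+ᵠ-identityˡ xs)
  sign : (0ℚ ℚ.≤ x) ⊎ (x ℚ.≤ 0ℚ) → Cone (_∈ spanning (suc n)) (x ∷ xs)
  sign (inj₁ 0≤x) = subst (Cone _) (cong₂ _∷_ (plus x) (tail≡ x)) (add-ray 0≤x (here refl) rest)
  sign (inj₂ x≤0) = subst (Cone _) (cong₂ _∷_ (minus x) (tail≡ (ℚ.- x)))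
    (add-ray (ℚ.neg-antimono-≤ x≤0) (there (here refl)) rest)

HCone-generators : ∀ {n} (A : List (Vec ℚ n)) →
  ∃[ L ] ((∀ g → g ∈ L → HCone A g) × (∀ x → HCone A x → Cone (_∈ L) x))
HCone-generators [] = spanning _ , (λ _ _ → []) , (λ x _ → spanning-spans x)
HCone-generators (a ∷ A) with HCone-generators A
... | L , L⊆A , A⊆L =
  cutGenerators , cut-generators⊆ A L⊆A , λ { x (ax≤0 ∷ Ax) → cut-spans (A⊆L x Ax) ax≤0 }
  where open CutCone a L

-- Inclusion need only be tested on the finitely many generators of the smaller cone. This decision
-- is what makes a search for the recession cone possible.
HCone-⊆? : ∀ {n} (A B : List (Vec ℚ n)) → Dec (∀ x → HCone A x → HCone B x)
HCone-⊆? A B with HCone-generators A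
... | L , L⊆A , A⊆L with All.all? (HCone? B) L
...   | yes L⊆B = yes λ x Ax → Cone⊆HCone B (λ g g∈ → All.lookup L⊆B g∈) (A⊆L x Ax)
...   | no  L⊈B = no λ A⊆B → L⊈B (All.tabulate (λ g∈ → A⊆B _ (L⊆A _ g∈)))

-- Polyhedra

HPoly : ∀ {n} → List (ℚ × Vec ℚ n) → QSet n
HPoly rows x = All (λ r → dot (proj₂ r) x ℚ.≤ proj₁ r) rows

recession : ∀ {n} → List (ℚ × Vec ℚ n) → List (Vec ℚ n)
recession = List.map proj₂

-- The total weight is an index so that inductions can pass through partial combinations; the convex
-- combinations are those of weight 1.
data Hull {n} (V : QSet n) : ℚ → QSet n where
  zero-hull : Hull V 0ℚ 0ᵠ
  add-point : ∀ {w v τ x} → 0ℚ ℚ.≤ w → V v → Hull V τ x → Hull V (w ℚ.+ τ) ((w ·ᵠ v) +ᵠ x)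

Hull-+ : ∀ {n} {V : QSet n} {τ σ x y} → Hull V τ x → Hull V σ y → Hull V (τ ℚ.+ σ) (x +ᵠ y)
Hull-+ {V = V} {σ = σ} {y = y} zero-hull k = subst₂ (Hull V) (sym (ℚ.+-identityˡ σ)) (sym (+ᵠ-identityˡ y)) k
Hull-+ {V = V} {σ = σ} {y = y} (add-point {w} {v} {τ} {x} 0≤w Vv h) k =
  subst₂ (Hull V) (sym (ℚ.+-assoc w τ σ)) (sym (+ᵠ-assoc (w ·ᵠ v) x y)) (add-point 0≤w Vv (Hull-+ h k))

Hull-· : ∀ {n} {V : QSet n} {c τ x} → 0ℚ ℚ.≤ c → Hull V τ x → Hull V (c ℚ.* τ) (c ·ᵠ x)
Hull-· {V = V} {c} 0≤c zero-hull = subst₂ (Hull V) (sym (ℚ.*-zeroʳ c)) (sym (·ᵠ-zeroʳ c)) zero-hull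
Hull-· {V = V} {c} 0≤c (add-point {w} {v} {τ} {x} 0≤w Vv h) =
  subst₂ (Hull V) (sym (ℚ.*-distribˡ-+ c w τ))
    (sym (trans (·ᵠ-distribˡ c (w ·ᵠ v) x) (cong (_+ᵠ (c ·ᵠ x)) (·ᵠ-assoc c w v))))
    (add-point (0≤p*q 0≤c 0≤w) Vv (Hull-· 0≤c h))

Hull-point : ∀ {n} {V : QSet n} {v} → V v → Hull V 1ℚ v
Hull-point {V = V} {v} Vv = subst₂ (Hull V) (ℚ.+-identityʳ 1ℚ) (trans (+ᵠ-identityʳ _) (·ᵠ-identity v))
  (add-point 0≤1 Vv zero-hull)

Hull-bind : ∀ {n} {V W : QSet n} → (∀ v → V v → Hull W 1ℚ v) → ∀ {τ x} → Hull V τ x → Hull W τ x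
Hull-bind V⊆W zero-hull = zero-hull
Hull-bind {W = W} V⊆W (add-point {w} {v} {τ} {x} 0≤w Vv h) =
  subst (λ t → Hull W (t ℚ.+ τ) ((w ·ᵠ v) +ᵠ x)) (ℚ.*-identityʳ w)
    (Hull-+ (Hull-· 0≤w (V⊆W v Vv)) (Hull-bind V⊆W h))

Hull-mono : ∀ {n} {V W : QSet n} → (∀ v → V v → W v) → ∀ {τ x} → Hull V τ x → Hull W τ x
Hull-mono V⊆W = Hull-bind (λ v Vv → Hull-point (V⊆W v Vv))

Hull-dot-≤ : ∀ {n} {V : QSet n} a M → (∀ v → V v → dot a v ℚ.≤ M) →
  ∀ {τ x} → Hull V τ x → dot a x ℚ.≤ τ ℚ.* M
Hull-dot-≤ a M V≤M zero-hull = ℚ.≤-reflexive (trans (dot-0 a) (sym (ℚ.*-zeroˡ M)))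
Hull-dot-≤ a M V≤M (add-point {w} {v} {τ} {x} 0≤w Vv h) =
  subst₂ ℚ._≤_ (sym (trans (dot-+ a (w ·ᵠ v) x) (cong (ℚ._+ dot a x) (dot-· a w v))))
    (sym (ℚ.*-distribʳ-+ M w τ))
    (ℚ.+-mono-≤ (*-monoˡ-≤ 0≤w (V≤M v Vv)) (Hull-dot-≤ a M V≤M h))

Hull-1-dot-≤ : ∀ {n} {V : QSet n} a M → (∀ v → V v → dot a v ℚ.≤ M) → ∀ {x} → Hull V 1ℚ x → dot a x ℚ.≤ M
Hull-1-dot-≤ a M V≤M {x} h = subst (dot a x ℚ.≤_) (ℚ.*-identityˡ M) (Hull-dot-≤ a M V≤M h)

Hull-empty : ∀ {n} {V : QSet n} → (∀ v → ¬ V v) → ∀ {τ x} → Hull V τ x → τ ≡ 0ℚ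
Hull-empty V∅ zero-hull = refl
Hull-empty V∅ (add-point _ Vv _) = ⊥-elim (V∅ _ Vv)

-- Rows of the cone over `P` placed at height 1; the first row keeps the height nonnegative.
homogenize : ∀ {n} → List (ℚ × Vec ℚ n) → List (Vec ℚ (suc n))
homogenize rows = (ℚ.- 1ℚ ∷ 0ᵠ) ∷ List.map (λ r → ℚ.- proj₁ r ∷ proj₂ r) rows

private
  homog-row : ∀ t b d → ℚ.- b ℚ.* t ℚ.+ d ℚ.≤ 0ℚ → d ℚ.≤ t ℚ.* b
  homog-row t b d h = ≤-from-difference (p≤q⇒0≤q-p h) (lemma t b d)
    where
    lemma : ∀ t b d → t ℚ.* b ≡ d ℚ.+ (0ℚ ℚ.- (ℚ.- b ℚ.* t ℚ.+ d))
    lemma = solve-∀ ringℚ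

  homog-row⁻ : ∀ b d → d ℚ.≤ b → ℚ.- b ℚ.* 1ℚ ℚ.+ d ℚ.≤ 0ℚ
  homog-row⁻ b d h = ≤-from-difference (p≤q⇒0≤q-p h) (lemma b d)
    where
    lemma : ∀ b d → 0ℚ ≡ (ℚ.- b ℚ.* 1ℚ ℚ.+ d) ℚ.+ (b ℚ.- d)
    lemma = solve-∀ ringℚ

  head≥0 : ∀ {n} t (x : Vec ℚ n) → dot (ℚ.- 1ℚ ∷ 0ᵠ) (t ∷ x) ℚ.≤ 0ℚ → 0ℚ ℚ.≤ t
  head≥0 t x h = ≤-from-difference (p≤q⇒0≤q-p h) (trans (lemma t) (cong (λ u → 0ℚ ℚ.+ (0ℚ ℚ.- (ℚ.- 1ℚ ℚ.* t ℚ.+ u))) (sym (dot-0ˡ x))))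
    where
    lemma : ∀ t → t ≡ 0ℚ ℚ.+ (0ℚ ℚ.- (ℚ.- 1ℚ ℚ.* t ℚ.+ 0ℚ))
    lemma = solve-∀ ringℚ

homogenize-rows : ∀ {n} rows {t} {x : Vec ℚ n} → HCone (List.map (λ r → ℚ.- proj₁ r ∷ proj₂ r) rows) (t ∷ x) →
  All (λ r → dot (proj₂ r) x ℚ.≤ t ℚ.* proj₁ r) rows
homogenize-rows [] [] = []
homogenize-rows ((b , a) ∷ rows) {t} {x} (h ∷ hs) = homog-row t b (dot a x) h ∷ homogenize-rows rows hs

HPoly⇒homogenized : ∀ {n} rows {x : Vec ℚ n} → HPoly rows x → HCone (homogenize rows) (1ℚ ∷ x)
HPoly⇒homogenized rows {x} Px =
  subst (ℚ._≤ 0ℚ) (sym (trans (cong (ℚ.- 1ℚ ℚ.* 1ℚ ℚ.+_) (dot-0ˡ x)) (ℚ.+-identityʳ _))) (ℚ.nonPositive⁻¹ (ℚ.- 1ℚ ℚ.* 1ℚ))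
  ∷ go rows Px
  where
  go : ∀ rows → HPoly rows x → HCone (List.map (λ r → ℚ.- proj₁ r ∷ proj₂ r) rows) (1ℚ ∷ x)
  go [] [] = []
  go ((b , a) ∷ rows) (h ∷ hs) = homog-row⁻ b (dot a x) h ∷ go rows hs

vertex : ∀ {n} → Vec ℚ (suc n) → Vec ℚ n
vertex (t ∷ x) with 0ℚ ℚ.<? t
... | yes 0<t = proj₁ (reciprocal 0<t) ·ᵠ x
-- A default value: `vertex` is used only on generators of positive height.
... | no _    = x

vertex-scaled : ∀ {n t} {x : Vec ℚ n} → 0ℚ ℚ.< t → t ·ᵠ vertex (t ∷ x) ≡ x
vertex-scaled {t = t} {x} 0<t with 0ℚ ℚ.<? t
... | no 0≮t = ⊥-elim (0≮t 0<t)
... | yes 0<t' = trans (·ᵠ-assoc t r x) (trans (cong (_·ᵠ x) (trans (ℚ.*-comm t r) rt≡1)) (·ᵠ-identity x))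
  where
  r : ℚ
  r = proj₁ (reciprocal 0<t')
  rt≡1 : r ℚ.* t ≡ 1ℚ
  rt≡1 = proj₂ (proj₂ (reciprocal 0<t'))

VRepresentation : ∀ {n} → List (ℚ × Vec ℚ n) → Set
VRepresentation {n} rows = Σ (List (Vec ℚ n)) λ V → Σ (List (Vec ℚ n)) λ R →
  (∀ v → v ∈ V → HPoly rows v) ×
  (∀ r → r ∈ R → HCone (recession rows) r) ×
  (∀ x → HPoly rows x → ∃[ v ] ∃[ r ] (Hull (_∈ V) 1ℚ v × Cone (_∈ R) r × x ≡ v +ᵠ r))

positive-head? : ∀ {n} (g : Vec ℚ (suc n)) → Dec (0ℚ ℚ.< head g)
positive-head? g = 0ℚ ℚ.<? head g

zero-head? : ∀ {n} (g : Vec ℚ (suc n)) → Dec (head g ≡ 0ℚ)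
zero-head? g = head g ℚ.≟ 0ℚ

-- Generators of the homogenized cone at positive height, scaled to height 1, become the points, and
-- those at height 0 the rays. In a combination the height is the total weight of the points, hence
-- 1 for an element of `P`.
vRepresentation : ∀ {n} (rows : List (ℚ × Vec ℚ n)) → VRepresentation rows
vRepresentation {n} rows with HCone-generators (homogenize rows)
... | L , L⊆ , ⊆L = V , R , V⊆ , R⊆ , λ x Px → split (⊆L (1ℚ ∷ x) (HPoly⇒homogenized rows Px))
  where
  V R : List (Vec ℚ n)
  V = List.map vertex (List.filter positive-head? L)
  R = List.map tail (List.filter zero-head? L)

  V⊆ : ∀ v → v ∈ V → HPoly rows v
  V⊆ v v∈ with ∈-map⁻ vertex v∈
  ... | (t ∷ g) , g∈ , refl with ∈-filter⁻ positive-head? {xs = L} g∈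
  ...   | g∈L , 0<t with L⊆ _ g∈L
  ...     | _ ∷ hs = All.map (λ {r} → unscale (proj₂ r) (proj₁ r)) (homogenize-rows rows hs)
    where
    unscale : ∀ a b → dot a g ℚ.≤ t ℚ.* b → dot a (vertex (t ∷ g)) ℚ.≤ b
    unscale a b h = ℚ.*-cancelˡ-≤-pos t {{ℚ.positive 0<t}}
      (subst (ℚ._≤ t ℚ.* b) (trans (cong (dot a) (sym (vertex-scaled 0<t))) (dot-· a t (vertex (t ∷ g)))) h)

  R⊆ : ∀ r → r ∈ R → HCone (recession rows) r
  R⊆ v v∈ with ∈-map⁻ tail v∈
  ... | (t ∷ g) , g∈ , refl with ∈-filter⁻ zero-head? {xs = L} g∈
  ...   | g∈L , refl with L⊆ _ g∈L
  ...     | _ ∷ hs = go rows (homogenize-rows rows hs)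
    where
    go : ∀ rows → All (λ r → dot (proj₂ r) g ℚ.≤ 0ℚ ℚ.* proj₁ r) rows → HCone (recession rows) g
    go [] [] = []
    go ((b , a) ∷ rows) (h ∷ hs) = subst (dot a g ℚ.≤_) (ℚ.*-zeroˡ b) h ∷ go rows hs

  Split : QSet (suc n)
  Split x = ∃[ v ] ∃[ r ] (Hull (_∈ V) (head x) v × Cone (_∈ R) r × tail x ≡ v +ᵠ r)

  split : ∀ {x} → Cone (_∈ L) x → Split x
  split zero-cone = 0ᵠ , 0ᵠ , zero-hull , zero-cone , sym (+ᵠ-identityˡ _)
  split (add-ray {c} {t ∷ g} {τ ∷ x} 0≤c g∈L Lx) = step (split Lx) (0ℚ ℚ.<? t)
    where
    head≤ : ∀ {t} → HCone (homogenize rows) (t ∷ g) → ¬ (0ℚ ℚ.< t) → t ≡ 0ℚ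
    head≤ {t} (h ∷ _) 0≮t = ℚ.≤-antisym (ℚ.≮⇒≥ 0≮t) (head≥0 t g h)
    step : Split (τ ∷ x) → Dec (0ℚ ℚ.< t) → Split ((c ·ᵠ (t ∷ g)) +ᵠ (τ ∷ x))
    step (v , r , Hv , Cr , eq) (yes 0<t) =
      (((c ℚ.* t) ·ᵠ vertex (t ∷ g)) +ᵠ v) , r ,
      add-point (0≤p*q 0≤c (ℚ.<⇒≤ 0<t)) (∈-map⁺ vertex (∈-filter⁺ positive-head? g∈L 0<t)) Hv , Cr ,
      trans (cong₂ _+ᵠ_ (sym (trans (sym (·ᵠ-assoc c t _)) (cong (c ·ᵠ_) (vertex-scaled 0<t)))) eq)
        (sym (+ᵠ-assoc _ v r))
    step (v , r , Hv , Cr , eq) (no 0≮t) =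
      v , ((c ·ᵠ g) +ᵠ r) , subst (λ s → Hull (_∈ V) s v) (sym (trans (cong (λ s → c ℚ.* s ℚ.+ τ) t≡0) (trans (cong (ℚ._+ τ) (ℚ.*-zeroʳ c)) (ℚ.+-identityˡ τ)))) Hv ,
      add-ray 0≤c (∈-map⁺ tail (∈-filter⁺ zero-head? g∈L t≡0)) Cr ,
      trans (cong ((c ·ᵠ g) +ᵠ_) eq) (+ᵠ-swap _ v r)
      where
      t≡0 : t ≡ 0ℚ
      t≡0 = head≤ (L⊆ _ g∈L) 0≮t

-- A point of the polyhedron puts weight 1 on the list of points, so that list cannot be empty.
HPoly-nonempty? : ∀ {n} (rows : List (ℚ × Vec ℚ n)) → Dec (∃[ x ] HPoly rows x)
HPoly-nonempty? rows with vRepresentation rows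
... | []     , _ , _  , _ , spans = no λ { (x , Px) → impossible (spans x Px) }
  where
  impossible : ∀ {x R} → ∃[ v ] ∃[ r ] (Hull (_∈ []) 1ℚ v × Cone R r × x ≡ v +ᵠ r) → ⊥
  impossible (v , r , Hv , _) = ℚ.1≢0 (Hull-empty (λ _ ()) Hv)
... | v ∷ V , _ , V⊆ , _ = yes (v , V⊆ v (here refl))

upper-bound : ∀ {n} (a : Vec ℚ n) V → ∃[ M ] (∀ v → v ∈ V → dot a v ℚ.≤ M)
upper-bound a [] = 0ℚ , λ _ ()
upper-bound a (v ∷ V) with upper-bound a V
... | M , V≤M = (dot a v ℚ.⊔ M) , λ
  { _ (here refl) → ℚ.p≤p⊔q (dot a v) M
  ; u (there u∈) → ℚ.≤-trans (V≤M u u∈) (ℚ.p≤q⊔p (dot a v) M) }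

-- If `a` were at most 0 on all rays, its maximum over the finitely many points would bound it on
-- the whole polyhedron.
unbounded⇒ray : ∀ {n} (rows : List (ℚ × Vec ℚ n)) (a : Vec ℚ n) →
  (∀ M → ∃[ x ] (HPoly rows x × M ℚ.< dot a x)) → ∃[ r ] (HCone (recession rows) r × 0ℚ ℚ.< dot a r)
unbounded⇒ray rows a unbounded with vRepresentation rows
... | V , R , V⊆ , R⊆ , spans with Any.any? (λ r → 0ℚ ℚ.<? dot a r) R
...   | yes found with find found
...     | r , r∈ , 0<ar = r , R⊆ r r∈ , 0<ar
unbounded⇒ray rows a unbounded | V , R , V⊆ , R⊆ , spans | no none with upper-bound a V
... | M , V≤M = ⊥-elim (contradiction (unbounded M))
  where
  Cone≤0 : ∀ {r} → Cone (_∈ R) r → dot a r ℚ.≤ 0ℚ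
  Cone≤0 Cr with Cone⊆HCone (a ∷ []) (λ g g∈ → ℚ.≮⇒≥ (λ 0<ag → none (lose g∈ 0<ag)) ∷ []) Cr
  ... | h ∷ [] = h
  contradiction : ¬ (∃[ x ] (HPoly rows x × M ℚ.< dot a x))
  contradiction (x , Px , M<ax) with spans x Px
  ... | v , r , Hv , Cr , refl =
    ℚ.<-irrefl refl (ℚ.<-≤-trans M<ax (subst₂ ℚ._≤_ (sym (dot-+ a v r)) (ℚ.+-identityʳ M)
      (ℚ.+-mono-≤ (Hull-1-dot-≤ a M V≤M Hv) (Cone≤0 Cr))))

-- Integers inside ℚ

private
  toℚ-≃ : ∀ z → ℚ.toℚᵘ (toℚ z) ℚᵘ.≃ ℚᵘ.mkℚᵘ z 0
  toℚ-≃ z = ℚ.toℚᵘ-fromℚᵘ (ℚᵘ.mkℚᵘ z 0)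

toℚ-+ : ∀ a b → toℚ (a ℤ.+ b) ≡ toℚ a ℚ.+ toℚ b
toℚ-+ a b = ℚ.toℚᵘ-injective (ℚᵘ.≃-trans (toℚ-≃ (a ℤ.+ b)) (ℚᵘ.≃-trans (ℚᵘ.*≡* (lemma a b))
  (ℚᵘ.≃-sym (ℚᵘ.≃-trans (ℚ.toℚᵘ-homo-+ (toℚ a) (toℚ b)) (ℚᵘ.+-cong (toℚ-≃ a) (toℚ-≃ b))))))
  where
  lemma : ∀ a b → (a ℤ.+ b) ℤ.* + 1 ≡ (a ℤ.* + 1 ℤ.+ b ℤ.* + 1) ℤ.* + 1
  lemma = solve-∀ ringℤ

toℚ-* : ∀ a b → toℚ (a ℤ.* b) ≡ toℚ a ℚ.* toℚ b
toℚ-* a b = ℚ.toℚᵘ-injective (ℚᵘ.≃-trans (toℚ-≃ (a ℤ.* b))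
  (ℚᵘ.≃-sym (ℚᵘ.≃-trans (ℚ.toℚᵘ-homo-* (toℚ a) (toℚ b)) (ℚᵘ.*-cong (toℚ-≃ a) (toℚ-≃ b)))))

toℚ-mono : ∀ {a b} → a ℤ.≤ b → toℚ a ℚ.≤ toℚ b
toℚ-mono {a} {b} a≤b = ℚ.toℚᵘ-cancel-≤ (ℚᵘ.≤-respʳ-≃ (ℚᵘ.≃-sym (toℚ-≃ b)) (ℚᵘ.≤-respˡ-≃ (ℚᵘ.≃-sym (toℚ-≃ a))
  (ℚᵘ.*≤* (subst₂ ℤ._≤_ (sym (ℤ.*-identityʳ a)) (sym (ℤ.*-identityʳ b)) a≤b))))

toℚ-cancel : ∀ {a b} → toℚ a ℚ.≤ toℚ b → a ℤ.≤ b
toℚ-cancel {a} {b} h = subst₂ ℤ._≤_ (ℤ.*-identityʳ a) (ℤ.*-identityʳ b)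
  (ℚᵘ.drop-*≤* (ℚᵘ.≤-respʳ-≃ (toℚ-≃ b) (ℚᵘ.≤-respˡ-≃ (toℚ-≃ a) (ℚ.toℚᵘ-mono-≤ h))))

toℚ-numerator : ∀ p → toℚ (ℚ.↥ p) ≡ toℚ (ℚ.↧ p) ℚ.* p
toℚ-numerator p@(ℚ.mkℚ z d _) = ℚ.toℚᵘ-injective (ℚᵘ.≃-trans (toℚ-≃ z)
  (ℚᵘ.≃-trans (ℚᵘ.*≡* (lemma z (+ suc d)))
    (ℚᵘ.≃-sym (ℚᵘ.≃-trans (ℚ.toℚᵘ-homo-* (toℚ (+ suc d)) p) (ℚᵘ.*-congʳ {ℚ.toℚᵘ p} (toℚ-≃ (+ suc d)))))))
  where
  lemma : ∀ z m → z ℤ.* (+ 1 ℤ.* m) ≡ (m ℤ.* z) ℤ.* + 1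
  lemma = solve-∀ ringℤ

1≤↧ : ∀ p → + 1 ℤ.≤ ℚ.↧ p
1≤↧ (ℚ.mkℚ _ _ _) = ℤ.+≤+ (ℕ.s≤s ℕ.z≤n)

archimedean : ∀ {u v M} → (∀ (k : ℕ) → u ℚ.+ toℚ (+ k) ℚ.* v ℚ.≤ M) → v ℚ.≤ 0ℚ
archimedean {u} {v} {M} h = ℚ.≮⇒≥ λ 0<v → contra 0<v (reciprocal 0<v)
  where
  contra : 0ℚ ℚ.< v → (∃[ r ] (0ℚ ℚ.< r × r ℚ.* v ≡ 1ℚ)) → ⊥
  contra 0<v (r , 0<r , rv≡1) = ℚ.<-irrefl refl (ℚ.<-≤-trans M<u+cv (ℚ.≤-trans (ℚ.+-monoʳ-≤ u cv≤kv) (h k)))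
    where
    -- As r = 1 / v, this is the solution of u + c v = M + 1.
    c : ℚ
    c = r ℚ.* ((M ℚ.- u) ℚ.+ 1ℚ)
    u≤M : u ℚ.≤ M
    u≤M = subst (ℚ._≤ M) (trans (cong (u ℚ.+_) (ℚ.*-zeroˡ v)) (ℚ.+-identityʳ u)) (h 0)
    0≤c : 0ℚ ℚ.≤ c
    0≤c = 0≤p*q (ℚ.<⇒≤ 0<r) (0≤p+q (p≤q⇒0≤q-p u≤M) 0≤1)
    -- Since c is nonnegative and its denominator at least 1, its numerator is a natural number not
    -- below c.
    k : ℕ
    k = ℤ.∣ ℚ.↥ c ∣
    k≡ : + k ≡ ℚ.↥ c
    k≡ = ℤ.0≤i⇒+∣i∣≡i (toℚ-cancel (subst (0ℚ ℚ.≤_) (sym (toℚ-numerator c))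
      (0≤p*q (ℚ.≤-trans 0≤1 (toℚ-mono (1≤↧ c))) 0≤c)))
    c≤k : c ℚ.≤ toℚ (+ k)
    c≤k = subst₂ ℚ._≤_ (ℚ.*-identityʳ c)
      (trans (ℚ.*-comm c (toℚ (ℚ.↧ c))) (trans (sym (toℚ-numerator c)) (cong toℚ (sym k≡))))
      (*-monoˡ-≤ {c} 0≤c (toℚ-mono (1≤↧ c)))
    cv≤kv : c ℚ.* v ℚ.≤ toℚ (+ k) ℚ.* v
    cv≤kv = ℚ.*-monoʳ-≤-nonNeg v {{ℚ.nonNegative (ℚ.<⇒≤ 0<v)}} c≤k
    cv≡ : u ℚ.+ c ℚ.* v ≡ M ℚ.+ 1ℚ
    cv≡ = trans (lemma u r M v) (trans (cong (λ t → u ℚ.+ t ℚ.* ((M ℚ.- u) ℚ.+ 1ℚ)) rv≡1) (lemma' u M))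
      where
      lemma : ∀ u r M v → u ℚ.+ r ℚ.* ((M ℚ.- u) ℚ.+ 1ℚ) ℚ.* v ≡ u ℚ.+ (r ℚ.* v) ℚ.* ((M ℚ.- u) ℚ.+ 1ℚ)
      lemma = solve-∀ ringℚ
      lemma' : ∀ u M → u ℚ.+ 1ℚ ℚ.* ((M ℚ.- u) ℚ.+ 1ℚ) ≡ M ℚ.+ 1ℚ
      lemma' = solve-∀ ringℚ
    M<u+cv : M ℚ.< u ℚ.+ c ℚ.* v
    M<u+cv = subst₂ ℚ._<_ (ℚ.+-identityʳ M) (sym cv≡) (ℚ.+-monoʳ-< M (ℚ.positive⁻¹ 1ℚ))

-- Integer vectors

dotᶻ : ∀ {n} → Vec ℤ n → Vec ℤ n → ℤ
dotᶻ [] [] = + 0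
dotᶻ (r ∷ rs) (x ∷ xs) = r ℤ.* x ℤ.+ dotᶻ rs xs

0ᶻ : ∀ {n} → Vec ℤ n
0ᶻ = tabulate (λ _ → + 0)

embed : ∀ {n} → Vec ℤ n → Vec ℚ n
embed = map toℚ

embed-+ : ∀ {n} (x y : Vec ℤ n) → embed (x +ᶻ y) ≡ embed x +ᵠ embed y
embed-+ [] [] = refl
embed-+ (x ∷ xs) (y ∷ ys) = cong₂ _∷_ (toℚ-+ x y) (embed-+ xs ys)

embed-* : ∀ {n} c (x : Vec ℤ n) → embed (map (c ℤ.*_) x) ≡ toℚ c ·ᵠ embed x
embed-* c [] = refl
embed-* c (x ∷ xs) = cong₂ _∷_ (toℚ-* c x) (embed-* c xs)

embed-0 : ∀ {n} → embed (0ᶻ {n}) ≡ 0ᵠ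
embed-0 {zero} = refl
embed-0 {suc n} = cong (0ℚ ∷_) embed-0

dot-embed : ∀ {n} (r x : Vec ℤ n) → dot (embed r) (embed x) ≡ toℚ (dotᶻ r x)
dot-embed [] [] = refl
dot-embed (r ∷ rs) (x ∷ xs) =
  trans (cong₂ ℚ._+_ (sym (toℚ-* r x)) (dot-embed rs xs)) (sym (toℚ-+ (r ℤ.* x) (dotᶻ rs xs)))

clear-denominators : ∀ {n} (x : Vec ℚ n) → ∃[ N ] ∃[ z ] (+ 1 ℤ.≤ N × embed z ≡ toℚ N ·ᵠ x)
clear-denominators [] = + 1 , [] , ℤ.≤-refl , refl
clear-denominators (x ∷ xs) with clear-denominators xs
... | N , zs , 1≤N , eq =
  N ℤ.* ℚ.↧ x , (N ℤ.* ℚ.↥ x) ∷ map (ℚ.↧ x ℤ.*_) zs , 1≤ ,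
  cong₂ _∷_
    (trans (toℚ-* N (ℚ.↥ x)) (trans (cong (toℚ N ℚ.*_) (toℚ-numerator x))
      (trans (sym (ℚ.*-assoc (toℚ N) (toℚ (ℚ.↧ x)) x)) (cong (ℚ._* x) (sym (toℚ-* N (ℚ.↧ x)))))))
    (trans (embed-* (ℚ.↧ x) zs) (trans (cong (toℚ (ℚ.↧ x) ·ᵠ_) eq) (trans (·ᵠ-assoc (toℚ (ℚ.↧ x)) (toℚ N) xs)
      (cong (_·ᵠ xs) (trans (ℚ.*-comm (toℚ (ℚ.↧ x)) (toℚ N)) (sym (toℚ-* N (ℚ.↧ x))))))))
  where
  1≤ : + 1 ℤ.≤ N ℤ.* ℚ.↧ x
  1≤ = ℤ.≤-trans 1≤N (subst (ℤ._≤ N ℤ.* ℚ.↧ x) (ℤ.*-identityʳ N)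
    (ℤ.*-monoˡ-≤-nonNeg N {{ℤ.nonNegative (ℤ.≤-trans (ℤ.+≤+ ℕ.z≤n) 1≤N)}} (1≤↧ x)))

-- Convex hulls of integer sets

Embedded : ∀ {n} → ZSet n → QSet n
Embedded S v = ∃[ s ] (S s × v ≡ embed s)

conv⇒Hull : ∀ {n} {S : ZSet n} {x} → conv S x → Hull (Embedded S) 1ℚ x
conv⇒Hull {S = S} (ws , all , sum≡1 , refl) = subst (λ t → Hull (Embedded S) t (combo ws)) sum≡1 (go ws all)
  where
  go : ∀ ws → All (λ wp → 0ℚ ℚ.≤ proj₁ wp × S (proj₂ wp)) ws → Hull (Embedded S) (weightSum ws) (combo ws)
  go [] [] = zero-hull
  go ((w , p) ∷ ws) ((0≤w , Sp) ∷ all) = add-point 0≤w (p , Sp , refl) (go ws all)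

Hull⇒conv : ∀ {n} {S : ZSet n} {x} → Hull (Embedded S) 1ℚ x → conv S x
Hull⇒conv {n} {S} h = go h
  where
  go : ∀ {τ x} → Hull (Embedded S) τ x →
    ∃[ ws ] (All (λ wp → 0ℚ ℚ.≤ proj₁ wp × S (proj₂ wp)) ws × weightSum ws ≡ τ × x ≡ combo ws)
  go zero-hull = [] , [] , refl , refl
  go (add-point {w} 0≤w (p , Sp , refl) h) with go h
  ... | ws , all , refl , refl = (w , p) ∷ ws , (0≤w , Sp) ∷ all , refl , refl

point∈conv : ∀ {n} {S : ZSet n} {s} → S s → conv S (embed s)
point∈conv {s = s} Ss = Hull⇒conv (Hull-point (s , Ss , refl))

IntegerPoints : ∀ {n} → QSet n → ZSet n
IntegerPoints P x = P (embed x)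

Embedded-mono : ∀ {n} {S T : ZSet n} → (∀ s → S s → T s) → ∀ {τ x} → Hull (Embedded S) τ x → Hull (Embedded T) τ x
Embedded-mono S⊆T = Hull-mono λ { v (s , Ss , eq) → s , S⊆T s Ss , eq }

conv-mono : ∀ {n} {S T : ZSet n} → (∀ s → S s → T s) → ∀ x → conv S x → conv T x
conv-mono S⊆T x h = Hull⇒conv (Embedded-mono S⊆T (conv⇒Hull h))

conv-cong : ∀ {n} {S T : ZSet n} → S ≐ T → conv S ≐ conv T
conv-cong S≐T x = mk⇔ (conv-mono (λ s → Equivalence.to (S≐T s)) x) (conv-mono (λ s → Equivalence.from (S≐T s)) x)

≐-trans : ∀ {n} {A : Set} {P Q R : Vec A n → Set} → P ≐ Q → Q ≐ R → P ≐ R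
≐-trans P≐Q Q≐R x = mk⇔ (Equivalence.to (Q≐R x) ∘ Equivalence.to (P≐Q x)) (Equivalence.from (P≐Q x) ∘ Equivalence.from (Q≐R x))

Hull⊆HCone : ∀ {n} {V : QSet n} A → (∀ v → V v → HCone A v) → ∀ {τ x} → Hull V τ x → HCone A x
Hull⊆HCone A V⊆A zero-hull = HCone-0 A
Hull⊆HCone A V⊆A (add-point 0≤w Vv h) = HCone-+ A (HCone-· A 0≤w (V⊆A _ Vv)) (Hull⊆HCone A V⊆A h)

convex-with-0 : ∀ {n} {V : QSet n} {c x} → V 0ᵠ → 0ℚ ℚ.≤ c → c ℚ.≤ 1ℚ → V x → Hull V 1ℚ (c ·ᵠ x)
convex-with-0 {V = V} {c} {x} V0 0≤c c≤1 Vx =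
  subst₂ (Hull V) (weight c) (trans (cong ((c ·ᵠ x) +ᵠ_) (trans (+ᵠ-identityʳ _) (·ᵠ-zeroʳ (1ℚ ℚ.- c)))) (+ᵠ-identityʳ _))
    (add-point 0≤c Vx (add-point (p≤q⇒0≤q-p c≤1) V0 zero-hull))
  where
  weight : ∀ c → c ℚ.+ ((1ℚ ℚ.- c) ℚ.+ 0ℚ) ≡ 1ℚ
  weight = solve-∀ ringℚ

-- A rational point x of a cone is (1/N)·(N x), a convex combination of the integer point N x and 0.
HCone⊆Hull : ∀ {n} (A : List (Vec ℚ n)) x → HCone A x → Hull (Embedded (IntegerPoints (HCone A))) 1ℚ x
HCone⊆Hull A x Ax with clear-denominators x
... | N , z , 1≤N , eq = go (reciprocal 0<N)
  where
  1≤toℚN : 1ℚ ℚ.≤ toℚ N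
  1≤toℚN = toℚ-mono 1≤N
  0<N : 0ℚ ℚ.< toℚ N
  0<N = ℚ.<-≤-trans (ℚ.positive⁻¹ 1ℚ) 1≤toℚN
  go : (∃[ r ] (0ℚ ℚ.< r × r ℚ.* toℚ N ≡ 1ℚ)) → Hull (Embedded (IntegerPoints (HCone A))) 1ℚ x
  go (r , 0<r , rN≡1) = subst (Hull _ 1ℚ)
    (trans (·ᵠ-assoc r (toℚ N) x) (trans (cong (_·ᵠ x) rN≡1) (·ᵠ-identity x)))
    (convex-with-0 (0ᶻ , subst (HCone A) (sym embed-0) (HCone-0 A) , sym embed-0) (ℚ.<⇒≤ 0<r) r≤1
      (z , subst (HCone A) (sym eq) (HCone-· A (ℚ.<⇒≤ 0<N) Ax) , sym eq))
    where
    r≤1 : r ℚ.≤ 1ℚ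
    r≤1 = subst₂ ℚ._≤_ (ℚ.*-identityʳ r) rN≡1 (*-monoˡ-≤ {r} (ℚ.<⇒≤ 0<r) 1≤toℚN)

HCone≐conv : ∀ {n} (A : List (Vec ℚ n)) → HCone A ≐ conv (IntegerPoints (HCone A))
HCone≐conv A x = mk⇔ (λ Ax → Hull⇒conv (HCone⊆Hull A x Ax))
  (λ h → Hull⊆HCone A (λ { v (s , As , refl) → As }) (conv⇒Hull h))

-- Bounded parts of a set

Box : ∀ {n} → ℤ → ZSet n
Box N x = ∀ i → ℤ.- N ℤ.≤ lookup x i × lookup x i ℤ.≤ N

in-some-box : ∀ {n} (x : Vec ℤ n) → ∃[ N ] (∀ M → N ℕ.≤ M → Box (+ M) x)
in-some-box [] = 0 , λ _ _ ()
in-some-box (x ∷ xs) with in-some-box xs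
... | N , xs∈ = ℤ.∣ x ∣ ℕ.⊔ N , λ
  { M h zero → ℤ.≤-trans (ℤ.neg-mono-≤ (ℤ.+≤+ (ℕ.m⊔n≤o⇒m≤o ℤ.∣ x ∣ N h))) (-∣i∣≤i x) ,
      ℤ.≤-trans (i≤∣i∣ x) (ℤ.+≤+ (ℕ.m⊔n≤o⇒m≤o ℤ.∣ x ∣ N h))
  ; M h (suc i) → xs∈ M (ℕ.m⊔n≤o⇒n≤o ℤ.∣ x ∣ N h) i }
  where
  i≤∣i∣ : ∀ i → i ℤ.≤ + ℤ.∣ i ∣
  i≤∣i∣ (+ n) = ℤ.≤-refl
  i≤∣i∣ -[1+ n ] = ℤ.-≤+
  -∣i∣≤i : ∀ i → ℤ.- + ℤ.∣ i ∣ ℤ.≤ i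
  -∣i∣≤i i = subst (ℤ.- + ℤ.∣ i ∣ ℤ.≤_) (ℤ.neg-involutive i)
    (ℤ.neg-mono-≤ (subst (ℤ.- i ℤ.≤_) (cong +_ (ℤ.∣-i∣≡∣i∣ i)) (i≤∣i∣ (ℤ.- i))))

-- The parts are left abstract, because for sums and linear images the box cuts the summands or the
-- preimage instead of `S`. `part-exhausts` speaks of all large indices, so that finitely many
-- points have a part in common. `part-class` may assume a point, from which the classes built from
-- two sets or from a preimage obtain their nonemptiness conditions.
record Truncation {n} (A : ZSet n → Set₁) (S : ZSet n) : Set₁ where
  field
    part         : ℕ → ZSet n
    part⊆        : ∀ N x → part N x → S x
    part-exhausts : ∀ x → S x → ∃[ N ] (∀ M → N ℕ.≤ M → part M x)
    part-bounded : ∀ N → ∃[ B ] (∀ x → part N x → Box B x)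
    part-class   : ∀ N → NonemptyZ (part N) → A (part N)

Hull-bounded : ∀ {n} {S : ZSet n} B → (∀ s → S s → Box B s) →
  ∀ {τ x} → Hull (Embedded S) τ x → ∀ i → ℚ.∣ lookup x i ∣ ℚ.≤ τ ℚ.* toℚ B
Hull-bounded B S⊆B zero-hull i =
  ℚ.≤-reflexive (trans (cong ℚ.∣_∣ (lookup∘tabulate (λ _ → 0ℚ) i)) (sym (ℚ.*-zeroˡ (toℚ B))))
Hull-bounded B S⊆B (add-point {w} {_} {τ} {x} 0≤w (s , Ss , refl) h) i =
  subst₂ ℚ._≤_ (cong ℚ.∣_∣ (sym lookup≡)) (sym (ℚ.*-distribʳ-+ (toℚ B) w τ))
    (ℚ.≤-trans (ℚ.∣p+q∣≤∣p∣+∣q∣ (w ℚ.* toℚ sᵢ) (lookup x i))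
      (ℚ.+-mono-≤ (subst (ℚ._≤ w ℚ.* toℚ B) (sym ∣ws∣≡) (*-monoˡ-≤ {w} 0≤w (∣toℚ∣≤ sᵢ (S⊆B s Ss i))))
        (Hull-bounded B S⊆B h i)))
  where
  sᵢ : ℤ
  sᵢ = lookup s i
  lookup≡ : lookup ((w ·ᵠ embed s) +ᵠ x) i ≡ w ℚ.* toℚ sᵢ ℚ.+ lookup x i
  lookup≡ = trans (lookup-zipWith ℚ._+_ i (w ·ᵠ embed s) x)
    (cong (ℚ._+ lookup x i) (trans (lookup-map i (w ℚ.*_) (embed s)) (cong (w ℚ.*_) (lookup-map i toℚ s))))
  ∣ws∣≡ : ℚ.∣ w ℚ.* toℚ sᵢ ∣ ≡ w ℚ.* ℚ.∣ toℚ sᵢ ∣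
  ∣ws∣≡ = trans (ℚ.∣p*q∣≡∣p∣*∣q∣ w (toℚ sᵢ)) (cong (ℚ._* ℚ.∣ toℚ sᵢ ∣) (ℚ.0≤p⇒∣p∣≡p 0≤w))
  ∣toℚ∣≤ : ∀ z → ℤ.- B ℤ.≤ z × z ℤ.≤ B → ℚ.∣ toℚ z ∣ ℚ.≤ toℚ B
  ∣toℚ∣≤ z (-B≤z , z≤B) = either (ℚ.∣p∣≡p∨∣p∣≡-p (toℚ z))
    where
    -toℚ : ℚ.- toℚ z ≡ toℚ (ℤ.- z)
    -toℚ = trans (neg-as-difference (toℚ z) (toℚ (ℤ.- z)) (trans (sym (toℚ-+ z (ℤ.- z))) (cong toℚ (ℤ.+-inverseʳ z)))) refl
      where
      neg-as-difference : ∀ p q → p ℚ.+ q ≡ 0ℚ → ℚ.- p ≡ q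
      neg-as-difference p q p+q≡0 = trans (lemma p q) (trans (cong (ℚ._+ q) (cong ℚ.-_ p+q≡0)) (ℚ.+-identityˡ q))
        where
        lemma : ∀ p q → ℚ.- p ≡ ℚ.- (p ℚ.+ q) ℚ.+ q
        lemma = solve-∀ ringℚ
    either : (ℚ.∣ toℚ z ∣ ≡ toℚ z) ⊎ (ℚ.∣ toℚ z ∣ ≡ ℚ.- toℚ z) → ℚ.∣ toℚ z ∣ ℚ.≤ toℚ B
    either (inj₁ eq) = subst (ℚ._≤ toℚ B) (sym eq) (toℚ-mono z≤B)
    either (inj₂ eq) = subst (ℚ._≤ toℚ B) (sym (trans eq -toℚ))
      (toℚ-mono (subst (ℤ.- z ℤ.≤_) (ℤ.neg-involutive B) (ℤ.neg-mono-≤ -B≤z)))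

module _ {n} {A : ZSet n → Set₁} {S : ZSet n} (T : Truncation A S) where
  open Truncation T

  -- A combination has finitely many terms, so one part contains them all.
  Hull-in-part : ∀ {τ x} → Hull (Embedded S) τ x → ∃[ N ] (∀ M → N ℕ.≤ M → Hull (Embedded (part M)) τ x)
  Hull-in-part zero-hull = 0 , λ _ _ → zero-hull
  Hull-in-part (add-point 0≤w (s , Ss , refl) h) with part-exhausts s Ss | Hull-in-part h
  ... | N₁ , s∈ | N₂ , h∈ = N₁ ℕ.⊔ N₂ , λ M le →
    add-point 0≤w (s , s∈ M (ℕ.m⊔n≤o⇒m≤o N₁ N₂ le) , refl) (h∈ M (ℕ.m⊔n≤o⇒n≤o N₁ N₂ le))

  all-in-part : ∀ V → (∀ v → v ∈ V → Hull (Embedded S) 1ℚ v) →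
    ∃[ N ] (∀ M → N ℕ.≤ M → ∀ v → v ∈ V → Hull (Embedded (part M)) 1ℚ v)
  all-in-part [] _ = 0 , λ _ _ _ ()
  all-in-part (v ∷ V) V⊆ with Hull-in-part (V⊆ v (here refl)) | all-in-part V (λ u u∈ → V⊆ u (there u∈))
  ... | N₁ , v∈ | N₂ , V∈ = N₁ ℕ.⊔ N₂ , λ
    { M le _ (here refl) → v∈ M (ℕ.m⊔n≤o⇒m≤o N₁ N₂ le)
    ; M le u (there u∈) → V∈ M (ℕ.m⊔n≤o⇒n≤o N₁ N₂ le) u u∈ }


polyhedron-rows : ∀ {n} {P : QSet n} → IsPolyhedron P → ∃[ rows ] (P ≐ HPoly rows)
polyhedron-rows (m , M , b , P≐) = List.tabulate (λ k → lookup b k , lookup M k) , λ x → mk⇔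
  (λ Px → All.tabulate⁺ (Equivalence.to (P≐ x) Px))
  (λ h → Equivalence.from (P≐ x) (All.tabulate⁻ h))

HPoly-+ray : ∀ {n} (rows : List (ℚ × Vec ℚ n)) {x d} → HPoly rows x → HCone (recession rows) d → HPoly rows (x +ᵠ d)
HPoly-+ray rows {x} {d} Px Kd = All.zipWith
  (λ { {b , a} (h , k) → subst₂ ℚ._≤_ (sym (dot-+ a x d)) (ℚ.+-identityʳ b) (ℚ.+-mono-≤ h k) }) (Px , All.map⁻ Kd)

-- The bounded summand is the hull of a part of S so large that it spans all vertices of P.
decompose : ∀ {n} {A : ZSet n → Set₁} {P : QSet n} rows → P ≐ HPoly rows →
  {S : ZSet n} → NonemptyZ S → P ≐ conv S → Truncation A S →
  (CZ : ZSet n) → NonemptyZ CZ → A CZ → HCone (recession rows) ≐ conv CZ → HasDecomposition A P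
decompose {n} {A} {P} rows P≐rows {S} (s₀ , Ss₀) P≐conv T CZ CZ-nonempty CZ-class K≐conv
  with vRepresentation rows
... | V , R , V⊆ , R⊆ , spans =
  conv (part N) , conv CZ ,
  (part N , part-nonempty , part-class N part-nonempty , lift (λ x → mk⇔ id id)) ,
  lift (toℚ B , λ x x∈ i → subst (ℚ.∣ lookup x i ∣ ℚ.≤_) (ℚ.*-identityˡ (toℚ B)) (Hull-bounded B part⊆B (conv⇒Hull x∈) i)) ,
  (CZ , CZ-nonempty , CZ-class , lift (λ x → mk⇔ id id)) ,
  lift (λ x c 0≤c x∈ → Equivalence.to (K≐conv _) (HCone-· (recession rows) 0≤c (Equivalence.from (K≐conv x) x∈))) ,
  lift (λ x → mk⇔ (to x) (from x))
  where
  open Truncation T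
  V⊆S : ∀ v → v ∈ V → Hull (Embedded S) 1ℚ v
  V⊆S v v∈ = conv⇒Hull (Equivalence.to (P≐conv v) (Equivalence.from (P≐rows v) (V⊆ v v∈)))
  N₁ N₂ N : ℕ
  N₁ = proj₁ (part-exhausts s₀ Ss₀)
  N₂ = proj₁ (all-in-part T V V⊆S)
  N = N₁ ℕ.⊔ N₂
  part-nonempty : NonemptyZ (part N)
  part-nonempty = s₀ , proj₂ (part-exhausts s₀ Ss₀) N (ℕ.m≤m⊔n N₁ N₂)
  B : ℤ
  B = proj₁ (part-bounded N)
  part⊆B : ∀ s → part N s → Box B s
  part⊆B = proj₂ (part-bounded N)
  V⊆part : ∀ v → v ∈ V → Hull (Embedded (part N)) 1ℚ v
  V⊆part = proj₂ (all-in-part T V V⊆S) N (ℕ.m≤n⊔m N₁ N₂)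
  to : ∀ x → P x → ∃[ q ] ∃[ c ] (conv (part N) q × conv CZ c × x ≡ q +ᵠ c)
  to x Px with spans x (Equivalence.to (P≐rows x) Px)
  ... | v , r , Hv , Cr , eq =
    v , r , Hull⇒conv (Hull-bind V⊆part Hv) , Equivalence.to (K≐conv r) (Cone⊆HCone (recession rows) R⊆ Cr) , eq
  from : ∀ x → ∃[ q ] ∃[ c ] (conv (part N) q × conv CZ c × x ≡ q +ᵠ c) → P x
  from x (q , c , q∈ , c∈ , refl) = Equivalence.from (P≐rows x) (HPoly-+ray rows Pq Kc)
    where
    Pq : HPoly rows q
    Pq = Equivalence.to (P≐rows q) (Equivalence.from (P≐conv q)
      (conv-mono (part⊆ N) q q∈))
    Kc : HCone (recession rows) c
    Kc = Equivalence.from (K≐conv c) c∈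

-- Recognising the recession cone among finitely many candidates

IntCone : ∀ {n} → List (Vec ℤ n) → ZSet n
IntCone B d = All (λ r → dotᶻ r d ℤ.≤ + 0) B

rationalRows : ∀ {n} → List (Vec ℤ n) → List (Vec ℚ n)
rationalRows = List.map embed

IntCone⇒HCone : ∀ {n} (B : List (Vec ℤ n)) {d} → IntCone B d → HCone (rationalRows B) (embed d)
IntCone⇒HCone B {d} = All.map⁺ ∘ All.map λ {r} h → subst (ℚ._≤ 0ℚ) (sym (dot-embed r d)) (toℚ-mono h)

HCone⇒IntCone : ∀ {n} (B : List (Vec ℤ n)) {d} → HCone (rationalRows B) (embed d) → IntCone B d
HCone⇒IntCone B {d} = All.map (λ {r} h → toℚ-cancel (subst (ℚ._≤ 0ℚ) (dot-embed r d) h)) ∘ All.map⁻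

IntCone-0 : ∀ {n} (B : List (Vec ℤ n)) → IntCone B 0ᶻ
IntCone-0 B = HCone⇒IntCone B (subst (HCone (rationalRows B)) (sym embed-0) (HCone-0 _))

HCone≐convIntCone : ∀ {n} (B : List (Vec ℤ n)) → HCone (rationalRows B) ≐ conv (IntCone B)
HCone≐convIntCone B = ≐-trans (HCone≐conv (rationalRows B)) (conv-cong (λ d → mk⇔ (HCone⇒IntCone B) (IntCone⇒HCone B)))

BoundedOn : ∀ {n} → ZSet n → Vec ℤ n → Set
BoundedOn S r = ∃[ M ] (∀ s → S s → dotᶻ r s ℤ.≤ M)

Hull-≤-bound : ∀ {n} {S : ZSet n} r {M} → (∀ s → S s → dotᶻ r s ℤ.≤ M) →
  ∀ {x} → Hull (Embedded S) 1ℚ x → dot (embed r) x ℚ.≤ toℚ M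
Hull-≤-bound r {M} S≤M = Hull-1-dot-≤ (embed r) (toℚ M)
  (λ { v (s , Ss , refl) → subst (ℚ._≤ toℚ M) (sym (dot-embed r s)) (toℚ-mono (S≤M s Ss)) })

-- The two fields give the two inclusions between the recession cone and the cone of `B`: bounded
-- functionals cannot grow along a recession direction, and directions that keep `S` inside itself
-- recede. The translates are only doubly negated, which is all that can be said of an undecidable
-- `S`.
record RecedesAlong {n} (S : ZSet n) (B : List (Vec ℤ n)) : Set where
  field
    rows-bounded : All (BoundedOn S) B
    translates   : ∀ d → IntCone B d → ∀ s → S s → ¬ ¬ S (s +ᶻ d)

HPoly-stable : ∀ {n} (rows : List (ℚ × Vec ℚ n)) {x} → ¬ ¬ HPoly rows x → HPoly rows x
HPoly-stable rows {x} = decidable-stable (All.all? (λ r → dot (proj₂ r) x ℚ.≤? proj₁ r) rows)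

-- Along the ray each row is an affine function of k that stays bounded, so its slope is at most 0.
recession-ray : ∀ {n} (rows : List (ℚ × Vec ℚ n)) {x d} →
  (∀ (k : ℕ) → HPoly rows (x +ᵠ (toℚ (+ k) ·ᵠ d))) → HCone (recession rows) d
recession-ray [] _ = []
recession-ray ((b , a) ∷ rows) {x} {d} h =
  archimedean {dot a x} {dot a d} {b} (λ k → subst (ℚ._≤ b) (trans (dot-+ a x _) (cong (dot a x ℚ.+_) (dot-· a (toℚ (+ k)) d))) (All.head (h k)))
  ∷ recession-ray rows (λ k → All.tail (h k))

module _ {n} {P : QSet n} rows (P≐rows : P ≐ HPoly rows) {S : ZSet n} (S-nonempty : NonemptyZ S) (P≐conv : P ≐ conv S) where

  private
    s₀ : Vec ℤ n
    s₀ = proj₁ S-nonempty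
    S⊆P : ∀ s → S s → HPoly rows (embed s)
    S⊆P s Ss = Equivalence.to (P≐rows _) (Equivalence.from (P≐conv _) (point∈conv Ss))

  -- A bound on `S` is a bound on its hull `P`, which contains the ray from `s₀` in direction `x`.
  bounded⇒recession≤0 : ∀ r → BoundedOn S r → ∀ x → HCone (recession rows) x → dot (embed r) x ℚ.≤ 0ℚ
  bounded⇒recession≤0 r (M , S≤M) x Kx = archimedean {dot (embed r) (embed s₀)} {dot (embed r) x} {toℚ M} λ k →
    subst (ℚ._≤ toℚ M) (trans (dot-+ (embed r) (embed s₀) _) (cong (dot (embed r) (embed s₀) ℚ.+_) (dot-· (embed r) (toℚ (+ k)) x)))
      (P≤M (HPoly-+ray rows (S⊆P s₀ (proj₂ S-nonempty)) (HCone-· (recession rows) (toℚ-mono {+ 0} {+ k} (ℤ.+≤+ ℕ.z≤n)) Kx)))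
    where
    P≤M : ∀ {y} → HPoly rows y → dot (embed r) y ℚ.≤ toℚ M
    P≤M {y} Py = Hull-≤-bound r S≤M (conv⇒Hull (Equivalence.to (P≐conv y) (Equivalence.from (P≐rows y) Py)))

  -- The double negation around `S` disappears on passing to the rows of `P`, whose membership is
  -- decidable.
  translation⇒recession : ∀ d → (∀ (k : ℕ) → ¬ ¬ S (s₀ +ᶻ map (+ k ℤ.*_) d)) → HCone (recession rows) (embed d)
  translation⇒recession d h = recession-ray rows {embed s₀} λ k → HPoly-stable rows λ ¬P → h k λ Ss →
    ¬P (subst (HPoly rows) (trans (embed-+ s₀ _) (cong (embed s₀ +ᵠ_) (embed-* (+ k) d))) (S⊆P _ Ss))

dotᶻ-* : ∀ {n} (r : Vec ℤ n) c x → dotᶻ r (map (c ℤ.*_) x) ≡ c ℤ.* dotᶻ r x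
dotᶻ-* [] c [] = sym (ℤ.*-zeroʳ c)
dotᶻ-* (r ∷ rs) c (x ∷ xs) = trans (cong (λ u → r ℤ.* (c ℤ.* x) ℤ.+ u) (dotᶻ-* rs c xs)) (lemma r c x (dotᶻ rs xs))
  where
  lemma : ∀ r c x u → r ℤ.* (c ℤ.* x) ℤ.+ c ℤ.* u ≡ c ℤ.* (r ℤ.* x ℤ.+ u)
  lemma = solve-∀ ringℤ

IntCone-* : ∀ {n} (B : List (Vec ℤ n)) (k : ℕ) {d} → IntCone B d → IntCone B (map (+ k ℤ.*_) d)
IntCone-* B k {d} = All.map (λ {r} h → subst (ℤ._≤ + 0) (sym (dotᶻ-* r (+ k) d))
  (subst (+ k ℤ.* dotᶻ r d ℤ.≤_) (ℤ.*-zeroʳ (+ k)) (ℤ.*-monoˡ-≤-nonNeg (+ k) h)))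

-- A rational cone is the hull of its integer points. The detour is needed because points of `S` can
-- be translated by integer vectors only.
HCone-from-integers : ∀ {n} (A B : List (Vec ℚ n)) → (∀ d → HCone A (embed d) → HCone B (embed d)) →
  ∀ x → HCone A x → HCone B x
HCone-from-integers A B h x Ax = Hull⊆HCone B (λ { v (s , As , refl) → h s As })
  (conv⇒Hull (Equivalence.to (HCone≐conv A x) Ax))

-- Which candidate is the recession cone is known only up to double negation, since S is not decidable;
-- but equality of polyhedral cones is decidable, so the right candidate can be searched for.
decompose-by-search : ∀ {n} {A : ZSet n → Set₁} {P : QSet n} → IsPolyhedron P →
  {S : ZSet n} → NonemptyZ S → P ≐ conv S → Truncation A S →
  (candidates : List (List (Vec ℤ n))) → (∀ B → B ∈ candidates → A (IntCone B)) →
  ¬ ¬ (∃[ B ] (B ∈ candidates × RecedesAlong S B)) → HasDecomposition A P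
decompose-by-search {n} {A} {P} P-poly {S} S-nonempty P≐conv T candidates cand-class ¬¬cand
  with polyhedron-rows P-poly
... | rows , P≐rows = choose (Any.any? same? candidates)
  where
  K : List (Vec ℚ n)
  K = recession rows
  Same : List (Vec ℤ n) → Set
  Same B = (∀ x → HCone K x → HCone (rationalRows B) x) × (∀ x → HCone (rationalRows B) x → HCone K x)
  same? : ∀ B → Dec (Same B)
  same? B = HCone-⊆? K (rationalRows B) ×-dec HCone-⊆? (rationalRows B) K
  recedes⇒same : ∀ B → RecedesAlong S B → Same B
  recedes⇒same B rec =
    (λ x Kx → All.map⁺ (All.map (λ {r} b → bounded⇒recession≤0 rows P≐rows S-nonempty P≐conv r b x Kx) rows-bounded)) ,
    HCone-from-integers (rationalRows B) K (λ d Bd → translation⇒recession rows P≐rows S-nonempty P≐conv d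
      (λ k → translates _ (IntCone-* B k (HCone⇒IntCone B Bd)) (proj₁ S-nonempty) (proj₂ S-nonempty)))
    where
    open RecedesAlong rec
  choose : Dec (Any Same candidates) → HasDecomposition A P
  choose (no none) = ⊥-elim (¬¬cand λ { (B , B∈ , rec) → none (lose B∈ (recedes⇒same B rec)) })
  choose (yes found) with find found
  ... | B , B∈ , K⊆B , B⊆K =
    decompose rows P≐rows S-nonempty P≐conv T (IntCone B) (0ᶻ , IntCone-0 B) (cand-class B B∈)
      (λ x → mk⇔ (λ Kx → Equivalence.to (HCone≐convIntCone B x) (K⊆B x Kx))
                 (λ h → B⊆K x (Equivalence.from (HCone≐convIntCone B x) h)))

-- Linear inequalities over ℤ are proved by exhibiting the difference as a sum of nonnegative terms.

≤-difference : ∀ {a b} → a ℤ.≤ b → + 0 ℤ.≤ b ℤ.- a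
≤-difference = ℤ.i≤j⇒0≤j-i

<-difference : ∀ {a b} → a ℤ.< b → + 0 ℤ.≤ b ℤ.- a ℤ.- + 1
<-difference {a} {b} a<b = subst (+ 0 ℤ.≤_) (lemma a b) (ℤ.i≤j⇒0≤j-i (ℤ.i<j⇒suc[i]≤j a<b))
  where
  lemma : ∀ a b → b ℤ.- (+ 1 ℤ.+ a) ≡ b ℤ.- a ℤ.- + 1
  lemma = solve-∀ ringℤ

≤-by : ∀ {a b r} → + 0 ℤ.≤ r → b ≡ a ℤ.+ r → a ℤ.≤ b
≤-by {a} {b} {r} 0≤r b≡ = subst₂ ℤ._≤_ (ℤ.+-identityʳ a) (sym b≡) (ℤ.+-monoʳ-≤ a 0≤r)

<-by : ∀ {a b r} → + 0 ℤ.≤ r → b ≡ + 1 ℤ.+ a ℤ.+ r → a ℤ.< b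
<-by 0≤r b≡ = ℤ.suc[i]≤j⇒i<j (≤-by 0≤r b≡)

_⊕_ : ∀ {p q} → + 0 ℤ.≤ p → + 0 ℤ.≤ q → + 0 ℤ.≤ p ℤ.+ q
_⊕_ = ℤ.+-mono-≤

infixl 6 _⊕_

0≤2* : ∀ {p} → + 0 ℤ.≤ p → + 0 ℤ.≤ + 2 ℤ.* p
0≤2* = ℤ.*-monoˡ-≤-nonNeg (+ 2) {+ 0}

-- Rounding halves

down up : ℤ → ℤ
down z = ℚ.floor (z ℚ./ 2)
up z = ℚ.ceiling (z ℚ./ 2)

half-≤ : ∀ {a b} → + 2 ℤ.* a ℤ.≤ + 2 ℤ.* b ℤ.+ + 1 → a ℤ.≤ b
half-≤ {a} {b} h = ℤ.≮⇒≥ λ b<a → ℤ.<-irrefl refl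
  (<-by {+ 2 ℤ.* b ℤ.+ + 1} (0≤2* (<-difference b<a) ⊕ ≤-difference h) (lemma a b))
  where
  lemma : ∀ a b → + 2 ℤ.* b ℤ.+ + 1 ≡
    + 1 ℤ.+ (+ 2 ℤ.* b ℤ.+ + 1) ℤ.+ (+ 2 ℤ.* (a ℤ.- b ℤ.- + 1) ℤ.+ ((+ 2 ℤ.* b ℤ.+ + 1) ℤ.- + 2 ℤ.* a))
  lemma = solve-∀ ringℤ

down-bounds : ∀ z → + 2 ℤ.* down z ℤ.≤ z × z ℤ.≤ + 2 ℤ.* down z ℤ.+ + 1
down-bounds z = bounds (z ℚ./ 2) (ℚ.toℚᵘ-fromℚᵘ (ℚᵘ.mkℚᵘ z 1))
  where
  bounds : ∀ p → ℚ.toℚᵘ p ℚᵘ.≃ ℚᵘ.mkℚᵘ z 1 → + 2 ℤ.* ℚ.floor p ℤ.≤ z × z ℤ.≤ + 2 ℤ.* ℚ.floor p ℤ.+ + 1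
  -- z / 2 is stored in lowest terms a / d, known only through a · 2 = z · d. Division of a by d
  -- with remainder gives the bounds once d is cancelled.
  bounds (ℚ.mkℚ a d-1 _) (ℚᵘ.*≡* a*2≡z*d) =
    ℤ.*-cancelʳ-≤-pos (+ 2 ℤ.* q) z d (≤-by (0≤2* 0≤r) (trans zd≡ (lemma q r d))) ,
    ≤-by (<-difference (ℤ.*-cancelʳ-<-nonNeg {z} {+ 2 ℤ.* q ℤ.+ + 2} d
      (<-by (0≤2* (<-difference r<d) ⊕ ℤ.+≤+ {0} {1} ℕ.z≤n) (trans (lemma₂ q r d) (cong (λ u → + 1 ℤ.+ u ℤ.+ (+ 2 ℤ.* (d ℤ.- r ℤ.- + 1) ℤ.+ + 1)) (sym zd≡))))))
      (lemma₃ z q)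
    where
    d q r : ℤ
    d = + suc d-1
    q = a ℤ./ d
    r = + (a ℤ.% d)
    0≤r : + 0 ℤ.≤ r
    0≤r = ℤ.+≤+ ℕ.z≤n
    r<d : r ℤ.< d
    r<d = ℤ.+<+ (ℤ.n%d<d a d)
    zd≡ : z ℤ.* d ≡ (r ℤ.+ q ℤ.* d) ℤ.* + 2
    zd≡ = trans (sym a*2≡z*d) (cong (ℤ._* + 2) (ℤ.a≡a%n+[a/n]*n a d))
    lemma : ∀ q r d → (r ℤ.+ q ℤ.* d) ℤ.* + 2 ≡ (+ 2 ℤ.* q) ℤ.* d ℤ.+ + 2 ℤ.* r
    lemma = solve-∀ ringℤ
    lemma₂ : ∀ q r d → (+ 2 ℤ.* q ℤ.+ + 2) ℤ.* d ≡ + 1 ℤ.+ (r ℤ.+ q ℤ.* d) ℤ.* + 2 ℤ.+ (+ 2 ℤ.* (d ℤ.- r ℤ.- + 1) ℤ.+ + 1)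
    lemma₂ = solve-∀ ringℤ
    lemma₃ : ∀ z q → + 2 ℤ.* q ℤ.+ + 1 ≡ z ℤ.+ ((+ 2 ℤ.* q ℤ.+ + 2) ℤ.- z ℤ.- + 1)
    lemma₃ = solve-∀ ringℤ

up≡-down- : ∀ z → up z ≡ ℤ.- down (ℤ.- z)
up≡-down- z = ceiling≡ (z ℚ./ 2) ((ℤ.- z) ℚ./ 2) (neg-/2 z)
  where
  ceiling≡ : ∀ p q → ℚ.- p ≡ q → ℚ.ceiling p ≡ ℤ.- ℚ.floor q
  ceiling≡ (ℚ.mkℚ _ _ _) _ refl = refl
  neg-/2 : ∀ z → ℚ.- (z ℚ./ 2) ≡ (ℤ.- z) ℚ./ 2
  neg-/2 (+ 0) = refl
  neg-/2 (+ suc n) = refl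
  neg-/2 -[1+ n ] = neg-neg (+ suc n ℚ./ 2)
    where
    neg-neg : ∀ p → ℚ.- (ℚ.- p) ≡ p
    neg-neg = solve-∀ ringℚ

up-bounds : ∀ z → z ℤ.≤ + 2 ℤ.* up z × + 2 ℤ.* up z ℤ.≤ z ℤ.+ + 1
up-bounds z with up z | up≡-down- z | down-bounds (ℤ.- z)
... | _ | refl | lo , hi =
  ≤-by (≤-difference lo) (lemma₁ z (down (ℤ.- z))) , ≤-by (≤-difference hi) (lemma₂ z (down (ℤ.- z)))
  where
  lemma₁ : ∀ z d → + 2 ℤ.* (ℤ.- d) ≡ z ℤ.+ ((ℤ.- z) ℤ.- + 2 ℤ.* d)
  lemma₁ = solve-∀ ringℤ
  lemma₂ : ∀ z d → z ℤ.+ + 1 ≡ + 2 ℤ.* (ℤ.- d) ℤ.+ ((+ 2 ℤ.* d ℤ.+ + 1) ℤ.- (ℤ.- z))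
  lemma₂ = solve-∀ ringℤ

down-unique : ∀ {z k} → + 2 ℤ.* k ℤ.≤ z → z ℤ.≤ + 2 ℤ.* k ℤ.+ + 1 → down z ≡ k
down-unique {z} {k} lo hi = ℤ.≤-antisym
  (half-≤ (ℤ.≤-trans (proj₁ (down-bounds z)) hi)) (half-≤ (ℤ.≤-trans lo (proj₂ (down-bounds z))))

up-unique : ∀ {z k} → z ℤ.≤ + 2 ℤ.* k → + 2 ℤ.* k ℤ.≤ z ℤ.+ + 1 → up z ≡ k
up-unique {z} {k} lo hi = ℤ.≤-antisym
  (half-≤ (ℤ.≤-trans (proj₂ (up-bounds z)) (ℤ.+-monoˡ-≤ (+ 1) lo)))
  (half-≤ (ℤ.≤-trans hi (ℤ.+-monoˡ-≤ (+ 1) (proj₁ (up-bounds z)))))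

down-mono : ∀ {a b} → a ℤ.≤ b → down a ℤ.≤ down b
down-mono {a} {b} a≤b = half-≤ (ℤ.≤-trans (proj₁ (down-bounds a)) (ℤ.≤-trans a≤b (proj₂ (down-bounds b))))

up-mono : ∀ {a b} → a ℤ.≤ b → up a ℤ.≤ up b
up-mono {a} {b} a≤b = half-≤ (ℤ.≤-trans (proj₂ (up-bounds a)) (ℤ.≤-trans (ℤ.+-monoˡ-≤ (+ 1) a≤b)
  (ℤ.+-monoˡ-≤ (+ 1) (proj₁ (up-bounds b)))))

down-even : ∀ z k → down (z ℤ.+ + 2 ℤ.* k) ≡ down z ℤ.+ k
down-even z k = down-unique
  (≤-by (≤-difference (proj₁ (down-bounds z))) (lemma₁ z k (down z)))
  (≤-by (≤-difference (proj₂ (down-bounds z))) (lemma₂ z k (down z)))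
  where
  lemma₁ : ∀ z k d → z ℤ.+ + 2 ℤ.* k ≡ + 2 ℤ.* (d ℤ.+ k) ℤ.+ (z ℤ.- + 2 ℤ.* d)
  lemma₁ = solve-∀ ringℤ
  lemma₂ : ∀ z k d → + 2 ℤ.* (d ℤ.+ k) ℤ.+ + 1 ≡ (z ℤ.+ + 2 ℤ.* k) ℤ.+ ((+ 2 ℤ.* d ℤ.+ + 1) ℤ.- z)
  lemma₂ = solve-∀ ringℤ

down-suc : ∀ z → down (z ℤ.+ + 1) ≡ up z
down-suc z = down-unique (proj₂ (up-bounds z)) (ℤ.+-monoˡ-≤ (+ 1) (proj₁ (up-bounds z)))

up-even : ∀ z k → up (z ℤ.+ + 2 ℤ.* k) ≡ up z ℤ.+ k
up-even z k = trans (sym (down-suc (z ℤ.+ + 2 ℤ.* k))) (trans (cong down (lemma z k))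
  (trans (down-even (z ℤ.+ + 1) k) (cong (λ u → u ℤ.+ k) (down-suc z))))
  where
  lemma : ∀ z k → z ℤ.+ + 2 ℤ.* k ℤ.+ + 1 ≡ z ℤ.+ + 1 ℤ.+ + 2 ℤ.* k
  lemma = solve-∀ ringℤ

up-suc : ∀ z → up (z ℤ.+ + 1) ≡ down z ℤ.+ + 1
up-suc z = trans (sym (down-suc (z ℤ.+ + 1))) (trans (cong down (lemma z)) (down-even z (+ 1)))
  where
  lemma : ∀ z → z ℤ.+ + 1 ℤ.+ + 1 ≡ z ℤ.+ + 2 ℤ.* + 1
  lemma = solve-∀ ringℤ

parity : ∀ z → ∃[ k ] ((z ≡ + 2 ℤ.* k) ⊎ (z ≡ + 1 ℤ.+ + 2 ℤ.* k))
parity z = down z , cases (+ 2 ℤ.* down z ℤ.<? z)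
  where
  cases : Dec (+ 2 ℤ.* down z ℤ.< z) → (z ≡ + 2 ℤ.* down z) ⊎ (z ≡ + 1 ℤ.+ + 2 ℤ.* down z)
  cases (no ≮z) = inj₁ (ℤ.≤-antisym (ℤ.≮⇒≥ ≮z) (proj₁ (down-bounds z)))
  cases (yes <z) = inj₂ (ℤ.≤-antisym (subst (z ℤ.≤_) (ℤ.+-comm (+ 2 ℤ.* down z) (+ 1)) (proj₂ (down-bounds z))) (ℤ.i<j⇒suc[i]≤j <z))

-- Unit vectors and integer functionals

-- Index 0 stands for an additional coordinate that is constantly 0, as in `lift₀`. Hence `pairRow`
-- covers the functionals xᵢ, -xᵢ and xᵢ - xⱼ alike.
ε : ∀ {n} → Fin (suc n) → Vec ℤ n
ε zero = 0ᶻ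
ε (suc i) = e i

lift₀ : ∀ {n} → Vec ℤ n → Fin (suc n) → ℤ
lift₀ x = lookup (+ 0 ∷ x)

dotᶻ-+ : ∀ {n} (r x y : Vec ℤ n) → dotᶻ r (x +ᶻ y) ≡ dotᶻ r x ℤ.+ dotᶻ r y
dotᶻ-+ [] [] [] = refl
dotᶻ-+ (r ∷ rs) (x ∷ xs) (y ∷ ys) =
  trans (cong (λ u → r ℤ.* (x ℤ.+ y) ℤ.+ u) (dotᶻ-+ rs xs ys)) (lemma r x y (dotᶻ rs xs) (dotᶻ rs ys))
  where
  lemma : ∀ r x y u v → r ℤ.* (x ℤ.+ y) ℤ.+ (u ℤ.+ v) ≡ (r ℤ.* x ℤ.+ u) ℤ.+ (r ℤ.* y ℤ.+ v)
  lemma = solve-∀ ringℤ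

dotᶻ-- : ∀ {n} (r x y : Vec ℤ n) → dotᶻ r (x -ᶻ y) ≡ dotᶻ r x ℤ.- dotᶻ r y
dotᶻ-- [] [] [] = refl
dotᶻ-- (r ∷ rs) (x ∷ xs) (y ∷ ys) =
  trans (cong (λ u → r ℤ.* (x ℤ.- y) ℤ.+ u) (dotᶻ-- rs xs ys)) (lemma r x y (dotᶻ rs xs) (dotᶻ rs ys))
  where
  lemma : ∀ r x y u v → r ℤ.* (x ℤ.- y) ℤ.+ (u ℤ.- v) ≡ (r ℤ.* x ℤ.+ u) ℤ.- (r ℤ.* y ℤ.+ v)
  lemma = solve-∀ ringℤ

dotᶻ-comm : ∀ {n} (r x : Vec ℤ n) → dotᶻ r x ≡ dotᶻ x r
dotᶻ-comm [] [] = refl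
dotᶻ-comm (r ∷ rs) (x ∷ xs) = cong₂ ℤ._+_ (ℤ.*-comm r x) (dotᶻ-comm rs xs)

dotᶻ-0 : ∀ {n} (r : Vec ℤ n) → dotᶻ r 0ᶻ ≡ + 0
dotᶻ-0 [] = refl
dotᶻ-0 (r ∷ rs) = trans (cong₂ ℤ._+_ (ℤ.*-zeroʳ r) (dotᶻ-0 rs)) refl

dotᶻ-e : ∀ {n} (r : Vec ℤ n) i → dotᶻ r (e i) ≡ lookup r i
dotᶻ-e (r ∷ rs) zero = trans (cong₂ ℤ._+_ (ℤ.*-identityʳ r) (dotᶻ-0 rs)) (ℤ.+-identityʳ r)
dotᶻ-e (r ∷ rs) (suc i) = trans (cong₂ ℤ._+_ (ℤ.*-zeroʳ r) (dotᶻ-e rs i)) (ℤ.+-identityˡ _)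

dotᶻ-ε : ∀ {n} (r : Vec ℤ n) u → dotᶻ r (ε u) ≡ lift₀ r u
dotᶻ-ε r zero = dotᶻ-0 r
dotᶻ-ε r (suc i) = dotᶻ-e r i

pairRow : ∀ {n} → Fin (suc n) × Fin (suc n) → Vec ℤ n
pairRow (u , v) = ε u -ᶻ ε v

dotᶻ-pairRow : ∀ {n} u v (x : Vec ℤ n) → dotᶻ (pairRow (u , v)) x ≡ lift₀ x u ℤ.- lift₀ x v
dotᶻ-pairRow u v x = trans (dotᶻ-comm (pairRow (u , v)) x)
  (trans (dotᶻ-- x (ε u) (ε v)) (cong₂ ℤ._-_ (dotᶻ-ε x u) (dotᶻ-ε x v)))

-- Double negation

_>>=_ : ∀ {a b} {A : Set a} {B : Set b} → ¬ ¬ A → (A → ¬ ¬ B) → ¬ ¬ B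
(m >>= f) ¬b = m (λ a → f a ¬b)

pure : ∀ {a} {A : Set a} → A → ¬ ¬ A
pure a ¬a = ¬a a

infixl 1 _>>=_

sublists : ∀ {A : Set} → List A → List (List A)
sublists [] = [] ∷ []
sublists (x ∷ xs) = List.map (x ∷_) (sublists xs) ++ sublists xs

-- The sublist without `x` is offered first. Should a proof of `Q x` ever be presented, the offer is
-- revised to the sublist with `x`; the double negation permits this.
¬¬-select : ∀ {A : Set} (Q : A → Set) xs →
  ¬ ¬ (∃[ ys ] (ys ∈ sublists xs × All Q ys × (∀ {x} → x ∈ xs → Q x → x ∈ ys)))
¬¬-select Q [] = pure ([] , here refl , [] , λ ())
¬¬-select Q (x ∷ xs) = ¬¬-select Q xs >>= λ { (ys , ys∈ , Qys , ys⊇) ¬found → ¬found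
  (ys , ∈-++⁺ʳ (List.map (x ∷_) (sublists xs)) ys∈ , Qys , λ
    { (here refl) Qx → ⊥-elim (¬found (x ∷ ys , ∈-++⁺ˡ (∈-map⁺ (x ∷_) ys∈) , Qx ∷ Qys , λ
        { (here refl) _ → here refl ; (there x∈) Qx → there (ys⊇ x∈ Qx) }))
    ; (there x∈) Qx → ys⊇ x∈ Qx }) }

-- Lattice operations on midpoint-convex sets

ceilMean floorMean : ∀ {m} → Vec ℤ m → Vec ℤ m → Vec ℤ m
ceilMean = zipWith (λ a b → up (a ℤ.+ b))
floorMean = zipWith (λ a b → down (a ℤ.+ b))

_∨_ _∧_ : ∀ {m} → Vec ℤ m → Vec ℤ m → Vec ℤ m
_∨_ = zipWith ℤ._⊔_
_∧_ = zipWith ℤ._⊓_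

distance : ∀ {m} → Vec ℤ m → Vec ℤ m → ℕ
distance [] [] = 0
distance (x ∷ xs) (y ∷ ys) = ℤ.∣ x ℤ.- y ∣ ℕ.+ distance xs ys

+∣x-y∣ : ∀ {x y} → y ℤ.≤ x → + ℤ.∣ x ℤ.- y ∣ ≡ x ℤ.- y
+∣x-y∣ y≤x = ℤ.0≤i⇒+∣i∣≡i (≤-difference y≤x)

closer-< : ∀ {p q c} → q ℤ.< c → c ℤ.≤ p → ℤ.∣ p ℤ.- c ∣ ℕ.< ℤ.∣ p ℤ.- q ∣
closer-< {p} {q} {c} q<c c≤p = ℤ.drop‿+<+ (subst₂ ℤ._<_ (sym (+∣x-y∣ c≤p)) (sym (+∣x-y∣ (ℤ.<⇒≤ (ℤ.<-≤-trans q<c c≤p))))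
  (ℤ.+-monoʳ-< p (ℤ.neg-mono-< q<c)))

closer-≤ : ∀ {p q c} → p ℤ.≤ c → c ℤ.≤ q → ℤ.∣ p ℤ.- c ∣ ℕ.≤ ℤ.∣ p ℤ.- q ∣
closer-≤ {p} {q} {c} p≤c c≤q = subst₂ ℕ._≤_ (ℤ.∣i-j∣≡∣j-i∣ c p) (ℤ.∣i-j∣≡∣j-i∣ q p)
  (ℤ.drop‿+≤+ (subst₂ ℤ._≤_ (sym (+∣x-y∣ p≤c)) (sym (+∣x-y∣ (ℤ.≤-trans p≤c c≤q))) (ℤ.+-monoˡ-≤ (ℤ.- p) c≤q)))

mean-bounds : ∀ {p q} → p ℤ.< q → p ℤ.< up (p ℤ.+ q) × up (p ℤ.+ q) ℤ.≤ q
mean-bounds {p} {q} p<q =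
  ℤ.suc[i]≤j⇒i<j (half-≤ (≤-by (≤-difference (proj₁ (up-bounds (p ℤ.+ q))) ⊕ <-difference p<q) (lemma₁ p q (up (p ℤ.+ q))))) ,
  half-≤ (≤-by (≤-difference (proj₂ (up-bounds (p ℤ.+ q))) ⊕ ≤-difference (ℤ.<⇒≤ p<q)) (lemma₂ p q (up (p ℤ.+ q))))
  where
  lemma₁ : ∀ p q c → + 2 ℤ.* c ℤ.+ + 1 ≡ + 2 ℤ.* (+ 1 ℤ.+ p) ℤ.+ ((+ 2 ℤ.* c ℤ.- (p ℤ.+ q)) ℤ.+ (q ℤ.- p ℤ.- + 1))
  lemma₁ = solve-∀ ringℤ
  lemma₂ : ∀ p q c → + 2 ℤ.* q ℤ.+ + 1 ≡ + 2 ℤ.* c ℤ.+ (((p ℤ.+ q) ℤ.+ + 1 ℤ.- + 2 ℤ.* c) ℤ.+ (q ℤ.- p))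
  lemma₂ = solve-∀ ringℤ

mean-bounds′ : ∀ {p q} → q ℤ.< p → q ℤ.< up (p ℤ.+ q) × up (p ℤ.+ q) ℤ.≤ p
mean-bounds′ {p} {q} q<p = subst (λ z → q ℤ.< up z × up z ℤ.≤ p) (ℤ.+-comm q p) (mean-bounds q<p)

mean-refl : ∀ p → up (p ℤ.+ p) ≡ p
mean-refl p = up-unique (ℤ.≤-reflexive (lemma p)) (≤-by {r = + 1} (ℤ.+≤+ ℕ.z≤n) (cong (λ u → u ℤ.+ + 1) (lemma p)))
  where
  lemma : ∀ p → p ℤ.+ p ≡ + 2 ℤ.* p
  lemma = solve-∀ ringℤ

-- Where q is below p, the rounded mean lies strictly above q and at most at p, hence strictly
-- closer to p. Where q = p + 1 it is q itself and nothing is gained. Lack of progress thus leaves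
-- only p ≤ q, when the join is q.
toward : ∀ {m} (p q : Vec ℤ m) → (distance p (ceilMean p q) ℕ.< distance p q) ⊎
  (p ∨ q ≡ q × distance p (ceilMean p q) ℕ.≤ distance p q)
toward [] [] = inj₂ (refl , ℕ.z≤n)
toward (p ∷ ps) (q ∷ qs) with toward ps qs | q ℤ.<? p
... | inj₁ lt | yes q<p =
  inj₁ (ℕ.+-mono-≤-< (ℕ.<⇒≤ (closer-< (proj₁ (mean-bounds′ q<p)) (proj₂ (mean-bounds′ q<p)))) lt)
... | inj₂ (_ , le) | yes q<p =
  inj₁ (ℕ.+-mono-<-≤ (closer-< (proj₁ (mean-bounds′ q<p)) (proj₂ (mean-bounds′ q<p))) le)
... | r | no q≮p = combine r
  where
  p≤q : p ℤ.≤ q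
  p≤q = ℤ.≮⇒≥ q≮p
  le₀ : ℤ.∣ p ℤ.- up (p ℤ.+ q) ∣ ℕ.≤ ℤ.∣ p ℤ.- q ∣
  le₀ with p ℤ.<? q
  ... | yes p<q = closer-≤ (ℤ.<⇒≤ (proj₁ (mean-bounds p<q))) (proj₂ (mean-bounds p<q))
  ... | no  p≮q = subst (λ z → ℤ.∣ p ℤ.- up (p ℤ.+ z) ∣ ℕ.≤ ℤ.∣ p ℤ.- z ∣) (ℤ.≤-antisym p≤q (ℤ.≮⇒≥ p≮q))
    (ℕ.≤-reflexive (cong (λ z → ℤ.∣ p ℤ.- z ∣) (mean-refl p)))
  combine : _ → _
  combine (inj₁ lt) = inj₁ (ℕ.+-mono-≤-< le₀ lt)
  combine (inj₂ (eq , le)) = inj₂ (cong₂ _∷_ (ℤ.i≤j⇒i⊔j≡j p≤q) eq , ℕ.+-mono-≤ le₀ le)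

-- Joining with the mean lifts the smaller entry to the mean and keeps the larger one, so every
-- coordinate in which p and q differ makes progress.
between : ∀ {m} (p q : Vec ℤ m) → (distance (p ∨ ceilMean p q) (q ∨ ceilMean p q) ℕ.< distance p q) ⊎
  (p ≡ q × distance (p ∨ ceilMean p q) (q ∨ ceilMean p q) ℕ.≤ distance p q)
between [] [] = inj₂ (refl , ℕ.z≤n)
between (p ∷ ps) (q ∷ qs) = combine (heads (ℤ.<-cmp p q)) (between ps qs)
  where
  c : ℤ
  c = up (p ℤ.+ q)
  heads : _ → (ℤ.∣ (p ℤ.⊔ c) ℤ.- (q ℤ.⊔ c) ∣ ℕ.< ℤ.∣ p ℤ.- q ∣) ⊎
    (p ≡ q × ℤ.∣ (p ℤ.⊔ c) ℤ.- (q ℤ.⊔ c) ∣ ℕ.≤ ℤ.∣ p ℤ.- q ∣)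
  heads (tri< p<q _ _) with mean-bounds p<q
  ... | p<c , c≤q = inj₁ (subst₂ ℕ._<_
    (trans (ℤ.∣i-j∣≡∣j-i∣ q c) (sym (cong₂ (λ a b → ℤ.∣ a ℤ.- b ∣) (ℤ.i≤j⇒i⊔j≡j (ℤ.<⇒≤ p<c)) (ℤ.i≥j⇒i⊔j≡i c≤q))))
    (ℤ.∣i-j∣≡∣j-i∣ q p) (closer-< p<c c≤q))
  heads (tri> _ _ q<p) with mean-bounds′ q<p
  ... | q<c , c≤p = inj₁ (subst (ℕ._< ℤ.∣ p ℤ.- q ∣)
    (sym (cong₂ (λ a b → ℤ.∣ a ℤ.- b ∣) (ℤ.i≥j⇒i⊔j≡i c≤p) (ℤ.i≤j⇒i⊔j≡j (ℤ.<⇒≤ q<c)))) (closer-< q<c c≤p))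
  heads (tri≈ _ refl _) = inj₂ (refl , ℕ.≤-reflexive (cong (λ z → ℤ.∣ z ∣)
    (trans (ℤ.+-inverseʳ (p ℤ.⊔ c)) (sym (ℤ.+-inverseʳ p)))))
  combine : _ → _ → _
  combine (inj₁ lt) (inj₁ lt′) = inj₁ (ℕ.+-mono-< lt lt′)
  combine (inj₁ lt) (inj₂ (_ , le)) = inj₁ (ℕ.+-mono-<-≤ lt le)
  combine (inj₂ (_ , le)) (inj₁ lt) = inj₁ (ℕ.+-mono-≤-< le lt)
  combine (inj₂ (eq , le)) (inj₂ (eqs , les)) = inj₂ (cong₂ _∷_ eq eqs , ℕ.+-mono-≤ le les)

∨-comm : ∀ {m} (p q : Vec ℤ m) → p ∨ q ≡ q ∨ p
∨-comm = zipWith-comm ℤ.⊔-comm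

ceilMean-comm : ∀ {m} (p q : Vec ℤ m) → ceilMean p q ≡ ceilMean q p
ceilMean-comm = zipWith-comm (λ p q → cong up (ℤ.+-comm p q))

distance-comm : ∀ {m} (p q : Vec ℤ m) → distance p q ≡ distance q p
distance-comm [] [] = refl
distance-comm (p ∷ ps) (q ∷ qs) = cong₂ ℕ._+_ (ℤ.∣i-j∣≡∣j-i∣ p q) (distance-comm ps qs)

∨-absorbs-mean : ∀ {m} (p q : Vec ℤ m) → (p ∨ ceilMean p q) ∨ (q ∨ ceilMean p q) ≡ p ∨ q
∨-absorbs-mean [] [] = refl
∨-absorbs-mean (p ∷ ps) (q ∷ qs) = cong₂ _∷_ (heads (ℤ.<-cmp p q)) (∨-absorbs-mean ps qs)
  where
  heads : _ → (p ℤ.⊔ up (p ℤ.+ q)) ℤ.⊔ (q ℤ.⊔ up (p ℤ.+ q)) ≡ p ℤ.⊔ q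
  heads (tri< p<q _ _) with mean-bounds p<q
  ... | p<c , c≤q = trans (cong₂ ℤ._⊔_ (ℤ.i≤j⇒i⊔j≡j (ℤ.<⇒≤ p<c)) (ℤ.i≥j⇒i⊔j≡i c≤q))
    (trans (ℤ.i≤j⇒i⊔j≡j c≤q) (sym (ℤ.i≤j⇒i⊔j≡j (ℤ.<⇒≤ p<q))))
  heads (tri> _ _ q<p) with mean-bounds′ q<p
  ... | q<c , c≤p = trans (cong₂ ℤ._⊔_ (ℤ.i≥j⇒i⊔j≡i c≤p) (ℤ.i≤j⇒i⊔j≡j (ℤ.<⇒≤ q<c)))
    (trans (ℤ.i≥j⇒i⊔j≡i c≤p) (sym (ℤ.i≥j⇒i⊔j≡i (ℤ.<⇒≤ q<p))))
  heads (tri≈ _ refl _) = trans (ℤ.⊔-idem _) (cong (p ℤ.⊔_) (mean-refl p))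

-- The pairs (p, c), (q, c) and (p ∨ c, q ∨ c), where c = ⌈(p+q)/2⌉, are closer together than (p, q).
∨-closed : ∀ {m} (T : Vec ℤ m → Set) → (∀ p q → T p → T q → T (ceilMean p q)) →
  ∀ p q → T p → T q → T (p ∨ q)
∨-closed T mid p q = go (suc (distance p q)) p q ℕ.≤-refl
  where
  go : ∀ k p q → distance p q ℕ.< k → T p → T q → T (p ∨ q)
  go (suc k) p q (ℕ.s≤s d≤k) Tp Tq = step (toward p q) (toward q p) (between p q)
    where
    c : Vec ℤ _
    c = ceilMean p q
    Tc : T c
    Tc = mid p q Tp Tq
    step : _ → _ → _ → T (p ∨ q)
    step (inj₂ (p∨q≡q , _)) _ _ = subst T (sym p∨q≡q) Tq
    step _ (inj₂ (q∨p≡p , _)) _ = subst T (sym (trans (∨-comm p q) q∨p≡p)) Tp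
    step _ _ (inj₂ (p≡q , _)) = subst T (trans (sym (zipWith-idem ℤ.⊔-idem p)) (cong (p ∨_) p≡q)) Tp
    step (inj₁ pc) (inj₁ qc) (inj₁ uv) = subst T (∨-absorbs-mean p q)
      (go k _ _ (ℕ.<-≤-trans uv d≤k) (go k p c (ℕ.<-≤-trans pc d≤k) Tp Tc)
        (go k q c (ℕ.<-≤-trans (subst₂ ℕ._<_ (cong (distance q) (ceilMean-comm q p)) (distance-comm q p) qc) d≤k) Tq Tc))

negate : ∀ {m} → Vec ℤ m → Vec ℤ m
negate = map (λ a → ℤ.- a)

negate-involutive : ∀ {m} (p : Vec ℤ m) → negate (negate p) ≡ p
negate-involutive [] = refl
negate-involutive (p ∷ ps) = cong₂ _∷_ (ℤ.neg-involutive p) (negate-involutive ps)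

-- Negation turns meets into joins and rounding down into rounding up.
∧-closed : ∀ {m} (T : Vec ℤ m → Set) → (∀ p q → T p → T q → T (floorMean p q)) →
  ∀ p q → T p → T q → T (p ∧ q)
∧-closed T mid p q Tp Tq = subst T (∧≡ p q)
  (∨-closed (T ∘ negate) (λ p q Tp Tq → subst T (mean≡ p q) (mid (negate p) (negate q) Tp Tq)) (negate p) (negate q)
    (subst T (sym (negate-involutive p)) Tp) (subst T (sym (negate-involutive q)) Tq))
  where
  ∧≡ : ∀ {m} (p q : Vec ℤ m) → negate (negate p ∨ negate q) ≡ p ∧ q
  ∧≡ [] [] = refl
  ∧≡ (p ∷ ps) (q ∷ qs) = cong₂ _∷_ (trans (ℤ.neg-distrib-⊔-⊓ (ℤ.- p) (ℤ.- q)) (cong₂ ℤ._⊓_ (ℤ.neg-involutive p) (ℤ.neg-involutive q))) (∧≡ ps qs)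
  mean≡ : ∀ {m} (p q : Vec ℤ m) → floorMean (negate p) (negate q) ≡ negate (ceilMean p q)
  mean≡ [] [] = refl
  mean≡ (p ∷ ps) (q ∷ qs) = cong₂ _∷_ (trans (cong down (sym (ℤ.neg-distrib-+ p q)))
    (trans (sym (ℤ.neg-involutive _)) (cong (λ a → ℤ.- a) (sym (up≡-down- (p ℤ.+ q)))))) (mean≡ ps qs)

-- x is the join over u of the meets over v of the witnesses w⟨u,v⟩.
two-coordinate-interpolation : ∀ {m} (T : Vec ℤ m → Set) →
  (∀ p q → T p → T q → T (p ∨ q)) → (∀ p q → T p → T q → T (p ∧ q)) → Fin m → (x : Vec ℤ m) →
  (∀ u v → ¬ ¬ (∃[ w ] (T w × lookup w u ≡ lookup x u × lookup w v ℤ.≤ lookup x v))) → ¬ ¬ T x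
two-coordinate-interpolation {m} T join meet u₀ x wit =
  joins (List.allFin m) >>= λ { (z , Tz , _ , z≡) → pure (subst T (vec-ext (λ u → All.lookup z≡ (∈-allFin u))) Tz) }
  where
  meets : ∀ u vs → ¬ ¬ (∃[ z ] (T z × lookup z u ≡ lookup x u × All (λ v → lookup z v ℤ.≤ lookup x v) vs))
  meets u [] = wit u u >>= λ { (w , Tw , w≡ , _) → pure (w , Tw , w≡ , []) }
  meets u (v ∷ vs) = wit u v >>= λ { (w , Tw , w≡ , w≤) → meets u vs >>= λ { (z , Tz , z≡ , z≤) → pure
    (w ∧ z , meet w z Tw Tz ,
     trans (lookup-zipWith ℤ._⊓_ u w z) (trans (cong₂ ℤ._⊓_ w≡ z≡) (ℤ.⊓-idem _)) ,
     subst (ℤ._≤ lookup x v) (sym (lookup-zipWith ℤ._⊓_ v w z)) (ℤ.≤-trans (ℤ.i⊓j≤i _ _) w≤) ∷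
     All.map (λ {v} h → subst (ℤ._≤ lookup x v) (sym (lookup-zipWith ℤ._⊓_ v w z)) (ℤ.≤-trans (ℤ.i⊓j≤j _ _) h)) z≤) } }

  meet-all : ∀ u → ¬ ¬ (∃[ z ] (T z × lookup z u ≡ lookup x u × (∀ v → lookup z v ℤ.≤ lookup x v)))
  meet-all u = meets u (List.allFin m) >>= λ { (z , Tz , z≡ , z≤) → pure (z , Tz , z≡ , λ v → All.lookup z≤ (∈-allFin v)) }

  joins : ∀ us → ¬ ¬ (∃[ z ] (T z × (∀ v → lookup z v ℤ.≤ lookup x v) × All (λ u → lookup z u ≡ lookup x u) us))
  joins [] = meet-all u₀ >>= λ { (z , Tz , _ , z≤) → pure (z , Tz , z≤ , []) }
  joins (u ∷ us) = meet-all u >>= λ { (w , Tw , w≡ , w≤) → joins us >>= λ { (z , Tz , z≤ , z≡) → pure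
    (w ∨ z , join w z Tw Tz ,
     (λ v → subst (ℤ._≤ lookup x v) (sym (lookup-zipWith ℤ._⊔_ v w z)) (ℤ.⊔-lub (w≤ v) (z≤ v))) ,
     trans (lookup-zipWith ℤ._⊔_ u w z) (trans (cong (ℤ._⊔ lookup z u) w≡) (ℤ.i≥j⇒i⊔j≡i (z≤ u))) ∷
     All.map (λ {v} h → trans (lookup-zipWith ℤ._⊔_ v w z) (trans (cong (lookup w v ℤ.⊔_) h) (ℤ.i≤j⇒i⊔j≡j (w≤ v)))) z≡) } }

-- L♮-convex sets

shift : ∀ {n} → ℤ → Vec ℤ n → Vec ℤ n
shift c = map (λ a → a ℤ.- c)

-- The set of all (x₀, x) with x − x₀·1 ∈ S, in which translation is just one more coordinate.
Lifted : ∀ {n} → ZSet n → Vec ℤ (suc n) → Set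
Lifted S (x₀ ∷ x) = ¬ ¬ S (shift x₀ x)

private
  sum-shift : ∀ x y a b → a ℤ.+ b ≡ ((a ℤ.- x) ℤ.+ (b ℤ.- y)) ℤ.+ (x ℤ.+ y)
  sum-shift = solve-∀ ringℤ

  up-2* : ∀ k → up (+ 2 ℤ.* k) ≡ k
  up-2* k = up-unique ℤ.≤-refl (≤-by {r = + 1} (ℤ.+≤+ ℕ.z≤n) refl)

  down-2* : ∀ k → down (+ 2 ℤ.* k) ≡ k
  down-2* k = down-unique ℤ.≤-refl (≤-by {r = + 1} (ℤ.+≤+ ℕ.z≤n) refl)

  odd-shift : ∀ w k → w ℤ.+ (+ 1 ℤ.+ + 2 ℤ.* k) ≡ (w ℤ.+ + 2 ℤ.* k) ℤ.+ + 1
  odd-shift = solve-∀ ringℤ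

  up-odd : ∀ w k → up (w ℤ.+ (+ 1 ℤ.+ + 2 ℤ.* k)) ≡ down w ℤ.+ k ℤ.+ + 1
  up-odd w k = trans (cong up (odd-shift w k)) (trans (up-suc (w ℤ.+ + 2 ℤ.* k)) (cong (λ u → u ℤ.+ + 1) (down-even w k)))

  down-odd : ∀ w k → down (w ℤ.+ (+ 1 ℤ.+ + 2 ℤ.* k)) ≡ up w ℤ.+ k
  down-odd w k = trans (cong down (odd-shift w k)) (trans (down-suc (w ℤ.+ + 2 ℤ.* k)) (up-even w k))

  difference-cancel : ∀ {s t w k} → s ≡ w ℤ.+ k → t ≡ + 0 ℤ.+ k → s ℤ.- t ≡ w
  difference-cancel {w = w} {k} refl refl = lemma w k
    where
    lemma : ∀ w k → w ℤ.+ k ℤ.- (+ 0 ℤ.+ k) ≡ w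
    lemma = solve-∀ ringℤ

  mean-shift : ∀ (f g : ℤ → ℤ) x₀ y₀ → (∀ w → f (w ℤ.+ (x₀ ℤ.+ y₀)) ℤ.- f (x₀ ℤ.+ y₀) ≡ g w) →
    ∀ {n} (x y : Vec ℤ n) →
    shift (f (x₀ ℤ.+ y₀)) (zipWith (λ a b → f (a ℤ.+ b)) x y) ≡
    zipWith (λ a b → g (a ℤ.+ b)) (shift x₀ x) (shift y₀ y)
  mean-shift f g x₀ y₀ h [] [] = refl
  mean-shift f g x₀ y₀ h (a ∷ x) (b ∷ y) = cong₂ _∷_
    (trans (cong (λ z → f z ℤ.- f (x₀ ℤ.+ y₀)) (sum-shift x₀ y₀ a b)) (h ((a ℤ.- x₀) ℤ.+ (b ℤ.- y₀))))
    (mean-shift f g x₀ y₀ h x y)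

module _ {n} {S : ZSet n} (S-LNat : IsLNat S) where

  private
    ceil-closed : ∀ {p q} → ¬ ¬ S p → ¬ ¬ S q → ¬ ¬ S (ceilMean p q)
    ceil-closed {p} {q} ¬¬Sp ¬¬Sq = ¬¬Sp >>= λ Sp → ¬¬Sq >>= λ Sq → pure (proj₁ (lower (S-LNat p q Sp Sq)))

    floor-closed : ∀ {p q} → ¬ ¬ S p → ¬ ¬ S q → ¬ ¬ S (floorMean p q)
    floor-closed {p} {q} ¬¬Sp ¬¬Sq = ¬¬Sp >>= λ Sp → ¬¬Sq >>= λ Sq → pure (proj₂ (lower (S-LNat p q Sp Sq)))

  -- Subtracting the rounded mean of x₀ and y₀ from the other rounded means leaves rounded means of
  -- the shifted vectors. For even x₀ + y₀ the direction of rounding stays the same; for odd x₀ + y₀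
  -- it is reversed. So closure of `S` under both midpoints is used.
  Lifted-ceilMean : ∀ x y → Lifted S x → Lifted S y → Lifted S (ceilMean x y)
  Lifted-ceilMean (x₀ ∷ x) (y₀ ∷ y) Tx Ty with parity (x₀ ℤ.+ y₀)
  ... | k , inj₁ even = subst (λ z → ¬ ¬ S z) (sym (mean-shift up up x₀ y₀
    (λ w → difference-cancel {k = k} (trans (cong (λ z → up (w ℤ.+ z)) even) (up-even w k))
      (trans (cong up even) (trans (up-2* k) (sym (ℤ.+-identityˡ k))))) x y)) (ceil-closed Tx Ty)
  ... | k , inj₂ odd = subst (λ z → ¬ ¬ S z) (sym (mean-shift up down x₀ y₀
    (λ w → difference-cancel {k = k ℤ.+ + 1} (trans (cong (λ z → up (w ℤ.+ z)) odd) (trans (up-odd w k) (ℤ.+-assoc (down w) k (+ 1))))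
      (trans (cong up odd) (trans (cong up (ℤ.+-comm (+ 1) (+ 2 ℤ.* k))) (trans (up-suc (+ 2 ℤ.* k))
        (trans (cong (λ z → z ℤ.+ + 1) (down-2* k)) (sym (ℤ.+-identityˡ _))))))) x y)) (floor-closed Tx Ty)

  Lifted-floorMean : ∀ x y → Lifted S x → Lifted S y → Lifted S (floorMean x y)
  Lifted-floorMean (x₀ ∷ x) (y₀ ∷ y) Tx Ty with parity (x₀ ℤ.+ y₀)
  ... | k , inj₁ even = subst (λ z → ¬ ¬ S z) (sym (mean-shift down down x₀ y₀
    (λ w → difference-cancel {k = k} (trans (cong (λ z → down (w ℤ.+ z)) even) (down-even w k))
      (trans (cong down even) (trans (down-2* k) (sym (ℤ.+-identityˡ k))))) x y)) (floor-closed Tx Ty)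
  ... | k , inj₂ odd = subst (λ z → ¬ ¬ S z) (sym (mean-shift down up x₀ y₀
    (λ w → difference-cancel {k = k} (trans (cong (λ z → down (w ℤ.+ z)) odd) (down-odd w k))
      (trans (cong down odd) (trans (cong down (ℤ.+-comm (+ 1) (+ 2 ℤ.* k))) (trans (down-suc (+ 2 ℤ.* k))
        (trans (up-2* k) (sym (ℤ.+-identityˡ k))))))) x y)) (ceil-closed Tx Ty)

  -- The lifted set contains all translates of a witness along the all-ones direction. The translate
  -- that agrees with `x` at `u` is at most `x` at `v`, by the hypothesis on the difference; this is
  -- the witness that interpolation asks for.
  LNat-interpolation : ∀ x → (∀ u v → ¬ ¬ (∃[ w ] (S w × dotᶻ (pairRow (u , v)) x ℤ.≤ dotᶻ (pairRow (u , v)) w))) → ¬ ¬ S x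
  LNat-interpolation x wit = two-coordinate-interpolation (Lifted S)
    (∨-closed (Lifted S) Lifted-ceilMean) (∧-closed (Lifted S) Lifted-floorMean) zero (+ 0 ∷ x)
    (λ u v → wit u v >>= λ { (w , Sw , h) → pure (translate u v w Sw
      (subst₂ ℤ._≤_ (dotᶻ-pairRow u v x) (dotᶻ-pairRow u v w) h)) })
    >>= subst (λ z → ¬ ¬ S z) (shift-0 x)
    where
    shift-0 : ∀ {m} (y : Vec ℤ m) → shift (+ 0) y ≡ y
    shift-0 [] = refl
    shift-0 (y ∷ ys) = cong₂ _∷_ (ℤ.+-identityʳ y) (shift-0 ys)
    shift-back : ∀ c {m} (y : Vec ℤ m) → shift (+ 0 ℤ.+ c) (map (λ a → a ℤ.+ c) y) ≡ y
    shift-back c [] = refl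
    shift-back c (y ∷ ys) = cong₂ _∷_ (lemma y c) (shift-back c ys)
      where
      lemma : ∀ y c → y ℤ.+ c ℤ.- (+ 0 ℤ.+ c) ≡ y
      lemma = solve-∀ ringℤ
    translate : ∀ u v w → S w → lift₀ x u ℤ.- lift₀ x v ℤ.≤ lift₀ w u ℤ.- lift₀ w v →
      ∃[ w′ ] (Lifted S w′ × lookup w′ u ≡ lift₀ x u × lookup w′ v ℤ.≤ lift₀ x v)
    translate u v w Sw h = map (λ a → a ℤ.+ c) (+ 0 ∷ w) , pure (subst S (sym (shift-back c w)) Sw) ,
      trans (lookup-map u (λ a → a ℤ.+ c) (+ 0 ∷ w)) (lemma₁ (lift₀ w u) (lift₀ x u)) ,
      subst (ℤ._≤ lift₀ x v) (sym (lookup-map v (λ a → a ℤ.+ c) (+ 0 ∷ w)))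
        (≤-by (≤-difference h) (lemma₂ (lift₀ w u) (lift₀ x u) (lift₀ w v) (lift₀ x v)))
      where
      c : ℤ
      c = lift₀ x u ℤ.- lift₀ w u
      lemma₁ : ∀ w x → w ℤ.+ (x ℤ.- w) ≡ x
      lemma₁ = solve-∀ ringℤ
      lemma₂ : ∀ wu xu wv xv → xv ≡ (wv ℤ.+ (xu ℤ.- wu)) ℤ.+ ((wu ℤ.- wv) ℤ.- (xu ℤ.- xv))
      lemma₂ = solve-∀ ringℤ

-- Recession cones of L♮-convex sets

allPairs : ∀ n → List (Fin (suc n) × Fin (suc n))
allPairs n = List.cartesianProductWith _,_ (List.allFin (suc n)) (List.allFin (suc n))

pairRows : ∀ {n} → List (Fin (suc n) × Fin (suc n)) → List (Vec ℤ n)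
pairRows = List.map pairRow

-- Witnesses for interpolation at `s + d`: where the difference is bounded on `S`, `d` does not
-- increase it and `s` itself serves; where it is unbounded, some point of `S` exceeds the value at
-- `s + d`, since otherwise that value would be a bound.
LNat-recedes : ∀ {n} {S : ZSet n} → IsLNat S →
  ¬ ¬ (∃[ E ] (E ∈ sublists (allPairs n) × RecedesAlong S (pairRows E)))
LNat-recedes {n} {S} S-LNat = ¬¬-select (BoundedOn S ∘ pairRow) (allPairs n) >>=
  λ { (E , E∈ , E-bounded , E⊇) → pure (E , E∈ , record
    { rows-bounded = All.map⁺ E-bounded
    ; translates = λ d Ed s Ss → LNat-interpolation S-LNat (s +ᶻ d) λ u v →
        ¬¬-excluded-middle >>= λ
          { (yes b) → pure (s , Ss , ≤-by (≤-difference (All.lookup Ed (∈-map⁺ pairRow (E⊇ (∈-cartesianProductWith⁺ _,_ (∈-allFin u) (∈-allFin v)) b))))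
              (trans (lemma (dotᶻ (pairRow (u , v)) s) (dotᶻ (pairRow (u , v)) d))
                (cong (λ z → z ℤ.+ (+ 0 ℤ.- dotᶻ (pairRow (u , v)) d)) (sym (dotᶻ-+ (pairRow (u , v)) s d)))))
          ; (no ¬b) → λ none → ¬b (dotᶻ (pairRow (u , v)) (s +ᶻ d) , λ w Sw →
              ℤ.<⇒≤ (ℤ.≰⇒> (λ h → none (w , Sw , h)))) } }) }
  where
  lemma : ∀ s d → s ≡ (s ℤ.+ d) ℤ.+ (+ 0 ℤ.- d)
  lemma = solve-∀ ringℤ

lift₀-zipWith : ∀ (f : ℤ → ℤ → ℤ) → f (+ 0) (+ 0) ≡ + 0 → ∀ {n} (x y : Vec ℤ n) u →
  lift₀ (zipWith f x y) u ≡ f (lift₀ x u) (lift₀ y u)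
lift₀-zipWith f f0 x y zero = sym f0
lift₀-zipWith f f0 x y (suc i) = lookup-zipWith f i x y

-- Each row says that one coordinate of (0, x) is at most another, and rounded means are monotone.
-- Index 0 takes part because the mean of zeros is 0.
pairCone-LNat : ∀ {n} (E : List (Fin (suc n) × Fin (suc n))) → IsLNat (IntCone (pairRows E))
pairCone-LNat [] p q _ _ = lift ([] , [])
pairCone-LNat ((u , v) ∷ E) p q (hp ∷ Ep) (hq ∷ Eq) with lower (pairCone-LNat E p q Ep Eq)
... | Ec , Ef = lift (close up up-mono refl ∷ Ec , close down down-mono refl ∷ Ef)
  where
  ordered : ∀ x → dotᶻ (pairRow (u , v)) x ℤ.≤ + 0 → lift₀ x u ℤ.≤ lift₀ x v
  ordered x h = ℤ.i-j≤0⇒i≤j (subst (ℤ._≤ + 0) (dotᶻ-pairRow u v x) h)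
  close : ∀ (f : ℤ → ℤ) → (∀ {a b} → a ℤ.≤ b → f a ℤ.≤ f b) → f (+ 0) ≡ + 0 →
    dotᶻ (pairRow (u , v)) (zipWith (λ a b → f (a ℤ.+ b)) p q) ℤ.≤ + 0
  close f f-mono f0 = subst (ℤ._≤ + 0) (sym (dotᶻ-pairRow u v (zipWith (λ a b → f (a ℤ.+ b)) p q))) (ℤ.i≤j⇒i-j≤0
    (subst₂ ℤ._≤_ (sym (lift₀-zipWith (λ a b → f (a ℤ.+ b)) f0 p q u)) (sym (lift₀-zipWith (λ a b → f (a ℤ.+ b)) f0 p q v))
      (f-mono (ℤ.+-mono-≤ (ordered p hp) (ordered q hq)))))

down-refl : ∀ p → down (p ℤ.+ p) ≡ p
down-refl p = trans (cong down (lemma p)) (trans (down-even (+ 0) p) (ℤ.+-identityˡ p))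
  where
  lemma : ∀ p → p ℤ.+ p ≡ + 0 ℤ.+ + 2 ℤ.* p
  lemma = solve-∀ ringℤ

InBox : ∀ {n} → ZSet n → ℕ → ZSet n
InBox S N x = S x × Box (+ N) x

Box-LNat : ∀ {n} {S : ZSet n} → IsLNat S → ∀ N → IsLNat (InBox S N)
Box-LNat {S = S} S-LNat N p q (Sp , p∈) (Sq , q∈) with lower (S-LNat p q Sp Sq)
... | Sc , Sf = lift ((Sc , in-box up up-mono mean-refl) , (Sf , in-box down down-mono down-refl))
  where
  in-box : ∀ (f : ℤ → ℤ) → (∀ {a b} → a ℤ.≤ b → f a ℤ.≤ f b) → (∀ a → f (a ℤ.+ a) ≡ a) →
    Box (+ N) (zipWith (λ a b → f (a ℤ.+ b)) p q)
  in-box f f-mono f-refl i =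
    subst₂ ℤ._≤_ (f-refl (ℤ.- + N)) (sym eq) (f-mono (ℤ.+-mono-≤ (proj₁ (p∈ i)) (proj₁ (q∈ i)))) ,
    subst₂ ℤ._≤_ (sym eq) (f-refl (+ N)) (f-mono (ℤ.+-mono-≤ (proj₂ (p∈ i)) (proj₂ (q∈ i))))
    where
    eq : lookup (zipWith (λ a b → f (a ℤ.+ b)) p q) i ≡ f (lookup p i ℤ.+ lookup q i)
    eq = lookup-zipWith (λ a b → f (a ℤ.+ b)) i p q

box-truncation : ∀ {n} {A : ZSet n → Set₁} {S : ZSet n} → (∀ N → A (InBox S N)) → Truncation A S
box-truncation {S = S} class = record
  { part          = InBox S
  ; part⊆         = λ N x → proj₁
  ; part-exhausts = λ x Sx → proj₁ (in-some-box x) , λ M le → Sx , proj₂ (in-some-box x) M le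
  ; part-bounded  = λ N → + N , λ x → proj₂
  ; part-class    = λ N _ → class N
  }

-- The interface through which L♮, M♮ and M share one search, and through which intersections are
-- reduced to their two members.
record ConeFamily {n} (A : ZSet n → Set₁) : Set₁ where
  field
    cones      : List (List (Vec ℤ n))
    cone-class : ∀ B → B ∈ cones → A (IntCone B)
    recedes    : ∀ {S} → A S → NonemptyZ S → ¬ ¬ (∃[ B ] (B ∈ cones × RecedesAlong S B))
    box-class  : ∀ {S} → A S → ∀ N → A (InBox S N)

decompose-by-family : ∀ {n} {A : ZSet n → Set₁} → ConeFamily A →
  ∀ {P} → IsPolyhedron P → IsClassPolyhedron A P → HasDecomposition A P
decompose-by-family F P-poly (S , S-nonempty , S-class , lift P≐conv) =
  decompose-by-search P-poly S-nonempty P≐conv (box-truncation (box-class S-class)) cones cone-class (recedes S-class S-nonempty)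
  where open ConeFamily F

LNat-cones : ∀ n → ConeFamily (IsLNat {n})
LNat-cones n = record
  { cones      = List.map pairRows (sublists (allPairs n))
  ; cone-class = λ B B∈ → case ∈-map⁻ pairRows B∈ of λ { (E , _ , refl) → pairCone-LNat E }
  ; recedes    = λ S-LNat _ → LNat-recedes S-LNat >>= λ { (E , E∈ , rec) → pure (pairRows E , ∈-map⁺ pairRows E∈ , rec) }
  ; box-class  = Box-LNat
  }

-- Multimodular sets

Image-D : ∀ {n} → ZSet n → ZSet n
Image-D T x = ∃[ y ] (T y × x ≡ D y)

partialSums : ∀ {n} → ℤ → Vec ℤ n → Vec ℤ n
partialSums a [] = []
partialSums a (x ∷ xs) = (a ℤ.+ x) ∷ partialSums (a ℤ.+ x) xs

D⁻¹ : ∀ {n} → Vec ℤ n → Vec ℤ n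
D⁻¹ = partialSums (+ 0)

D-D⁻¹ : ∀ {n} (x : Vec ℤ n) → D (D⁻¹ x) ≡ x
D-D⁻¹ [] = refl
D-D⁻¹ (x ∷ xs) = cong₂ _∷_ (ℤ.+-identityˡ x) (differences (+ 0 ℤ.+ x) xs)
  where
  differences : ∀ a {n} (xs : Vec ℤ n) → tail (D (a ∷ partialSums a xs)) ≡ xs
  differences a [] = refl
  differences a (x ∷ xs) = cong₂ _∷_ (lemma a x) (differences (a ℤ.+ x) xs)
    where
    lemma : ∀ a x → a ℤ.+ x ℤ.- a ≡ x
    lemma = solve-∀ ringℤ

D⁻¹-D : ∀ {n} (y : Vec ℤ n) → D⁻¹ (D y) ≡ y
D⁻¹-D [] = refl
D⁻¹-D (y ∷ ys) = cong₂ _∷_ (ℤ.+-identityˡ y) (sums (+ 0 ℤ.+ y) y (ℤ.+-identityˡ y) ys)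
  where
  sums : ∀ a a′ → a ≡ a′ → ∀ {n} (ys : Vec ℤ n) → partialSums a (tail (D (a′ ∷ ys))) ≡ ys
  sums a _ refl [] = refl
  sums a _ refl (y ∷ ys) = cong₂ _∷_ (lemma a y) (sums (a ℤ.+ (y ℤ.- a)) y (lemma a y) ys)
    where
    lemma : ∀ a y → a ℤ.+ (y ℤ.- a) ≡ y
    lemma = solve-∀ ringℤ

D-+ : ∀ {n} (x y : Vec ℤ n) → D (x +ᶻ y) ≡ D x +ᶻ D y
D-+ [] [] = refl
D-+ (x ∷ xs) (y ∷ ys) = cong ((x ℤ.+ y) ∷_) (differences x y xs ys)
  where
  differences : ∀ a b {n} (xs ys : Vec ℤ n) →
    tail (D ((a ℤ.+ b) ∷ (xs +ᶻ ys))) ≡ tail (D (a ∷ xs)) +ᶻ tail (D (b ∷ ys))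
  differences a b [] [] = refl
  differences a b (x ∷ xs) (y ∷ ys) = cong₂ _∷_ (lemma x y a b) (differences x y xs ys)
    where
    lemma : ∀ x y a b → x ℤ.+ y ℤ.- (a ℤ.+ b) ≡ (x ℤ.- a) ℤ.+ (y ℤ.- b)
    lemma = solve-∀ ringℤ

D-Box : ∀ {n} (N : ℕ) (y : Vec ℤ n) → Box (+ N) y → Box (+ N ℤ.+ + N) (D y)
D-Box N (y ∷ ys) y∈ zero =
  ≤-by (≤-difference (proj₁ (y∈ zero)) ⊕ ℤ.+≤+ {0} {N} ℕ.z≤n) (lemma₁ (+ N) y) ,
  ≤-by (≤-difference (proj₂ (y∈ zero)) ⊕ ℤ.+≤+ {0} {N} ℕ.z≤n) (lemma₂ (+ N) y)
  where
  lemma₁ : ∀ N y → y ≡ ℤ.- (N ℤ.+ N) ℤ.+ ((y ℤ.- ℤ.- N) ℤ.+ N)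
  lemma₁ = solve-∀ ringℤ
  lemma₂ : ∀ N y → N ℤ.+ N ≡ y ℤ.+ ((N ℤ.- y) ℤ.+ N)
  lemma₂ = solve-∀ ringℤ
D-Box N (y ∷ ys) y∈ (suc i) = differences y ys (y∈ zero) (λ i → y∈ (suc i)) i
  where
  differences : ∀ a {n} (ys : Vec ℤ n) → (ℤ.- + N ℤ.≤ a × a ℤ.≤ + N) → Box (+ N) ys → Box (+ N ℤ.+ + N) (tail (D (a ∷ ys)))
  differences a (y ∷ ys) (la , ua) ys∈ zero =
    ≤-by (≤-difference (proj₁ (ys∈ zero)) ⊕ ≤-difference ua) (lemma₁ (+ N) a y) ,
    ≤-by (≤-difference (proj₂ (ys∈ zero)) ⊕ ≤-difference la) (lemma₂ (+ N) a y)
    where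
    lemma₁ : ∀ N a y → y ℤ.- a ≡ ℤ.- (N ℤ.+ N) ℤ.+ ((y ℤ.- ℤ.- N) ℤ.+ (N ℤ.- a))
    lemma₁ = solve-∀ ringℤ
    lemma₂ : ∀ N a y → N ℤ.+ N ≡ (y ℤ.- a) ℤ.+ ((N ℤ.- y) ℤ.+ (a ℤ.- ℤ.- N))
    lemma₂ = solve-∀ ringℤ
  differences a (y ∷ ys) _ ys∈ (suc i) = differences y ys (ys∈ zero) (λ i → ys∈ (suc i)) i

total : ∀ {n} → Vec ℤ n → ℤ
total [] = + 0
total (x ∷ xs) = x ℤ.+ total xs

-- The transpose of D⁻¹
suffixSums : ∀ {n} → Vec ℤ n → Vec ℤ n
suffixSums [] = []
suffixSums (q ∷ qs) = (q ℤ.+ total qs) ∷ suffixSums qs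

dotᶻ-suffixSums : ∀ {n} (q x : Vec ℤ n) → dotᶻ (suffixSums q) x ≡ dotᶻ q (D⁻¹ x)
dotᶻ-suffixSums q x = sym (trans (general (+ 0) q x) (ℤ.+-identityˡ _))
  where
  general : ∀ a {n} (q x : Vec ℤ n) → dotᶻ q (partialSums a x) ≡ a ℤ.* total q ℤ.+ dotᶻ (suffixSums q) x
  general a [] [] = sym (trans (ℤ.+-identityʳ _) (ℤ.*-zeroʳ a))
  general a (q ∷ qs) (x ∷ xs) = trans (cong (λ z → q ℤ.* (a ℤ.+ x) ℤ.+ z) (general (a ℤ.+ x) qs xs))
    (lemma q a x (total qs) (dotᶻ (suffixSums qs) xs))
    where
    lemma : ∀ q a x t s → q ℤ.* (a ℤ.+ x) ℤ.+ ((a ℤ.+ x) ℤ.* t ℤ.+ s) ≡ a ℤ.* (q ℤ.+ t) ℤ.+ ((q ℤ.+ t) ℤ.* x ℤ.+ s)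
    lemma = solve-∀ ringℤ

dotᶻ-suffixSums-D : ∀ {n} (q y : Vec ℤ n) → dotᶻ (suffixSums q) (D y) ≡ dotᶻ q y
dotᶻ-suffixSums-D q y = trans (dotᶻ-suffixSums q (D y)) (cong (dotᶻ q) (D⁻¹-D y))

IntCone-D⁻¹ : ∀ {n} (B : List (Vec ℤ n)) {x} → IntCone (List.map suffixSums B) x → IntCone B (D⁻¹ x)
IntCone-D⁻¹ B {x} = All.map (λ {r} → subst (ℤ._≤ + 0) (dotᶻ-suffixSums r x)) ∘ All.map⁻

IntCone-D : ∀ {n} (B : List (Vec ℤ n)) {y} → IntCone B y → IntCone (List.map suffixSums B) (D y)
IntCone-D B {y} = All.map⁺ ∘ All.map λ {r} → subst (ℤ._≤ + 0) (sym (dotᶻ-suffixSums-D r y))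

-- Points are carried over by `D` and functionals by the transpose of its inverse, which preserves
-- all values. As the inverse is integral, an integer direction of the image comes from an integer
-- direction of `T`.
RecedesAlong-D : ∀ {n} {T : ZSet n} {B} → RecedesAlong T B → RecedesAlong (Image-D T) (List.map suffixSums B)
RecedesAlong-D {T = T} {B} rec = record
  { rows-bounded = All.map⁺ (All.map (λ { {r} (M , T≤M) → M , λ { _ (y , Ty , refl) →
      subst (ℤ._≤ M) (sym (dotᶻ-suffixSums-D r y)) (T≤M y Ty) } }) rows-bounded)
  ; translates = λ { d Bd _ (y , Ty , refl) → translates (D⁻¹ d) (IntCone-D⁻¹ B Bd) y Ty >>= λ Ty′ →
      pure (y +ᶻ D⁻¹ d , Ty′ , sym (trans (D-+ y (D⁻¹ d)) (cong (D y +ᶻ_) (D-D⁻¹ d)))) }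
  }
  where open RecedesAlong rec

multimodular-truncation : ∀ {n} {T : ZSet n} → IsLNat T → Truncation IsMultimodular (Image-D T)
multimodular-truncation {T = T} T-LNat = record
  { part          = λ N → Image-D (InBox T N)
  ; part⊆         = λ { N x (y , (Ty , _) , eq) → y , Ty , eq }
  ; part-exhausts = λ { x (y , Ty , eq) → proj₁ (in-some-box y) , λ M le → y , (Ty , proj₂ (in-some-box y) M le) , eq }
  ; part-bounded  = λ N → + N ℤ.+ + N , λ { _ (y , (_ , y∈) , refl) → D-Box N y y∈ }
  ; part-class    = λ { N (x , y , y∈ , _) → InBox T N , (y , y∈) , Box-LNat T-LNat N , lift (λ x → mk⇔ id id) }
  }

decompose-multimodular : ∀ {n} {P : QSet n} → IsPolyhedron P → IsClassPolyhedron IsMultimodular P → HasDecomposition IsMultimodular P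
decompose-multimodular {n} P-poly (S , _ , (T , (t , Tt) , T-LNat , lift S≐) , lift P≐conv) =
  decompose-by-search P-poly (D t , t , Tt , refl) (≐-trans P≐conv (conv-cong S≐)) (multimodular-truncation T-LNat)
    (List.map (List.map suffixSums ∘ pairRows) (sublists (allPairs n)))
    (λ B B∈ → case ∈-map⁻ (List.map suffixSums ∘ pairRows) B∈ of λ { (E , _ , refl) →
      IntCone (pairRows E) , (0ᶻ , IntCone-0 _) , pairCone-LNat E , lift (λ x → mk⇔
        (λ h → D⁻¹ x , IntCone-D⁻¹ (pairRows E) h , sym (D-D⁻¹ x))
        (λ { (y , Ey , refl) → IntCone-D (pairRows E) Ey })) })
    (LNat-recedes T-LNat >>= λ { (E , E∈ , rec) →
      pure (_ , ∈-map⁺ (List.map suffixSums ∘ pairRows) E∈ , RecedesAlong-D rec) })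

-- Set functionals

χ : Bool → ℤ
χ true = + 1
χ false = + 0

-- x̂ = (−Σᵢ xᵢ, x): the coordinate 0 makes every x sum to zero, and setRow X evaluates x̂(X).
hat : ∀ {n} → Vec ℤ n → Vec ℤ (suc n)
hat x = (ℤ.- total x) ∷ x

indicator : ∀ {m} → Subset m → Vec ℤ m
indicator = map χ

setRow : ∀ {n} → Subset (suc n) → Vec ℤ n
setRow (b ∷ X) = map (λ c → χ c ℤ.- χ b) X

dotᶻ-setRow : ∀ {n} (X : Subset (suc n)) x → dotᶻ (setRow X) x ≡ dotᶻ (indicator X) (hat x)
dotᶻ-setRow (b ∷ X) x = trans (general X x) (lemma (χ b) (total x) (dotᶻ (indicator X) x))
  where
  general : ∀ {m} (X : Subset m) (x : Vec ℤ m) →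
    dotᶻ (map (λ c → χ c ℤ.- χ b) X) x ≡ dotᶻ (indicator X) x ℤ.- χ b ℤ.* total x
  general [] [] = sym (cong (λ z → + 0 ℤ.- z) (ℤ.*-zeroʳ (χ b)))
  general (c ∷ X) (x ∷ xs) = trans (cong (λ z → (χ c ℤ.- χ b) ℤ.* x ℤ.+ z) (general X xs))
    (lemma₀ (χ c) (χ b) x (dotᶻ (indicator X) xs) (total xs))
    where
    lemma₀ : ∀ c b x d t → (c ℤ.- b) ℤ.* x ℤ.+ (d ℤ.- b ℤ.* t) ≡ c ℤ.* x ℤ.+ d ℤ.- b ℤ.* (x ℤ.+ t)
    lemma₀ = solve-∀ ringℤ
  lemma : ∀ b t d → d ℤ.- b ℤ.* t ≡ b ℤ.* (ℤ.- t) ℤ.+ d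
  lemma = solve-∀ ringℤ

indicator-modular : ∀ {m} (X Y : Subset m) w →
  dotᶻ (indicator (X ∪ Y)) w ℤ.+ dotᶻ (indicator (X ∩ Y)) w ≡ dotᶻ (indicator X) w ℤ.+ dotᶻ (indicator Y) w
indicator-modular [] [] [] = refl
indicator-modular (a ∷ X) (b ∷ Y) (w ∷ ws) =
  trans (interchange (χ (a ∨ᵇ b) ℤ.* w) (dotᶻ (indicator (X ∪ Y)) ws) (χ (a ∧ᵇ b) ℤ.* w) (dotᶻ (indicator (X ∩ Y)) ws))
    (trans (cong₂ ℤ._+_ (heads a b) (indicator-modular X Y ws))
      (interchange (χ a ℤ.* w) (χ b ℤ.* w) (dotᶻ (indicator X) ws) (dotᶻ (indicator Y) ws)))
  where
  interchange : ∀ a b c d → (a ℤ.+ b) ℤ.+ (c ℤ.+ d) ≡ (a ℤ.+ c) ℤ.+ (b ℤ.+ d)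
  interchange = solve-∀ ringℤ
  heads : ∀ a b → χ (a ∨ᵇ b) ℤ.* w ℤ.+ χ (a ∧ᵇ b) ℤ.* w ≡ χ a ℤ.* w ℤ.+ χ b ℤ.* w
  heads true true = refl
  heads true false = refl
  heads false true = ℤ.+-comm (+ 1 ℤ.* w) (+ 0 ℤ.* w)
  heads false false = refl

setRow-modular : ∀ {n} (X Y : Subset (suc n)) x →
  dotᶻ (setRow (X ∪ Y)) x ℤ.+ dotᶻ (setRow (X ∩ Y)) x ≡ dotᶻ (setRow X) x ℤ.+ dotᶻ (setRow Y) x
setRow-modular X Y x = trans (cong₂ ℤ._+_ (dotᶻ-setRow (X ∪ Y) x) (dotᶻ-setRow (X ∩ Y) x))
  (trans (indicator-modular X Y (hat x)) (sym (cong₂ ℤ._+_ (dotᶻ-setRow X x) (dotᶻ-setRow Y x))))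

-- The vector x̂ sums to zero, so its sums over a set and over the complement are opposite. Negating
-- `S` therefore amounts to complementing sets.
setRow-complement : ∀ {n} (X : Subset (suc n)) x → dotᶻ (setRow (∁ X)) (negate x) ≡ dotᶻ (setRow X) x
setRow-complement (b ∷ X) x = go X x
  where
  heads : ∀ b c x → (χ (not c) ℤ.- χ (not b)) ℤ.* (ℤ.- x) ≡ (χ c ℤ.- χ b) ℤ.* x
  heads true true x = refl
  heads false false x = refl
  heads true false x = lemma x
    where
    lemma : ∀ x → + 1 ℤ.* (ℤ.- x) ≡ (ℤ.- + 1) ℤ.* x
    lemma = solve-∀ ringℤ
  heads false true x = lemma x
    where
    lemma : ∀ x → (ℤ.- + 1) ℤ.* (ℤ.- x) ≡ + 1 ℤ.* x
    lemma = solve-∀ ringℤ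
  go : ∀ {m} (X : Subset m) x →
    dotᶻ (map (λ c → χ c ℤ.- χ (not b)) (∁ X)) (negate x) ≡ dotᶻ (map (λ c → χ c ℤ.- χ b) X) x
  go [] [] = refl
  go (c ∷ X) (x ∷ xs) = cong₂ ℤ._+_ (heads b c x) (go X xs)

complement-involutive : ∀ {m} (X : Subset m) → ∁ (∁ X) ≡ X
complement-involutive [] = refl
complement-involutive (b ∷ X) = cong₂ _∷_ (not-involutive b) (complement-involutive X)

complement-∪ : ∀ {m} (X Y : Subset m) → ∁ (X ∪ Y) ≡ ∁ X ∩ ∁ Y
complement-∪ [] [] = refl
complement-∪ (true ∷ X) (b ∷ Y) = cong (false ∷_) (complement-∪ X Y)
complement-∪ (false ∷ X) (b ∷ Y) = cong (not b ∷_) (complement-∪ X Y)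

complement-∩ : ∀ {m} (X Y : Subset m) → ∁ (X ∩ Y) ≡ ∁ X ∪ ∁ Y
complement-∩ [] [] = refl
complement-∩ (true ∷ X) (b ∷ Y) = cong (not b ∷_) (complement-∩ X Y)
complement-∩ (false ∷ X) (b ∷ Y) = cong (true ∷_) (complement-∩ X Y)

lift₀-setRow : ∀ {n} (X : Subset (suc n)) u → lift₀ (setRow X) u ≡ χ (lookup X u) ℤ.- χ (head X)
lift₀-setRow (b ∷ X) zero = sym (ℤ.+-inverseʳ (χ b))
lift₀-setRow (b ∷ X) (suc i) = lookup-map i (λ c → χ c ℤ.- χ b) X

-- Transfers of one unit between coordinates

setRow-transfer : ∀ {n} (X : Subset (suc n)) x u v →
  dotᶻ (setRow X) (x +ᶻ pairRow (u , v)) ≡ dotᶻ (setRow X) x ℤ.+ (χ (lookup X u) ℤ.- χ (lookup X v))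
setRow-transfer X x u v = trans (dotᶻ-+ (setRow X) x (pairRow (u , v))) (cong (λ z → dotᶻ (setRow X) x ℤ.+ z)
  (trans (dotᶻ-- (setRow X) (ε u) (ε v)) (trans (cong₂ ℤ._-_
    (trans (dotᶻ-ε (setRow X) u) (lift₀-setRow X u)) (trans (dotᶻ-ε (setRow X) v) (lift₀-setRow X v)))
    (lemma (χ (lookup X u)) (χ (lookup X v)) (χ (head X))))))
  where
  lemma : ∀ a b c → (a ℤ.- c) ℤ.- (b ℤ.- c) ≡ a ℤ.- b
  lemma = solve-∀ ringℤ

δ : ∀ {n} → Fin (suc n) → Fin n → ℤ
δ u k = if does (suc k ≟ u) then + 1 else + 0

lookup-ε : ∀ {n} (u : Fin (suc n)) k → lookup (ε u) k ≡ δ u k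
lookup-ε zero k = lookup∘tabulate (λ _ → + 0) k
lookup-ε (suc i) k = lookup∘tabulate (λ k → if does (k ≟ i) then + 1 else + 0) k

lookup-transfer : ∀ {n} (x : Vec ℤ n) u v k → lookup (x +ᶻ pairRow (u , v)) k ≡ lookup x k ℤ.+ (δ u k ℤ.- δ v k)
lookup-transfer x u v k = trans (lookup-zipWith ℤ._+_ k x (pairRow (u , v))) (cong (λ z → lookup x k ℤ.+ z)
  (trans (lookup-zipWith ℤ._-_ k (ε u) (ε v)) (cong₂ ℤ._-_ (lookup-ε u k) (lookup-ε v k))))

δ-yes : ∀ {n} {u : Fin (suc n)} {k} → suc k ≡ u → δ u k ≡ + 1
δ-yes {u = u} {k} eq = cong (λ b → if b then + 1 else + 0) (dec-true (suc k ≟ u) eq)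

δ-no : ∀ {n} {u : Fin (suc n)} {k} → suc k ≢ u → δ u k ≡ + 0
δ-no {u = u} {k} neq = cong (λ b → if b then + 1 else + 0) (dec-false (suc k ≟ u) neq)

0≤δ : ∀ {n} (u : Fin (suc n)) k → + 0 ℤ.≤ δ u k
0≤δ u k with does (suc k ≟ u)
... | true  = ℤ.+≤+ ℕ.z≤n
... | false = ℤ.+≤+ ℕ.z≤n

-- Raising the coordinate u moves z toward a; the coordinate 0 is absent from z and a and always qualifies.
Toward : ∀ {n} → Vec ℤ n → Vec ℤ n → Fin (suc n) → Set
Toward z a u = u ≡ zero ⊎ lift₀ z u ℤ.< lift₀ a u

Toward-suc : ∀ {n} (z a : Vec ℤ n) {k} → Toward z a (suc k) → lookup z k ℤ.< lookup a k
Toward-suc z a (inj₂ lt) = lt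

distance-≤ : ∀ {m} (a z z′ : Vec ℤ m) →
  (∀ k → ℤ.∣ lookup a k ℤ.- lookup z′ k ∣ ℕ.≤ ℤ.∣ lookup a k ℤ.- lookup z k ∣) → distance a z′ ℕ.≤ distance a z
distance-≤ [] [] [] h = ℕ.z≤n
distance-≤ (_ ∷ a) (_ ∷ z) (_ ∷ z′) h = ℕ.+-mono-≤ (h zero) (distance-≤ a z z′ (λ k → h (suc k)))

distance-< : ∀ {m} (a z z′ : Vec ℤ m) →
  (∀ k → ℤ.∣ lookup a k ℤ.- lookup z′ k ∣ ℕ.≤ ℤ.∣ lookup a k ℤ.- lookup z k ∣) →
  ∀ k → ℤ.∣ lookup a k ℤ.- lookup z′ k ∣ ℕ.< ℤ.∣ lookup a k ℤ.- lookup z k ∣ → distance a z′ ℕ.< distance a z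
distance-< (_ ∷ a) (_ ∷ z) (_ ∷ z′) h zero lt = ℕ.+-mono-<-≤ lt (distance-≤ a z z′ (λ k → h (suc k)))
distance-< (_ ∷ a) (_ ∷ z) (_ ∷ z′) h (suc k) lt = ℕ.+-mono-≤-< (h zero) (distance-< a z z′ (λ k → h (suc k)) k lt)

module _ {n} (a z : Vec ℤ n) (u v : Fin (suc n)) (z⟶a : Toward z a u) (a⟶z : Toward a z v) where

  private
    z′ : Vec ℤ n
    z′ = z +ᶻ pairRow (u , v)

    Closer Strict : Fin n → Set
    Closer k = ℤ.∣ lookup a k ℤ.- lookup z′ k ∣ ℕ.≤ ℤ.∣ lookup a k ℤ.- lookup z k ∣
    Strict k = ℤ.∣ lookup a k ℤ.- lookup z′ k ∣ ℕ.< ℤ.∣ lookup a k ℤ.- lookup z k ∣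

    at-u : ∀ {k} → suc k ≡ u → lookup z k ℤ.< lookup a k
    at-u ≡u = Toward-suc z a (subst (Toward z a) (sym ≡u) z⟶a)

    at-v : ∀ {k} → suc k ≡ v → lookup a k ℤ.< lookup z k
    at-v ≡v = Toward-suc a z (subst (Toward a z) (sym ≡v) a⟶z)

    strict : ∀ k → suc k ≡ u ⊎ suc k ≡ v → Strict k
    strict k (inj₁ ≡u) = subst (λ w → ℤ.∣ lookup a k ℤ.- w ∣ ℕ.< _) (sym z′≡)
      (closer-< (<-by {r = + 0} ℤ.≤-refl (lemma (lookup z k))) (≤-by (<-difference (at-u ≡u)) (lemma₂ (lookup z k) (lookup a k))))
      where
      ≢v : suc k ≢ v
      ≢v ≡v = ℤ.<-asym (at-u ≡u) (at-v ≡v)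
      z′≡ : lookup z′ k ≡ lookup z k ℤ.+ + 1
      z′≡ = trans (lookup-transfer z u v k) (cong₂ (λ p q → lookup z k ℤ.+ (p ℤ.- q)) (δ-yes ≡u) (δ-no ≢v))
      lemma : ∀ z → z ℤ.+ + 1 ≡ + 1 ℤ.+ z ℤ.+ + 0
      lemma = solve-∀ ringℤ
      lemma₂ : ∀ z a → a ≡ (z ℤ.+ + 1) ℤ.+ (a ℤ.- z ℤ.- + 1)
      lemma₂ = solve-∀ ringℤ
    strict k (inj₂ ≡v) = subst (λ w → ℤ.∣ lookup a k ℤ.- w ∣ ℕ.< _) (sym z′≡)
      (subst₂ ℕ._<_ (swap (lookup a k) (lookup z k ℤ.- + 1)) (swap (lookup a k) (lookup z k))
        (closer-< {ℤ.- lookup a k} {ℤ.- lookup z k} (<-by {r = + 0} ℤ.≤-refl (lemma₂ (lookup z k)))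
          (ℤ.neg-mono-≤ (≤-by {lookup a k} (<-difference (at-v ≡v)) (lemma₃ (lookup z k) (lookup a k))))))
      where
      ≢u : suc k ≢ u
      ≢u ≡u = ℤ.<-asym (at-u ≡u) (at-v ≡v)
      z′≡ : lookup z′ k ≡ lookup z k ℤ.- + 1
      z′≡ = trans (lookup-transfer z u v k) (cong₂ (λ p q → lookup z k ℤ.+ (p ℤ.- q)) (δ-no ≢u) (δ-yes ≡v))
      swap : ∀ a b → ℤ.∣ (ℤ.- a) ℤ.- (ℤ.- b) ∣ ≡ ℤ.∣ a ℤ.- b ∣
      swap a b = trans (cong ℤ.∣_∣ (lemma a b)) (ℤ.∣-i∣≡∣i∣ (a ℤ.- b))
        where
        lemma : ∀ a b → (ℤ.- a) ℤ.- (ℤ.- b) ≡ ℤ.- (a ℤ.- b)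
        lemma = solve-∀ ringℤ
      lemma₂ : ∀ z → ℤ.- (z ℤ.- + 1) ≡ + 1 ℤ.+ (ℤ.- z) ℤ.+ + 0
      lemma₂ = solve-∀ ringℤ
      lemma₃ : ∀ z a → z ℤ.- + 1 ≡ a ℤ.+ (z ℤ.- a ℤ.- + 1)
      lemma₃ = solve-∀ ringℤ

    closer : ∀ k → Closer k
    closer k = cases (suc k ≟ u) (suc k ≟ v)
      where
      cases : Dec (suc k ≡ u) → Dec (suc k ≡ v) → Closer k
      cases (yes ≡u) _ = ℕ.<⇒≤ (strict k (inj₁ ≡u))
      cases (no _) (yes ≡v) = ℕ.<⇒≤ (strict k (inj₂ ≡v))
      cases (no ≢u) (no ≢v) = ℕ.≤-reflexive (cong (λ w → ℤ.∣ lookup a k ℤ.- w ∣)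
        (trans (lookup-transfer z u v k) (trans (cong₂ (λ p q → lookup z k ℤ.+ (p ℤ.- q)) (δ-no ≢u) (δ-no ≢v))
          (ℤ.+-identityʳ (lookup z k)))))

  -- Every real coordinate touched by the transfer moves one unit toward `a`. The witness `k`
  -- ensures that there is one, as index 0 does not enter the distance.
  transfer-closer : ∀ k → suc k ≡ u ⊎ suc k ≡ v → distance a z′ ℕ.< distance a z
  transfer-closer k k∈ = distance-< a z z′ closer k (strict k k∈)

transfer-compose : ∀ {n} (y p q r : Vec ℤ n) → (y +ᶻ (p -ᶻ q)) +ᶻ (r -ᶻ p) ≡ y +ᶻ (r -ᶻ q)
transfer-compose [] [] [] [] = refl
transfer-compose (y ∷ ys) (p ∷ ps) (q ∷ qs) (r ∷ rs) = cong₂ _∷_ (lemma y p q r) (transfer-compose ys ps qs rs)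
  where
  lemma : ∀ y p q r → (y ℤ.+ (p ℤ.- q)) ℤ.+ (r ℤ.- p) ≡ y ℤ.+ (r ℤ.- q)
  lemma = solve-∀ ringℤ

transfer-compose′ : ∀ {n} (y p q r : Vec ℤ n) → (y +ᶻ (r -ᶻ p)) +ᶻ (p -ᶻ q) ≡ y +ᶻ (r -ᶻ q)
transfer-compose′ [] [] [] [] = refl
transfer-compose′ (y ∷ ys) (p ∷ ps) (q ∷ qs) (r ∷ rs) = cong₂ _∷_ (lemma y p q r) (transfer-compose′ ys ps qs rs)
  where
  lemma : ∀ y p q r → (y ℤ.+ (r ℤ.- p)) ℤ.+ (p ℤ.- q) ≡ y ℤ.+ (r ℤ.- q)
  lemma = solve-∀ ringℤ

transfer-undo : ∀ {n} (y d p q : Vec ℤ n) → (y +ᶻ (p -ᶻ q)) +ᶻ (d +ᶻ (q -ᶻ p)) ≡ y +ᶻ d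
transfer-undo [] [] [] [] = refl
transfer-undo (y ∷ ys) (d ∷ ds) (p ∷ ps) (q ∷ qs) = cong₂ _∷_ (lemma y d p q) (transfer-undo ys ds ps qs)
  where
  lemma : ∀ y d p q → (y ℤ.+ (p ℤ.- q)) ℤ.+ (d ℤ.+ (q ℤ.- p)) ≡ y ℤ.+ d
  lemma = solve-∀ ringℤ

transfer-self : ∀ {n} (y p : Vec ℤ n) → y +ᶻ (p -ᶻ p) ≡ y
transfer-self [] [] = refl
transfer-self (y ∷ ys) (p ∷ ps) = cong₂ _∷_ (lemma y p) (transfer-self ys ps)
  where
  lemma : ∀ y p → y ℤ.+ (p ℤ.- p) ≡ y
  lemma = solve-∀ ringℤ

transfer-negate : ∀ {n} (y p q : Vec ℤ n) → negate (negate y +ᶻ (p -ᶻ q)) ≡ y +ᶻ (q -ᶻ p)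
transfer-negate [] [] [] = refl
transfer-negate (y ∷ ys) (p ∷ ps) (q ∷ qs) = cong₂ _∷_ (lemma y p q) (transfer-negate ys ps qs)
  where
  lemma : ∀ y p q → ℤ.- ((ℤ.- y) ℤ.+ (p ℤ.- q)) ≡ y ℤ.+ (q ℤ.- p)
  lemma = solve-∀ ringℤ

remove-add : ∀ {n} (x p q : Vec ℤ n) → (x -ᶻ p) +ᶻ q ≡ x +ᶻ (q -ᶻ p)
remove-add [] [] [] = refl
remove-add (x ∷ xs) (p ∷ ps) (q ∷ qs) = cong₂ _∷_ (lemma x p q) (remove-add xs ps qs)
  where
  lemma : ∀ x p q → (x ℤ.- p) ℤ.+ q ≡ x ℤ.+ (q ℤ.- p)
  lemma = solve-∀ ringℤ

add-remove : ∀ {n} (x p q : Vec ℤ n) → (x +ᶻ p) -ᶻ q ≡ x +ᶻ (p -ᶻ q)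
add-remove [] [] [] = refl
add-remove (x ∷ xs) (p ∷ ps) (q ∷ qs) = cong₂ _∷_ (ℤ.+-assoc x p (ℤ.- q)) (add-remove xs ps qs)

remove-only : ∀ {n} (x p : Vec ℤ n) → x -ᶻ p ≡ x +ᶻ (0ᶻ -ᶻ p)
remove-only [] [] = refl
remove-only (x ∷ xs) (p ∷ ps) = cong₂ _∷_ (lemma x p) (remove-only xs ps)
  where
  lemma : ∀ x p → x ℤ.- p ≡ x ℤ.+ (+ 0 ℤ.- p)
  lemma = solve-∀ ringℤ

add-only : ∀ {n} (x p : Vec ℤ n) → x +ᶻ p ≡ x +ᶻ (p -ᶻ 0ᶻ)
add-only [] [] = refl
add-only (x ∷ xs) (p ∷ ps) = cong₂ _∷_ (cong (λ z → x ℤ.+ z) (sym (ℤ.+-identityʳ p))) (add-only xs ps)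

-- Exchange

-- The choice `v = zero` is the alternative without a partner. The conclusion is doubly negated
-- because the property will be applied to the double negation of a set.
ExchangeM : ∀ {n} → ZSet n → Set
ExchangeM {n} S = ∀ x y (i : Fin n) → S x → S y → lookup y i ℤ.< lookup x i →
  ¬ ¬ (∃[ v ] (Toward x y v × S (x +ᶻ pairRow (v , suc i)) × S (y +ᶻ pairRow (suc i , v))))

Stable : ∀ {n} → ZSet n → Set
Stable S = ∀ x → ¬ ¬ S x → S x

lookup-negate : ∀ {n} (x : Vec ℤ n) i → lookup (negate x) i ≡ ℤ.- lookup x i
lookup-negate x i = lookup-map i (λ a → ℤ.- a) x

-- Negation swaps the roles of x and y. Together with complements it carries results for sets
-- avoiding 0 over to sets containing 0.
ExchangeM-negate : ∀ {n} {S : ZSet n} → ExchangeM S → ExchangeM (S ∘ negate)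
ExchangeM-negate {S = S} exchange x y i Sx Sy y<x =
  exchange (negate y) (negate x) i Sy Sx (subst₂ ℤ._<_ (sym (lookup-negate x i)) (sym (lookup-negate y i)) (ℤ.neg-mono-< y<x))
  >>= λ { (v , toward , Sy′ , Sx′) → pure (v , flip v toward ,
    subst S (sym (move x v (suc i))) Sx′ , subst S (sym (move y (suc i) v)) Sy′) }
  where
  move : ∀ x u v → negate (x +ᶻ pairRow (u , v)) ≡ negate x +ᶻ pairRow (v , u)
  move x u v = trans (cong (λ z → negate (z +ᶻ pairRow (u , v))) (sym (negate-involutive x))) (transfer-negate (negate x) (ε u) (ε v))
  flip : ∀ v → Toward (negate y) (negate x) v → Toward x y v
  flip zero _ = inj₁ refl
  flip (suc k) (inj₂ lt) = inj₂ (ℤ.neg-cancel-< (subst₂ ℤ._<_ (lookup-negate y k) (lookup-negate x k) lt))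

χ-bounds : ∀ b → + 0 ℤ.≤ χ b × χ b ℤ.≤ + 1
χ-bounds true = ℤ.+≤+ ℕ.z≤n , ℤ.≤-refl
χ-bounds false = ℤ.≤-refl , ℤ.+≤+ ℕ.z≤n

dotᶻ-increase : ∀ {n} (r a z : Vec ℤ n) → dotᶻ r z ℤ.< dotᶻ r a → ∃[ i ] (lookup r i ℤ.* lookup z i ℤ.< lookup r i ℤ.* lookup a i)
dotᶻ-increase [] [] [] h = ⊥-elim (ℤ.<-irrefl refl h)
dotᶻ-increase (r ∷ rs) (a ∷ as) (z ∷ zs) h with r ℤ.* z ℤ.<? r ℤ.* a
... | yes lt = zero , lt
... | no ≮ with dotᶻ-increase rs as zs (ℤ.≰⇒> λ le → ℤ.<-irrefl refl (ℤ.<-≤-trans h (ℤ.+-mono-≤ (ℤ.≮⇒≥ ≮) le)))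
...   | i , lt = suc i , lt

-- For 0 ∉ A the functional of A is the plain coordinate sum over A.
set-increase : ∀ {n} (A : Subset (suc n)) a z → head A ≡ false → dotᶻ (setRow A) z ℤ.< dotᶻ (setRow A) a →
  ∃[ i ] (lookup A (suc i) ≡ true × lookup z i ℤ.< lookup a i)
set-increase (false ∷ A) a z refl h with dotᶻ-increase (setRow (false ∷ A)) a z h
... | i , lt with lookup A i in eq | subst (λ r → r ℤ.* lookup z i ℤ.< r ℤ.* lookup a i) (lookup-map i (λ c → χ c ℤ.- χ false) A) lt
...   | true  | lt′ = i , eq , subst₂ ℤ._<_ (ℤ.*-identityˡ _) (ℤ.*-identityˡ _) lt′
...   | false | lt′ = ⊥-elim (ℤ.<-irrefl refl lt′)

_⊆_ : ∀ {m} → Subset m → Subset m → Set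
A ⊆ B = ∀ u → lookup A u ≡ true → lookup B u ≡ true

module ExchangeM-properties {n} (S : ZSet n) (exchange : ExchangeM S) where

  -- Moving z toward a along exchanges at elements of A never decreases z(B), as A ⊆ B.
  chain : ∀ A B → head A ≡ false → A ⊆ B → ∀ a z → S a → S z →
    ¬ ¬ (∃[ w ] (S w × dotᶻ (setRow A) a ℤ.≤ dotᶻ (setRow A) w × dotᶻ (setRow B) z ℤ.≤ dotᶻ (setRow B) w))
  chain A B 0∉A A⊆B a z Sa = go (suc (distance a z)) z ℕ.≤-refl
    where
    go : ∀ k z → distance a z ℕ.< k → S z →
      ¬ ¬ (∃[ w ] (S w × dotᶻ (setRow A) a ℤ.≤ dotᶻ (setRow A) w × dotᶻ (setRow B) z ℤ.≤ dotᶻ (setRow B) w))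
    go (suc k) z (ℕ.s≤s d≤k) Sz = compare (dotᶻ (setRow A) z ℤ.<? dotᶻ (setRow A) a)
      where
      compare : Dec (dotᶻ (setRow A) z ℤ.< dotᶻ (setRow A) a) → _
      compare (no ≮) = pure (z , Sz , ℤ.≮⇒≥ ≮ , ℤ.≤-refl)
      compare (yes lt) with set-increase A a z 0∉A lt
      ... | i , i∈A , zᵢ<aᵢ = exchange a z i Sa Sz zᵢ<aᵢ >>= λ { (v , toward , _ , Sz′) →
        go k (z +ᶻ pairRow (suc i , v)) (ℕ.<-≤-trans (transfer-closer a z (suc i) v (inj₂ zᵢ<aᵢ) toward i (inj₁ refl)) d≤k) Sz′
        >>= λ { (w , Sw , Aw , Bw) → pure (w , Sw , Aw , ℤ.≤-trans (≤-by (≤-difference (proj₂ (χ-bounds (lookup B v))))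
            (trans (setRow-transfer B z (suc i) v) (cong (λ b → dotᶻ (setRow B) z ℤ.+ (χ b ℤ.- χ (lookup B v))) (A⊆B (suc i) i∈A)))) Bw) } }

  -- `X` consists of the partners against which coordinate `i` of `y` can be raised, known for base
  -- polyhedra as the dependence set of `i` at `y`. The goal is that `y` maximises the functional of
  -- `X` over `S`. That `i` cannot be raised alone keeps 0 outside `X`.
  module TightSet (y : Vec ℤ n) (Sy : S y) (i : Fin n) (stable : Stable S)
    (not-augmentable : ¬ S (y +ᶻ pairRow (suc i , zero)))
    (X : Subset (suc n)) (X⇒S : ∀ u → lookup X u ≡ true → S (y +ᶻ pairRow (suc i , u)))
    (S⇒X : ∀ u → S (y +ᶻ pairRow (suc i , u)) → lookup X u ≡ true) where

    0∉X : lookup X zero ≡ false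
    0∉X with lookup X zero in eq
    ... | true  = ⊥-elim (not-augmentable (X⇒S zero eq))
    ... | false = refl

    i∈X : lookup X (suc i) ≡ true
    i∈X = S⇒X (suc i) (subst S (sym (transfer-self y (ε (suc i)))) Sy)

    -- Exchange at `j` between a = y + εⱼ - εᵥ and b = y + εᵢ - εⱼ. The only real coordinates in
    -- which b can exceed a are `i` and `v`, and either partner produces y + εᵢ - εᵥ; the partner 0
    -- would raise `i` alone.
    transitive : ∀ j v → suc j ≢ v → S (y +ᶻ pairRow (suc i , suc j)) → S (y +ᶻ pairRow (suc j , v)) → S (y +ᶻ pairRow (suc i , v))
    transitive j v j≢v Sb Sa with i ≟ j
    ... | yes refl = Sa
    ... | no i≢j = stable _ (exchange a b j Sa Sb b<a >>= λ { (k , toward , Sa′ , Sb′) → finish k toward Sa′ Sb′ })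
      where
      a b : Vec ℤ n
      a = y +ᶻ pairRow (suc j , v)
      b = y +ᶻ pairRow (suc i , suc j)
      suc-≢ : ∀ {p q : Fin n} → p ≢ q → suc p ≢ suc q
      suc-≢ p≢q refl = p≢q refl
      b<a : lookup b j ℤ.< lookup a j
      b<a = subst₂ ℤ._<_
        (sym (trans (lookup-transfer y (suc i) (suc j) j) (cong₂ (λ p q → lookup y j ℤ.+ (p ℤ.- q)) (δ-no (suc-≢ (i≢j ∘ sym))) (δ-yes {u = suc j} refl))))
        (sym (trans (lookup-transfer y (suc j) v j) (cong₂ (λ p q → lookup y j ℤ.+ (p ℤ.- q)) (δ-yes {u = suc j} refl) (δ-no j≢v))))
        (ℤ.+-monoʳ-< (lookup y j) ℤ.-<+)
      finish : ∀ k → Toward a b k → S (a +ᶻ pairRow (k , suc j)) → S (b +ᶻ pairRow (suc j , k)) → ¬ ¬ S (y +ᶻ pairRow (suc i , v))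
      finish zero _ _ Sb′ = ⊥-elim (not-augmentable (subst S (transfer-compose′ y (ε (suc j)) (ε zero) (ε (suc i))) Sb′))
      finish (suc k) toward Sa′ Sb′ = cases (k ≟ i) (suc k ≟ v)
        where
        cases : Dec (k ≡ i) → Dec (suc k ≡ v) → ¬ ¬ S (y +ᶻ pairRow (suc i , v))
        cases (yes refl) _ = pure (subst S (transfer-compose y (ε (suc j)) (ε v) (ε (suc i))) Sa′)
        cases (no _) (yes refl) = pure (subst S (transfer-compose′ y (ε (suc j)) (ε v) (ε (suc i))) Sb′)
        cases (no k≢i) (no k≢v) = ⊥-elim (ℤ.<-irrefl refl (ℤ.<-≤-trans (Toward-suc a b toward)
          (≤-by (0≤δ (suc j) k ⊕ 0≤δ (suc j) k)
            (trans (trans (lookup-transfer y (suc j) v k) (cong (λ q → lookup y k ℤ.+ (δ (suc j) k ℤ.- q)) (δ-no k≢v)))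
              (trans (lemma (lookup y k) (δ (suc j) k))
                (cong (λ z → z ℤ.+ (δ (suc j) k ℤ.+ δ (suc j) k))
                  (sym (trans (lookup-transfer y (suc i) (suc j) k) (cong (λ p → lookup y k ℤ.+ (p ℤ.- δ (suc j) k)) (δ-no (suc-≢ k≢i)))))))))))
          where
          lemma : ∀ y d → y ℤ.+ (d ℤ.- + 0) ≡ (y ℤ.+ (+ 0 ℤ.- d)) ℤ.+ (d ℤ.+ d)
          lemma = solve-∀ ringℤ

    -- If z had more on `X` than y, an exchange at some j in `X` with yⱼ < zⱼ would be possible. A
    -- partner in `X` leaves the value of z unchanged and brings z closer to y. A partner outside
    -- `X` could be exchanged against j in y, and by transitivity against i, so it would belong to
    -- `X`.
    tight : ∀ z → S z → dotᶻ (setRow X) z ℤ.≤ dotᶻ (setRow X) y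
    tight z = go (suc (distance y z)) z ℕ.≤-refl
      where
      go : ∀ k z → distance y z ℕ.< k → S z → dotᶻ (setRow X) z ℤ.≤ dotᶻ (setRow X) y
      go (suc k) z (ℕ.s≤s d≤k) Sz = decidable-stable (dotᶻ (setRow X) z ℤ.≤? dotᶻ (setRow X) y) λ ≰ → increase (ℤ.≰⇒> ≰)
        where
        increase : dotᶻ (setRow X) y ℤ.< dotᶻ (setRow X) z → ⊥
        increase lt with set-increase X z y 0∉X′ lt
          where
          0∉X′ : head X ≡ false
          0∉X′ = trans (sym (lookup-zero X)) 0∉X
            where
            lookup-zero : ∀ {m} (X : Subset (suc m)) → lookup X zero ≡ head X
            lookup-zero (_ ∷ _) = refl
        ... | j , j∈X , yⱼ<zⱼ = exchange z y j Sz Sy yⱼ<zⱼ λ { (v , toward , Sz′ , Sy′) → step v toward Sz′ Sy′ }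
          where
          step : ∀ v → Toward z y v → S (z +ᶻ pairRow (v , suc j)) → S (y +ᶻ pairRow (suc j , v)) → ⊥
          step v toward Sz′ Sy′ with lookup X v in v∈?X
          ... | true = ℤ.<-irrefl refl (ℤ.<-≤-trans lt (subst (ℤ._≤ dotᶻ (setRow X) y)
                (trans (setRow-transfer X z v (suc j)) (trans (cong₂ (λ p q → dotᶻ (setRow X) z ℤ.+ (χ p ℤ.- χ q)) v∈?X j∈X) (ℤ.+-identityʳ _)))
                (go k _ (ℕ.<-≤-trans (transfer-closer y z v (suc j) toward (inj₂ yⱼ<zⱼ) j (inj₂ refl)) d≤k) Sz′)))
          ... | false = case trans (sym v∈?X) (S⇒X v (transitive j v j≢v (X⇒S (suc j) j∈X) Sy′)) of λ ()
            where
            j≢v : suc j ≢ v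
            j≢v refl = case trans (sym v∈?X) j∈X of λ ()

¬¬-characteristic : ∀ {m} (Q : Fin m → Set) →
  ¬ ¬ (∃[ X ] ((∀ u → lookup X u ≡ true → Q u) × (∀ u → Q u → lookup X u ≡ true)))
¬¬-characteristic {zero} Q = pure ([] , (λ ()) , λ ())
¬¬-characteristic {suc m} Q = ¬¬-characteristic (Q ∘ suc) >>= λ { (X , X⇒Q , Q⇒X) → ¬¬-excluded-middle >>= λ
  { (yes q) → pure (true ∷ X , (λ { zero _ → q ; (suc u) → X⇒Q u }) , λ { zero _ → refl ; (suc u) → Q⇒X u })
  ; (no ¬q) → pure (false ∷ X , (λ { zero () ; (suc u) → X⇒Q u }) , λ { zero q → ⊥-elim (¬q q) ; (suc u) → Q⇒X u }) } }

lookup-complement : ∀ {m} (X : Subset m) u → lookup (∁ X) u ≡ not (lookup X u)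
lookup-complement X u = lookup-map u not X

-- Bounded sets and translation along edges

BoundedSet : ∀ {n} → ZSet n → Subset (suc n) → Set
BoundedSet S X = BoundedOn S (setRow X)

BoundedSet-complement : ∀ {n} {S : ZSet n} X → BoundedSet S X → BoundedSet (S ∘ negate) (∁ X)
BoundedSet-complement {S = S} X (M , S≤M) = M , λ s Ss → subst (ℤ._≤ M)
  (trans (sym (setRow-complement X (negate s))) (cong (dotᶻ (setRow (∁ X))) (negate-involutive s))) (S≤M (negate s) Ss)

BoundedSet-complement⁻ : ∀ {n} {S : ZSet n} X → BoundedSet (S ∘ negate) X → BoundedSet S (∁ X)
BoundedSet-complement⁻ {S = S} X (M , S≤M) = M , λ s Ss → subst (ℤ._≤ M)
  (trans (sym (setRow-complement X (negate s))) (cong (dotᶻ (setRow (∁ X))) (negate-involutive s)))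
  (S≤M (negate s) (subst S (sym (negate-involutive s)) Ss))

∩⊆∪ : ∀ {m} (X Y : Subset m) → (X ∩ Y) ⊆ (X ∪ Y)
∩⊆∪ (true ∷ X) (true ∷ Y) zero _ = refl
∩⊆∪ (a ∷ X) (b ∷ Y) (suc u) h = ∩⊆∪ X Y u h

module _ {n} {S : ZSet n} (exchange : ExchangeM S) {s₀} (Ss₀ : S s₀) where

  -- `chain` finds one point that is at least as large as a on X ∩ Y and as b on X ∪ Y, and there
  -- modularity bounds the sum by M + N. Fixing one of a and b at `s₀` leaves a bound for the other.
  bounded-avoiding : ∀ X Y → head (X ∩ Y) ≡ false → BoundedSet S X → BoundedSet S Y → BoundedSet S (X ∪ Y) × BoundedSet S (X ∩ Y)
  bounded-avoiding X Y 0∉ (M , S≤M) (N , S≤N) =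
    (M ℤ.+ N ℤ.- dotᶻ (setRow (X ∩ Y)) s₀ , λ s Ss → ≤-by (≤-difference (joint s₀ s Ss₀ Ss))
      (lemma₁ (M ℤ.+ N) (dotᶻ (setRow (X ∩ Y)) s₀) (dotᶻ (setRow (X ∪ Y)) s))) ,
    (M ℤ.+ N ℤ.- dotᶻ (setRow (X ∪ Y)) s₀ , λ s Ss → ≤-by (≤-difference (joint s s₀ Ss Ss₀))
      (lemma₂ (M ℤ.+ N) (dotᶻ (setRow (X ∪ Y)) s₀) (dotᶻ (setRow (X ∩ Y)) s)))
    where
    joint : ∀ a b → S a → S b → dotᶻ (setRow (X ∩ Y)) a ℤ.+ dotᶻ (setRow (X ∪ Y)) b ℤ.≤ M ℤ.+ N
    joint a b Sa Sb = decidable-stable (_ ℤ.≤? M ℤ.+ N)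
      (ExchangeM-properties.chain S exchange (X ∩ Y) (X ∪ Y) 0∉ (∩⊆∪ X Y) a b Sa Sb >>= λ { (w , Sw , Aw , Bw) → pure
        (ℤ.≤-trans (ℤ.+-mono-≤ Aw Bw) (subst (ℤ._≤ M ℤ.+ N)
          (sym (trans (ℤ.+-comm (dotᶻ (setRow (X ∩ Y)) w) (dotᶻ (setRow (X ∪ Y)) w)) (setRow-modular X Y w)))
          (ℤ.+-mono-≤ (S≤M w Sw) (S≤N w Sw)))) })
    lemma₁ : ∀ m a b → m ℤ.- a ≡ b ℤ.+ (m ℤ.- (a ℤ.+ b))
    lemma₁ = solve-∀ ringℤ
    lemma₂ : ∀ m b a → m ℤ.- b ≡ a ℤ.+ (m ℤ.- (a ℤ.+ b))
    lemma₂ = solve-∀ ringℤ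

BoundedSet-∪-∩ : ∀ {n} {S : ZSet n} → ExchangeM S → ∀ {s₀} → S s₀ → ∀ X Y →
  BoundedSet S X → BoundedSet S Y → BoundedSet S (X ∪ Y) × BoundedSet S (X ∩ Y)
BoundedSet-∪-∩ {S = S} exchange {s₀} Ss₀ X Y bX bY = cases (head (X ∩ Y)) refl
  where
  cases : ∀ b → head (X ∩ Y) ≡ b → BoundedSet S (X ∪ Y) × BoundedSet S (X ∩ Y)
  cases false eq = bounded-avoiding exchange Ss₀ X Y eq bX bY
  -- `chain` needs 0 outside the intersection. If 0 lies in X ∩ Y, it lies in neither complement,
  -- and the complements are bounded on the negated set.
  cases true eq with bounded-avoiding (ExchangeM-negate exchange) (subst S (sym (negate-involutive s₀)) Ss₀) (∁ X) (∁ Y)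
                     (0∉ X Y eq) (BoundedSet-complement X bX) (BoundedSet-complement Y bY)
    where
    0∉ : ∀ {m} (X Y : Subset (suc m)) → head (X ∩ Y) ≡ true → head (∁ X ∩ ∁ Y) ≡ false
    0∉ (true ∷ X) (true ∷ Y) _ = refl
  ... | b∪ , b∩ =
    subst (BoundedSet S) (trans (cong ∁ (sym (complement-∪ X Y))) (complement-involutive _)) (BoundedSet-complement⁻ (∁ X ∩ ∁ Y) b∩) ,
    subst (BoundedSet S) (trans (cong ∁ (sym (complement-∩ X Y))) (complement-involutive _)) (BoundedSet-complement⁻ (∁ X ∪ ∁ Y) b∪)

tight-set : ∀ {n} {S : ZSet n} → Stable S → ExchangeM S → ∀ y i → S y → ¬ S (y +ᶻ pairRow (suc i , zero)) →
  ¬ ¬ (∃[ X ] (BoundedSet S X × lookup X (suc i) ≡ true ×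
    (∀ u → lookup X u ≡ true → S (y +ᶻ pairRow (suc i , u)))))
tight-set {S = S} stable exchange y i Sy ¬S = ¬¬-characteristic (λ u → S (y +ᶻ pairRow (suc i , u))) >>= λ { (X , X⇒S , S⇒X) →
  let open ExchangeM-properties.TightSet S exchange y Sy i stable ¬S X X⇒S S⇒X in
  pure (X , (dotᶻ (setRow X) y , tight) , i∈X , X⇒S) }

-- If raising u alone fails, the tight set of u is bounded, so by hypothesis it contains v, which is
-- the claim. If lowering v alone fails, the same holds after negation.
translate-edge : ∀ {n} {S : ZSet n} → Stable S → ExchangeM S → ∀ y → S y → ∀ u v →
  (∀ X → BoundedSet S X → lookup X u ≡ true → lookup X v ≡ true) → S (y +ᶻ pairRow (u , v))
translate-edge {S = S} stable exchange y Sy u v separated = stable _ (edge u v separated)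
  where
  S⁻ : ZSet _
  S⁻ = S ∘ negate
  edge-from-v : ∀ u j → (∀ X → BoundedSet S X → lookup X u ≡ true → lookup X (suc j) ≡ true) →
    ¬ S (y +ᶻ pairRow (zero , suc j)) → ¬ ¬ S (y +ᶻ pairRow (u , suc j))
  edge-from-v u j separated ¬S =
    tight-set (λ x → stable (negate x)) (ExchangeM-negate exchange) (negate y) j (subst S (sym (negate-involutive y)) Sy)
      (λ S⁻y → ¬S (subst S (transfer-negate y (ε (suc j)) (ε zero)) S⁻y))
    >>= λ { (X , bX , j∈X , X⇒S) → pure (subst S (transfer-negate y (ε (suc j)) (ε u)) (X⇒S u (u∈ X bX j∈X))) }
    where
    u∈ : ∀ X → BoundedSet S⁻ X → lookup X (suc j) ≡ true → lookup X u ≡ true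
    u∈ X bX j∈X with lookup X u in eq
    ... | true = refl
    ... | false = case trans (sym (trans (lookup-complement X (suc j)) (cong not j∈X)))
                    (separated (∁ X) (BoundedSet-complement⁻ X bX) (trans (lookup-complement X u) (cong not eq))) of λ ()
  edge : ∀ u v → (∀ X → BoundedSet S X → lookup X u ≡ true → lookup X v ≡ true) → ¬ ¬ S (y +ᶻ pairRow (u , v))
  edge zero zero _ = pure (subst S (sym (transfer-self y (ε zero))) Sy)
  edge zero (suc j) separated = ¬¬-excluded-middle >>= λ
    { (yes S′) → pure S′
    ; (no ¬S) → edge-from-v zero j separated ¬S }
  edge (suc i) v separated = ¬¬-excluded-middle >>= λ
    { (no ¬S) → tight-set stable exchange y i Sy ¬S >>= λ { (X , bX , i∈X , X⇒S) → pure (X⇒S v (separated X bX i∈X)) }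
    ; (yes S+) → with-add v separated S+ }
    where
    with-add : ∀ v → (∀ X → BoundedSet S X → lookup X (suc i) ≡ true → lookup X v ≡ true) →
      S (y +ᶻ pairRow (suc i , zero)) → ¬ ¬ S (y +ᶻ pairRow (suc i , v))
    with-add zero _ S+ = pure S+
    with-add (suc j) separated S+ = ¬¬-excluded-middle >>= λ
      { (no ¬S) → edge-from-v (suc i) j separated ¬S
      -- Both single steps stay in `S`. As a = y + eᵢ is nowhere below b = y - eⱼ, the exchange at i
      -- has no real partner; it is with 0 and turns b into y + eᵢ - eⱼ.
      ; (yes S-) → exchange a b i S+ S- b<a >>= λ { (k , toward , _ , Sb′) → finish k toward Sb′ } }
      where
      a b : Vec ℤ _
      a = y +ᶻ pairRow (suc i , zero)
      b = y +ᶻ pairRow (zero , suc j)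
      a≡ : ∀ k → lookup a k ≡ lookup y k ℤ.+ (δ (suc i) k ℤ.- + 0)
      a≡ k = trans (lookup-transfer y (suc i) zero k) (cong (λ q → lookup y k ℤ.+ (δ (suc i) k ℤ.- q)) (δ-no {u = zero} {k} λ ()))
      b≡ : ∀ k → lookup b k ≡ lookup y k ℤ.+ (+ 0 ℤ.- δ (suc j) k)
      b≡ k = trans (lookup-transfer y zero (suc j) k) (cong (λ q → lookup y k ℤ.+ (q ℤ.- δ (suc j) k)) (δ-no {u = zero} {k} λ ()))
      lemma : ∀ y p q → y ℤ.+ (p ℤ.- + 0) ≡ (y ℤ.+ (+ 0 ℤ.- q)) ℤ.+ (p ℤ.+ q)
      lemma = solve-∀ ringℤ
      lemma₂ : ∀ y q → y ℤ.+ (+ 1 ℤ.- + 0) ≡ + 1 ℤ.+ (y ℤ.+ (+ 0 ℤ.- q)) ℤ.+ q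
      lemma₂ = solve-∀ ringℤ
      b<a : lookup b i ℤ.< lookup a i
      b<a = <-by (0≤δ (suc j) i) (trans (trans (a≡ i) (cong (λ p → lookup y i ℤ.+ (p ℤ.- + 0)) (δ-yes {u = suc i} refl)))
        (trans (lemma₂ (lookup y i) (δ (suc j) i)) (cong (λ z → + 1 ℤ.+ z ℤ.+ δ (suc j) i) (sym (b≡ i)))))
      finish : ∀ k → Toward a b k → S (b +ᶻ pairRow (suc i , k)) → ¬ ¬ S (y +ᶻ pairRow (suc i , suc j))
      finish zero _ Sb′ = pure (subst S (transfer-compose y (ε zero) (ε (suc j)) (ε (suc i))) Sb′)
      finish (suc k) toward _ = ⊥-elim (ℤ.<-irrefl refl (ℤ.<-≤-trans (Toward-suc a b toward)
        (≤-by (0≤δ (suc i) k ⊕ 0≤δ (suc j) k) (trans (a≡ k) (trans (lemma (lookup y k) (δ (suc i) k) (δ (suc j) k))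
          (cong (λ z → z ℤ.+ (δ (suc i) k ℤ.+ δ (suc j) k)) (sym (b≡ k))))))))

-- Cones of ring families

record RingFamily {m} (G : List (Subset m)) : Set where
  field
    closed : All (λ X → All (λ Y → (X ∪ Y) ∈ G × (X ∩ Y) ∈ G) G) G
    full∈  : full ∈ G
    empty∈ : empty ∈ G

  ∪∈ : ∀ {X Y} → X ∈ G → Y ∈ G → (X ∪ Y) ∈ G
  ∪∈ X∈ Y∈ = proj₁ (All.lookup (All.lookup closed X∈) Y∈)
  ∩∈ : ∀ {X Y} → X ∈ G → Y ∈ G → (X ∩ Y) ∈ G
  ∩∈ X∈ Y∈ = proj₂ (All.lookup (All.lookup closed X∈) Y∈)

setRows : ∀ {n} → List (Subset (suc n)) → List (Vec ℤ n)
setRows = List.map setRow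

dotᶻ-zeros : ∀ {m} c (X : Subset m) x → (∀ u → lookup X u ≡ c) → dotᶻ (map (λ d → χ d ℤ.- χ c) X) x ≡ + 0
dotᶻ-zeros c [] [] h = refl
dotᶻ-zeros c (d ∷ X) (x ∷ xs) h rewrite h zero = trans (cong₂ ℤ._+_ (trans (cong (ℤ._* x) (ℤ.+-inverseʳ (χ c))) refl) (dotᶻ-zeros c X xs (λ u → h (suc u)))) refl

dotᶻ-full : ∀ {n} (x : Vec ℤ n) → dotᶻ (setRow full) x ≡ + 0
dotᶻ-full x = dotᶻ-zeros true full x (λ u → lookup-replicate u true)

dotᶻ-empty : ∀ {n} (x : Vec ℤ n) → dotᶻ (setRow empty) x ≡ + 0
dotᶻ-empty x = dotᶻ-zeros false empty x (λ u → lookup-replicate u false)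

-- After cancelling the sums over X on both sides, this compares the sums of y and x over Y minus X.
indicator-strict : ∀ {m} (X Y : Subset m) (x y : Vec ℤ m) →
  (∀ v → lookup X v ≡ false → lookup Y v ≡ true → lookup y v ℤ.≤ lookup x v) →
  dotᶻ (indicator (X ∪ Y)) y ℤ.+ dotᶻ (indicator X) x ℤ.≤ dotᶻ (indicator (X ∪ Y)) x ℤ.+ dotᶻ (indicator X) y
  × (∀ u → lookup X u ≡ false → lookup Y u ≡ true → lookup y u ℤ.< lookup x u →
    dotᶻ (indicator (X ∪ Y)) y ℤ.+ dotᶻ (indicator X) x ℤ.< dotᶻ (indicator (X ∪ Y)) x ℤ.+ dotᶻ (indicator X) y)
indicator-strict [] [] [] [] h = ℤ.≤-refl , λ ()
indicator-strict (a ∷ X) (b ∷ Y) (x ∷ xs) (y ∷ ys) h with indicator-strict X Y xs ys (λ v → h (suc v))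
... | le , lt = combine-≤ (heads-≤ a b (h zero)) le , λ
  { zero X∌ Y∋ y<x → combine-< (heads-< a b X∌ Y∋ y<x) le
  ; (suc u) X∌ Y∋ y<x → combine-≤-< (heads-≤ a b (h zero)) (lt u X∌ Y∋ y<x) }
  where
  p q r s : ℤ
  p = dotᶻ (indicator (X ∪ Y)) ys
  q = dotᶻ (indicator X) xs
  r = dotᶻ (indicator (X ∪ Y)) xs
  s = dotᶻ (indicator X) ys
  interchange : ∀ a p b q → (a ℤ.+ b) ℤ.+ (p ℤ.+ q) ≡ (a ℤ.+ p) ℤ.+ (b ℤ.+ q)
  interchange = solve-∀ ringℤ
  heads-≤ : ∀ a b → (a ≡ false → b ≡ true → y ℤ.≤ x) →
    χ (a ∨ᵇ b) ℤ.* y ℤ.+ χ a ℤ.* x ℤ.≤ χ (a ∨ᵇ b) ℤ.* x ℤ.+ χ a ℤ.* y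
  heads-≤ true b _ = ℤ.≤-reflexive (ℤ.+-comm (+ 1 ℤ.* y) (+ 1 ℤ.* x))
  heads-≤ false true h = ℤ.+-monoˡ-≤ (+ 0) (ℤ.*-monoˡ-≤-nonNeg (+ 1) (h refl refl))
  heads-≤ false false _ = ℤ.≤-refl
  heads-< : ∀ a b → a ≡ false → b ≡ true → y ℤ.< x →
    χ (a ∨ᵇ b) ℤ.* y ℤ.+ χ a ℤ.* x ℤ.< χ (a ∨ᵇ b) ℤ.* x ℤ.+ χ a ℤ.* y
  heads-< false true _ _ y<x = ℤ.+-monoˡ-< (+ 0) (ℤ.*-monoˡ-<-pos (+ 1) y<x)
  A B C E : ℤ
  A = χ (a ∨ᵇ b) ℤ.* y
  B = χ a ℤ.* x
  C = χ (a ∨ᵇ b) ℤ.* x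
  E = χ a ℤ.* y
  combine-≤ : A ℤ.+ B ℤ.≤ C ℤ.+ E → p ℤ.+ q ℤ.≤ r ℤ.+ s → (A ℤ.+ p) ℤ.+ (B ℤ.+ q) ℤ.≤ (C ℤ.+ r) ℤ.+ (E ℤ.+ s)
  combine-≤ h k = subst₂ ℤ._≤_ (interchange A p B q) (interchange C r E s) (ℤ.+-mono-≤ h k)
  combine-< : A ℤ.+ B ℤ.< C ℤ.+ E → p ℤ.+ q ℤ.≤ r ℤ.+ s → (A ℤ.+ p) ℤ.+ (B ℤ.+ q) ℤ.< (C ℤ.+ r) ℤ.+ (E ℤ.+ s)
  combine-< h k = subst₂ ℤ._<_ (interchange A p B q) (interchange C r E s) (ℤ.+-mono-<-≤ h k)
  combine-≤-< : A ℤ.+ B ℤ.≤ C ℤ.+ E → p ℤ.+ q ℤ.< r ℤ.+ s → (A ℤ.+ p) ℤ.+ (B ℤ.+ q) ℤ.< (C ℤ.+ r) ℤ.+ (E ℤ.+ s)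
  combine-≤-< h k = subst₂ ℤ._<_ (interchange A p B q) (interchange C r E s) (ℤ.+-mono-≤-< h k)

InSets : ∀ {n} → List (Subset (suc n)) → ZSet n
InSets G x = All (λ X → dotᶻ (setRow X) x ℤ.≤ + 0) G

InSets? : ∀ {n} (G : List (Subset (suc n))) x → Dec (InSets G x)
InSets? G x = All.all? (λ X → dotᶻ (setRow X) x ℤ.≤? + 0) G

-- A transfer changes each functional by at most 1 and values are integers, so a violated set was
-- tight before and gained a full unit: it contains `u` but not `v`.
blocked : ∀ {n} (G : List (Subset (suc n))) x u v → InSets G x → ¬ InSets G (x +ᶻ pairRow (u , v)) →
  ∃[ Z ] (Z ∈ G × dotᶻ (setRow Z) x ≡ + 0 × lookup Z u ≡ true × lookup Z v ≡ false)
blocked G x u v Gx ¬G with find (All.¬All⇒Any¬ (λ X → dotᶻ (setRow X) (x +ᶻ pairRow (u , v)) ℤ.≤? + 0) G ¬G)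
... | Z , Z∈ , ≰0 = Z , Z∈ , cases (lookup Z u) (lookup Z v) (λ h → ≰0 (subst (ℤ._≤ + 0) (sym (setRow-transfer Z x u v)) h))
  where
  d : ℤ
  d = dotᶻ (setRow Z) x
  d≤0 : d ℤ.≤ + 0
  d≤0 = All.lookup Gx Z∈
  cases : ∀ a b → ¬ (d ℤ.+ (χ a ℤ.- χ b) ℤ.≤ + 0) → d ≡ + 0 × a ≡ true × b ≡ false
  cases true false ≰0 = ℤ.≤-antisym d≤0 (ℤ.≮⇒≥ λ d<0 → ≰0 (subst (ℤ._≤ + 0) (ℤ.+-comm (+ 1) d) (ℤ.i<j⇒suc[i]≤j d<0))) , refl , refl
  cases true true ≰0 = ⊥-elim (≰0 (subst (ℤ._≤ + 0) (sym (ℤ.+-identityʳ d)) d≤0))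
  cases false false ≰0 = ⊥-elim (≰0 (subst (ℤ._≤ + 0) (sym (ℤ.+-identityʳ d)) d≤0))
  cases false true ≰0 = ⊥-elim (≰0 (ℤ.≤-trans (ℤ.+-monoʳ-≤ d ℤ.-≤+) (subst (ℤ._≤ + 0) (sym (ℤ.+-identityʳ d)) d≤0)))

lookup-∪ˡ : ∀ {m} (X Y : Subset m) u → lookup X u ≡ true → lookup (X ∪ Y) u ≡ true
lookup-∪ˡ X Y u h = trans (lookup-zipWith _∨ᵇ_ u X Y) (cong (_∨ᵇ lookup Y u) h)

lookup-∪ʳ : ∀ {m} (X Y : Subset m) u → lookup Y u ≡ true → lookup (X ∪ Y) u ≡ true
lookup-∪ʳ X Y u h = trans (lookup-zipWith _∨ᵇ_ u X Y) (trans (cong (lookup X u ∨ᵇ_) h) (∨-zeroʳ (lookup X u)))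

lookup-∪-false : ∀ {m} (X Y : Subset m) u → lookup X u ≡ false → lookup Y u ≡ false → lookup (X ∪ Y) u ≡ false
lookup-∪-false X Y u h k = trans (lookup-zipWith _∨ᵇ_ u X Y) (cong₂ _∨ᵇ_ h k)

lookup-∩ˡ : ∀ {m} (X Y : Subset m) u → lookup X u ≡ false → lookup (X ∩ Y) u ≡ false
lookup-∩ˡ X Y u h = trans (lookup-zipWith _∧ᵇ_ u X Y) (cong (_∧ᵇ lookup Y u) h)

lookup-∩ʳ : ∀ {m} (X Y : Subset m) u → lookup Y u ≡ false → lookup (X ∩ Y) u ≡ false
lookup-∩ʳ X Y u h = trans (lookup-zipWith _∧ᵇ_ u X Y) (trans (cong (lookup X u ∧ᵇ_) h) (∧-zeroʳ (lookup X u)))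

lookup-∩-true : ∀ {m} (X Y : Subset m) u → lookup X u ≡ true → lookup Y u ≡ true → lookup (X ∩ Y) u ≡ true
lookup-∩-true X Y u h k = trans (lookup-zipWith _∧ᵇ_ u X Y) (cong₂ _∧ᵇ_ h k)

-- Uncrossing: by modularity the two values, each at most 0, add up to 0.
tight-∪-∩ : ∀ {n} (X Y : Subset (suc n)) x → dotᶻ (setRow X) x ≡ + 0 → dotᶻ (setRow Y) x ≡ + 0 →
  dotᶻ (setRow (X ∪ Y)) x ℤ.≤ + 0 → dotᶻ (setRow (X ∩ Y)) x ℤ.≤ + 0 →
  dotᶻ (setRow (X ∪ Y)) x ≡ + 0 × dotᶻ (setRow (X ∩ Y)) x ≡ + 0
tight-∪-∩ X Y x X0 Y0 ∪≤0 ∩≤0 =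
  ℤ.≤-antisym ∪≤0 (subst (ℤ._≤ p) sum0 (ℤ.≤-trans (ℤ.+-monoʳ-≤ p ∩≤0) (ℤ.≤-reflexive (ℤ.+-identityʳ p)))) ,
  ℤ.≤-antisym ∩≤0 (subst (ℤ._≤ q) sum0 (ℤ.≤-trans (ℤ.+-monoˡ-≤ q ∪≤0) (ℤ.≤-reflexive (ℤ.+-identityˡ q))))
  where
  p q : ℤ
  p = dotᶻ (setRow (X ∪ Y)) x
  q = dotᶻ (setRow (X ∩ Y)) x
  sum0 : p ℤ.+ q ≡ + 0
  sum0 = trans (setRow-modular X Y x) (cong₂ ℤ._+_ X0 Y0)

-- If no exchange at i is possible, the union X of tight sets of x and the intersection Y of tight sets of y
-- satisfy i ∈ Y ∖ X and x̂ ≥ ŷ on Y ∖ X, against the tightness of X for x and of Y for y.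
module RingExchange {n} {G : List (Subset (suc n))} (ring : RingFamily G) (x y : Vec ℤ n) (i : Fin n)
  (Gx : InSets G x) (Gy : InSets G y) (y<x : lookup y i ℤ.< lookup x i) where
  open RingFamily ring

  -- Comparing x̂ with ŷ restricts index 0 as well, unlike `Toward`. Thus index 0 cannot be chosen
  -- between vectors of equal total, which is how M-convexity of cones will follow.
  Exchangeable : Fin (suc n) → Set
  Exchangeable v = lookup (hat x) v ℤ.< lookup (hat y) v × InSets G (x +ᶻ pairRow (v , suc i)) × InSets G (y +ᶻ pairRow (suc i , v))

  Separation : List (Fin (suc n)) → Set
  Separation vs = ∃[ X ] ∃[ Y ] (X ∈ G × Y ∈ G × dotᶻ (setRow X) x ≡ + 0 × dotᶻ (setRow Y) y ≡ + 0 ×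
    lookup X (suc i) ≡ false × lookup Y (suc i) ≡ true ×
    All (λ v → lookup (hat x) v ℤ.< lookup (hat y) v → lookup X v ≡ true ⊎ lookup Y v ≡ false) vs)

  search : ∀ vs → ∃ Exchangeable ⊎ Separation vs
  search [] = inj₂ (empty , full , empty∈ , full∈ , dotᶻ-empty x , dotᶻ-full y , lookup-replicate i false , lookup-replicate i true , [])
  search (v ∷ vs) with search vs
  ... | inj₁ found = inj₁ found
  ... | inj₂ (X , Y , X∈ , Y∈ , X0 , Y0 , i∉X , i∈Y , sep) =
    extend (lookup (hat x) v ℤ.<? lookup (hat y) v) (InSets? G (x +ᶻ pairRow (v , suc i))) (InSets? G (y +ᶻ pairRow (suc i , v)))
    where
    extend : Dec (lookup (hat x) v ℤ.< lookup (hat y) v) → Dec (InSets G (x +ᶻ pairRow (v , suc i))) →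
      Dec (InSets G (y +ᶻ pairRow (suc i , v))) → ∃ Exchangeable ⊎ Separation (v ∷ vs)
    extend (no ≮) _ _ = inj₂ (X , Y , X∈ , Y∈ , X0 , Y0 , i∉X , i∈Y , (λ lt → ⊥-elim (≮ lt)) ∷ sep)
    extend (yes lt) (yes Gx′) (yes Gy′) = inj₁ (v , lt , Gx′ , Gy′)
    -- The blocking set takes care of v and avoids i, and its union with X stays tight by
    -- uncrossing.
    extend (yes _) (no ¬Gx′) _ with blocked G x v (suc i) Gx ¬Gx′
    ... | Z , Z∈ , Z0 , v∈Z , i∉Z = inj₂ (X ∪ Z , Y , ∪∈ X∈ Z∈ , Y∈ ,
      proj₁ (tight-∪-∩ X Z x X0 Z0 (All.lookup Gx (∪∈ X∈ Z∈)) (All.lookup Gx (∩∈ X∈ Z∈))) , Y0 ,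
      lookup-∪-false X Z (suc i) i∉X i∉Z , i∈Y , (λ _ → inj₁ (lookup-∪ʳ X Z v v∈Z)) ∷
      All.map (λ {u} h lt → case h lt of λ { (inj₁ u∈X) → inj₁ (lookup-∪ˡ X Z u u∈X) ; (inj₂ u∉Y) → inj₂ u∉Y }) sep)
    extend (yes _) (yes _) (no ¬Gy′) with blocked G y (suc i) v Gy ¬Gy′
    ... | Z , Z∈ , Z0 , i∈Z , v∉Z = inj₂ (X , Y ∩ Z , X∈ , ∩∈ Y∈ Z∈ , X0 ,
      proj₂ (tight-∪-∩ Y Z y Y0 Z0 (All.lookup Gy (∪∈ Y∈ Z∈)) (All.lookup Gy (∩∈ Y∈ Z∈))) ,
      i∉X , lookup-∩-true Y Z (suc i) i∈Y i∈Z , (λ _ → inj₂ (lookup-∩ʳ Y Z v v∉Z)) ∷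
      All.map (λ {u} h lt → case h lt of λ { (inj₁ u∈X) → inj₁ u∈X ; (inj₂ u∉Y) → inj₂ (lookup-∩ˡ Y Z u u∉Y) }) sep)

  no-separation : ¬ Separation (List.allFin (suc n))
  no-separation (X , Y , X∈ , Y∈ , X0 , Y0 , i∉X , i∈Y , sep) =
    -- As X is tight for x and x̂(X ∪ Y) ≤ 0, `strict` gives ŷ(X ∪ Y) < ŷ(X). As Y is tight for y
    -- and ŷ(X ∩ Y) ≤ 0, modularity gives the opposite inequality.
    impossible (dotᶻ (indicator (X ∪ Y)) (hat y)) (dotᶻ (indicator X) (hat x)) (dotᶻ (indicator (X ∪ Y)) (hat x))
      (dotᶻ (indicator X) (hat y)) (dotᶻ (indicator (X ∩ Y)) (hat y)) strict X0′ ∪x≤0 ∩y≤0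
      (trans (indicator-modular X Y (hat y)) (cong (λ z → dotᶻ (indicator X) (hat y) ℤ.+ z) Y0′))
    where
    impossible : ∀ a b c d e → a ℤ.+ b ℤ.< c ℤ.+ d → b ≡ + 0 → c ℤ.≤ + 0 → e ℤ.≤ + 0 → a ℤ.+ e ≡ d ℤ.+ + 0 → ⊥
    impossible a b c d e lt b≡0 c≤0 e≤0 eq = 0≰-1 (subst (+ 0 ℤ.≤_)
      (trans (lemma a b c d e) (trans (cong₂ (λ p q → ℤ.- p ℤ.- (q ℤ.- (d ℤ.+ + 0)) ℤ.- + 1) b≡0 eq) (lemma₂ d)))
      (<-difference lt ⊕ ≤-difference c≤0 ⊕ ≤-difference e≤0))
      where
      lemma : ∀ a b c d e → (c ℤ.+ d ℤ.- (a ℤ.+ b) ℤ.- + 1) ℤ.+ (+ 0 ℤ.- c) ℤ.+ (+ 0 ℤ.- e) ≡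
        ℤ.- b ℤ.- ((a ℤ.+ e) ℤ.- (d ℤ.+ + 0)) ℤ.- + 1
      lemma = solve-∀ ringℤ
      lemma₂ : ∀ d → ℤ.- + 0 ℤ.- ((d ℤ.+ + 0) ℤ.- (d ℤ.+ + 0)) ℤ.- + 1 ≡ ℤ.- + 1
      lemma₂ = solve-∀ ringℤ
      0≰-1 : ¬ (+ 0 ℤ.≤ ℤ.- + 1)
      0≰-1 ()
    X0′ : dotᶻ (indicator X) (hat x) ≡ + 0
    X0′ = trans (sym (dotᶻ-setRow X x)) X0
    Y0′ : dotᶻ (indicator Y) (hat y) ≡ + 0
    Y0′ = trans (sym (dotᶻ-setRow Y y)) Y0
    ∪x≤0 : dotᶻ (indicator (X ∪ Y)) (hat x) ℤ.≤ + 0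
    ∪x≤0 = subst (ℤ._≤ + 0) (dotᶻ-setRow (X ∪ Y) x) (All.lookup Gx (∪∈ X∈ Y∈))
    ∩y≤0 : dotᶻ (indicator (X ∩ Y)) (hat y) ℤ.≤ + 0
    ∩y≤0 = subst (ℤ._≤ + 0) (dotᶻ-setRow (X ∩ Y) y) (All.lookup Gy (∩∈ X∈ Y∈))
    ordered : ∀ v → lookup X v ≡ false → lookup Y v ≡ true → lookup (hat y) v ℤ.≤ lookup (hat x) v
    ordered v v∉X v∈Y = ℤ.≮⇒≥ λ lt → case All.lookup sep (∈-allFin v) lt of λ
      { (inj₁ v∈X) → case trans (sym v∉X) v∈X of λ ()
      ; (inj₂ v∉Y) → case trans (sym v∈Y) v∉Y of λ () }
    strict : dotᶻ (indicator (X ∪ Y)) (hat y) ℤ.+ dotᶻ (indicator X) (hat x) ℤ.<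
      dotᶻ (indicator (X ∪ Y)) (hat x) ℤ.+ dotᶻ (indicator X) (hat y)
    strict = proj₂ (indicator-strict X Y (hat x) (hat y) ordered) (suc i) i∉X i∈Y y<x

  exchange : ∃ Exchangeable
  exchange with search (List.allFin (suc n))
  ... | inj₁ found = found
  ... | inj₂ sep   = ⊥-elim (no-separation sep)

hat⇒Toward : ∀ {n} {x y : Vec ℤ n} v → lookup (hat x) v ℤ.< lookup (hat y) v → Toward x y v
hat⇒Toward zero _ = inj₁ refl
hat⇒Toward (suc k) lt = inj₂ lt

all-zero : ∀ {n} {d : Vec ℤ n} → (∀ i → lookup d i ≡ + 0) → d ≡ 0ᶻ
all-zero h = vec-ext (λ i → trans (h i) (sym (lookup∘tabulate (λ _ → + 0) i)))

nonzero? : ∀ {n} (d : Vec ℤ n) → (∀ i → lookup d i ≡ + 0) ⊎ ∃[ i ] (lookup d i ≢ + 0)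
nonzero? [] = inj₁ λ ()
nonzero? (d ∷ ds) with d ℤ.≟ + 0 | nonzero? ds
... | no d≢0 | _ = inj₂ (zero , d≢0)
... | yes d≡0 | inj₁ h = inj₁ λ { zero → d≡0 ; (suc i) → h i }
... | yes _ | inj₂ (i , h) = inj₂ (suc i , h)

lookup-0ᶻ : ∀ {n} (i : Fin n) → lookup (0ᶻ {n}) i ≡ + 0
lookup-0ᶻ = lookup∘tabulate (λ _ → + 0)

InSets-0 : ∀ {n} (G : List (Subset (suc n))) → InSets G 0ᶻ
InSets-0 G = All.tabulate (λ {X} _ → ℤ.≤-reflexive (dotᶻ-0 (setRow X)))

-- A member containing `u` but not `v` would take the value 1 on the edge. This supplies the
-- hypothesis of `translate-edge`.
edge-separated : ∀ {n} (G : List (Subset (suc n))) u v → InSets G (0ᶻ +ᶻ pairRow (u , v)) →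
  ∀ {X} → X ∈ G → lookup X u ≡ true → lookup X v ≡ true
edge-separated G u v Guv {X} X∈ u∈X with lookup X v in eq
... | true = refl
... | false = ⊥-elim (1≰0 (subst (ℤ._≤ + 0)
    (trans (setRow-transfer X 0ᶻ u v) (cong₂ (λ p q → p ℤ.+ q) (dotᶻ-0 (setRow X)) (cong₂ (λ a b → χ a ℤ.- χ b) u∈X eq)))
    (All.lookup Guv X∈)))
  where
  1≰0 : ¬ (+ 1 ℤ.≤ + 0)
  1≰0 (ℤ.+≤+ ())

-- d is taken apart into edges ε u − ε v of the cone, along which every point of S can be translated.
translate-cone : ∀ {n} {S : ZSet n} → Stable S → ExchangeM S → ∀ {G} → RingFamily G →
  (∀ X → BoundedSet S X → X ∈ G) → ∀ d → InSets G d → ∀ y → S y → S (y +ᶻ d)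
translate-cone {n} {S} stable exchange {G} ring bounded∈G d = go (suc (distance 0ᶻ d)) d ℕ.≤-refl
  where
  go : ∀ k d → distance 0ᶻ d ℕ.< k → InSets G d → ∀ y → S y → S (y +ᶻ d)
  go (suc k) d (ℕ.s≤s le) Gd y Sy = cases (nonzero? d)
    where
    step : ∀ u v → Toward 0ᶻ d u → Toward d 0ᶻ v → ∀ i → suc i ≡ u ⊎ suc i ≡ v →
      InSets G (0ᶻ +ᶻ pairRow (u , v)) → InSets G (d +ᶻ pairRow (v , u)) → S (y +ᶻ d)
    step u v 0⟶d d⟶0 i i∈ Guv Gd′ = subst S (transfer-undo y d (ε u) (ε v))
      (go k (d +ᶻ pairRow (v , u)) (ℕ.<-≤-trans (transfer-closer 0ᶻ d v u d⟶0 0⟶d i (swap i∈)) le) Gd′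
        (y +ᶻ pairRow (u , v)) (translate-edge stable exchange y Sy u v
          (λ X bX → edge-separated G u v Guv (bounded∈G X bX))))
      where
      swap : suc i ≡ u ⊎ suc i ≡ v → suc i ≡ v ⊎ suc i ≡ u
      swap (inj₁ p) = inj₂ p
      swap (inj₂ p) = inj₁ p
    cases : _ → S (y +ᶻ d)
    cases (inj₁ d≡0) = subst S (sym (trans (cong (y +ᶻ_) (all-zero d≡0)) (+ᶻ-identityʳ y))) Sy
      where
      +ᶻ-identityʳ : ∀ {m} (y : Vec ℤ m) → y +ᶻ 0ᶻ ≡ y
      +ᶻ-identityʳ [] = refl
      +ᶻ-identityʳ (y ∷ ys) = cong₂ _∷_ (ℤ.+-identityʳ y) (+ᶻ-identityʳ ys)
    cases (inj₂ (i , dᵢ≢0)) with ℤ.<-cmp (lookup d i) (+ 0)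
    ... | tri≈ _ dᵢ≡0 _ = ⊥-elim (dᵢ≢0 dᵢ≡0)
    -- The exchange between d and 0 splits d into an edge and a rest nearer to 0, both in the cone.
    ... | tri> _ _ 0<dᵢ with RingExchange.exchange ring d 0ᶻ i Gd (InSets-0 G) (subst (ℤ._< lookup d i) (sym (lookup-0ᶻ i)) 0<dᵢ)
    ...   | v , lt , Gd′ , Guv =
      step (suc i) v (inj₂ (subst (ℤ._< lookup d i) (sym (lookup-0ᶻ i)) 0<dᵢ)) (hat⇒Toward v lt) i (inj₁ refl) Guv Gd′
    cases (inj₂ (i , dᵢ≢0)) | tri< dᵢ<0 _ _ with RingExchange.exchange ring 0ᶻ d i (InSets-0 G) Gd (subst (lookup d i ℤ.<_) (sym (lookup-0ᶻ i)) dᵢ<0)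
    ...   | v , lt , Guv , Gd′ =
      step v (suc i) (hat⇒Toward v lt) (inj₂ (subst (lookup d i ℤ.<_) (sym (lookup-0ᶻ i)) dᵢ<0)) i (inj₂ refl) Guv Gd′

-- Boxes and recession cones for M♮- and M-convex sets

Exchanges : ∀ {n} → ZSet n → Vec ℤ n → Vec ℤ n → Fin n → Fin (suc n) → Set
Exchanges S x y i v = Toward x y v × S (x +ᶻ pairRow (v , suc i)) × S (y +ᶻ pairRow (suc i , v))

IsMNat⇒Exchanges : ∀ {n} {S : ZSet n} → IsMNat S → ∀ x y i → S x → S y → lookup y i ℤ.< lookup x i → ∃ (Exchanges S x y i)
IsMNat⇒Exchanges {S = S} S-MNat x y i Sx Sy lt with lower (S-MNat x y i Sx Sy lt)
... | inj₁ (Sx′ , Sy′) = zero , inj₁ refl , subst S (remove-only x (e i)) Sx′ , subst S (add-only y (e i)) Sy′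
... | inj₂ (j , xⱼ<yⱼ , Sx′ , Sy′) =
  suc j , inj₂ xⱼ<yⱼ , subst S (remove-add x (e i) (e j)) Sx′ , subst S (add-remove y (e i) (e j)) Sy′

Exchanges⇒IsMNat : ∀ {n} {S : ZSet n} → (∀ x y i → S x → S y → lookup y i ℤ.< lookup x i → ∃ (Exchanges S x y i)) → IsMNat S
Exchanges⇒IsMNat {S = S} exchange x y i Sx Sy lt with exchange x y i Sx Sy lt
... | zero , _ , Sx′ , Sy′ = lift (inj₁ (subst S (sym (remove-only x (e i))) Sx′ , subst S (sym (add-only y (e i))) Sy′))
... | suc j , inj₂ xⱼ<yⱼ , Sx′ , Sy′ = lift (inj₂ (j , xⱼ<yⱼ ,
  subst S (sym (remove-add x (e i) (e j))) Sx′ , subst S (sym (add-remove y (e i) (e j))) Sy′))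

IsM⇒Exchanges : ∀ {n} {S : ZSet n} → IsM S → ∀ x y i → S x → S y → lookup y i ℤ.< lookup x i → ∃[ j ] Exchanges S x y i (suc j)
IsM⇒Exchanges {S = S} S-M x y i Sx Sy lt with lower (S-M x y i Sx Sy lt)
... | j , xⱼ<yⱼ , Sx′ , Sy′ =
  j , inj₂ xⱼ<yⱼ , subst S (remove-add x (e i) (e j)) Sx′ , subst S (add-remove y (e i) (e j)) Sy′

Exchanges⇒IsM : ∀ {n} {S : ZSet n} → (∀ x y i → S x → S y → lookup y i ℤ.< lookup x i → ∃[ j ] Exchanges S x y i (suc j)) → IsM S
Exchanges⇒IsM {S = S} exchange x y i Sx Sy lt with exchange x y i Sx Sy lt
... | j , inj₂ xⱼ<yⱼ , Sx′ , Sy′ = lift (j , xⱼ<yⱼ ,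
  subst S (sym (remove-add x (e i) (e j))) Sx′ , subst S (sym (add-remove y (e i) (e j))) Sy′)

IsM⇒IsMNat : ∀ {n} {S : ZSet n} → IsM S → IsMNat S
IsM⇒IsMNat S-M x y i Sx Sy lt = lift (inj₂ (lower (S-M x y i Sx Sy lt)))

-- Every changed entry moves toward the corresponding entry of y, so it stays between two entries
-- within the box.
transfer-in-box : ∀ {n} {N} (x y : Vec ℤ n) u v → Toward x y u → Toward y x v → Box N x → Box N y → Box N (x +ᶻ pairRow (u , v))
transfer-in-box {N = N} x y u v x⟶y y⟶x x∈ y∈ k = subst (λ z → ℤ.- N ℤ.≤ z × z ℤ.≤ N) (sym (lookup-transfer x u v k))
  (cases (suc k ≟ u) (suc k ≟ v))
  where
  InN : ℤ → Set
  InN z = ℤ.- N ℤ.≤ z × z ℤ.≤ N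
  lemma₁ : ∀ x → x ℤ.+ (+ 1 ℤ.- + 0) ≡ x ℤ.+ + 1
  lemma₁ = solve-∀ ringℤ
  lemma₂ : ∀ x y → y ≡ (x ℤ.+ (+ 1 ℤ.- + 0)) ℤ.+ (y ℤ.- x ℤ.- + 1)
  lemma₂ = solve-∀ ringℤ
  lemma₃ : ∀ x y → x ℤ.+ (+ 0 ℤ.- + 1) ≡ y ℤ.+ (x ℤ.- y ℤ.- + 1)
  lemma₃ = solve-∀ ringℤ
  lemma₄ : ∀ x → x ≡ (x ℤ.+ (+ 0 ℤ.- + 1)) ℤ.+ + 1
  lemma₄ = solve-∀ ringℤ
  cases : Dec (suc k ≡ u) → Dec (suc k ≡ v) → InN (lookup x k ℤ.+ (δ u k ℤ.- δ v k))
  cases (yes ≡u) (yes ≡v) = ⊥-elim (ℤ.<-asym (Toward-suc x y (subst (Toward x y) (sym ≡u) x⟶y)) (Toward-suc y x (subst (Toward y x) (sym ≡v) y⟶x)))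
  cases (yes ≡u) (no ≢v) = subst₂ (λ p q → InN (lookup x k ℤ.+ (p ℤ.- q))) (sym (δ-yes ≡u)) (sym (δ-no ≢v))
    (ℤ.≤-trans (proj₁ (x∈ k)) (≤-by {r = + 1} (ℤ.+≤+ ℕ.z≤n) (lemma₁ (lookup x k))) ,
     ℤ.≤-trans (≤-by (<-difference (Toward-suc x y (subst (Toward x y) (sym ≡u) x⟶y))) (lemma₂ (lookup x k) (lookup y k))) (proj₂ (y∈ k)))
  cases (no ≢u) (yes ≡v) = subst₂ (λ p q → InN (lookup x k ℤ.+ (p ℤ.- q))) (sym (δ-no ≢u)) (sym (δ-yes ≡v))
    (ℤ.≤-trans (proj₁ (y∈ k)) (≤-by (<-difference (Toward-suc y x (subst (Toward y x) (sym ≡v) y⟶x))) (lemma₃ (lookup x k) (lookup y k))) ,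
     ℤ.≤-trans (≤-by {r = + 1} (ℤ.+≤+ ℕ.z≤n) (lemma₄ (lookup x k))) (proj₂ (x∈ k)))
  cases (no ≢u) (no ≢v) = subst₂ (λ p q → InN (lookup x k ℤ.+ (p ℤ.- q))) (sym (δ-no ≢u)) (sym (δ-no ≢v))
    (subst InN (sym (ℤ.+-identityʳ (lookup x k))) (x∈ k))


Exchanges-in-box : ∀ {n} (S : ZSet n) N x y i v → lookup y i ℤ.< lookup x i → Box (+ N) x → Box (+ N) y →
  Exchanges S x y i v → Exchanges (InBox S N) x y i v
Exchanges-in-box S N x y i v lt x∈ y∈ (toward , Sx′ , Sy′) =
  toward , (Sx′ , transfer-in-box x y v (suc i) toward (inj₂ lt) x∈ y∈) , (Sy′ , transfer-in-box y x (suc i) v (inj₂ lt) toward y∈ x∈)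

Box-MNat : ∀ {n} {S : ZSet n} → IsMNat S → ∀ N → IsMNat (InBox S N)
Box-MNat {S = S} S-MNat N = Exchanges⇒IsMNat λ { x y i (Sx , x∈) (Sy , y∈) lt →
  case IsMNat⇒Exchanges S-MNat x y i Sx Sy lt of λ { (v , ex) → v , Exchanges-in-box S N x y i v lt x∈ y∈ ex } }

Box-M : ∀ {n} {S : ZSet n} → IsM S → ∀ N → IsM (InBox S N)
Box-M {S = S} S-M N = Exchanges⇒IsM λ { x y i (Sx , x∈) (Sy , y∈) lt →
  case IsM⇒Exchanges S-M x y i Sx Sy lt of λ { (j , ex) → j , Exchanges-in-box S N x y i (suc j) lt x∈ y∈ ex } }

allSubsets : ∀ m → List (Subset m)
allSubsets zero = [] ∷ []
allSubsets (suc m) = List.map (true ∷_) (allSubsets m) ++ List.map (false ∷_) (allSubsets m)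

∈-allSubsets : ∀ {m} (X : Subset m) → X ∈ allSubsets m
∈-allSubsets [] = here refl
∈-allSubsets (true ∷ X) = ∈-++⁺ˡ (∈-map⁺ (true ∷_) (∈-allSubsets X))
∈-allSubsets {suc m} (false ∷ X) = ∈-++⁺ʳ (List.map (true ∷_) (allSubsets m)) (∈-map⁺ (false ∷_) (∈-allSubsets X))

_∈?_ : ∀ {m} (X : Subset m) G → Dec (X ∈ G)
X ∈? G = Any.any? (≡-dec Bool._≟_ X) G

RingFamily? : ∀ {m} (G : List (Subset m)) → Dec (RingFamily G)
RingFamily? {m} G = map′
  (λ { (closed , full∈ , empty∈) → record { closed = closed ; full∈ = full∈ ; empty∈ = empty∈ } })
  (λ ring → let open RingFamily ring in closed , full∈ , empty∈)
  (All.all? (λ X → All.all? (λ Y → ((X ∪ Y) ∈? G) ×-dec ((X ∩ Y) ∈? G)) G) G ×-dec ((full ∈? G) ×-dec (empty ∈? G)))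

IntCone⇒InSets : ∀ {n} (G : List (Subset (suc n))) {x} → IntCone (setRows G) x → InSets G x
IntCone⇒InSets G = All.map⁻

InSets⇒IntCone : ∀ {n} (G : List (Subset (suc n))) {x} → InSets G x → IntCone (setRows G) x
InSets⇒IntCone G = All.map⁺

ringCone-MNat : ∀ {n} {G : List (Subset (suc n))} → RingFamily G → IsMNat (IntCone (setRows G))
ringCone-MNat {G = G} ring = Exchanges⇒IsMNat λ x y i Gx Gy lt →
  case RingExchange.exchange ring x y i (IntCone⇒InSets G Gx) (IntCone⇒InSets G Gy) lt of λ
    { (v , hat< , Gx′ , Gy′) → v , hat⇒Toward v hat< , InSets⇒IntCone G Gx′ , InSets⇒IntCone G Gy′ }

-- The argument runs on the double negation of `S`, which is stable as `translate-cone` requires. It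
-- has the same bounded sets as `S`, because inequalities between integers are decidable.
MNat-recedes : ∀ {n} {S : ZSet n} → IsMNat S → NonemptyZ S →
  ¬ ¬ (∃[ G ] (G ∈ sublists (allSubsets (suc n)) × RingFamily G × (∀ X → BoundedSet S X → X ∈ G) × RecedesAlong S (setRows G)))
MNat-recedes {n} {S} S-MNat (s₀ , Ss₀) = ¬¬-select (BoundedSet S) (allSubsets (suc n)) >>= λ { (G , G∈ , G-bounded , G⊇) →
  let bounded∈G : ∀ X → BoundedSet S X → X ∈ G
      bounded∈G X bX = G⊇ (∈-allSubsets X) bX
      ring : RingFamily G
      ring = record
        { closed = All.tabulate λ {X} X∈ → All.tabulate λ {Y} Y∈ →
            let b∪ , b∩ = BoundedSet-∪-∩ exchange (pure Ss₀) X Y (weaken X (All.lookup G-bounded X∈)) (weaken Y (All.lookup G-bounded Y∈)) in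
            bounded∈G (X ∪ Y) (strengthen (X ∪ Y) b∪) , bounded∈G (X ∩ Y) (strengthen (X ∩ Y) b∩)
        ; full∈  = bounded∈G full (+ 0 , λ s _ → ℤ.≤-reflexive (dotᶻ-full s))
        ; empty∈ = bounded∈G empty (+ 0 , λ s _ → ℤ.≤-reflexive (dotᶻ-empty s))
        }
  in pure (G , G∈ , ring , bounded∈G , record
    { rows-bounded = All.map⁺ G-bounded
    ; translates = λ d Gd s Ss → translate-cone (λ _ → negated-stable) exchange ring (λ X bX → bounded∈G X (strengthen X bX))
        d (IntCone⇒InSets G Gd) s (pure Ss)
    }) }
  where
  S̄ : ZSet n
  S̄ x = ¬ ¬ S x
  negated-stable : ∀ {A : Set} → ¬ ¬ ¬ ¬ A → ¬ ¬ A
  negated-stable h ¬a = h λ k → k ¬a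
  exchange : ExchangeM S̄
  exchange x y i ¬¬Sx ¬¬Sy lt = ¬¬Sx >>= λ Sx → ¬¬Sy >>= λ Sy →
    case IsMNat⇒Exchanges S-MNat x y i Sx Sy lt of λ { (v , toward , Sx′ , Sy′) → pure (v , toward , pure Sx′ , pure Sy′) }
  weaken : ∀ X → BoundedSet S X → BoundedSet S̄ X
  weaken X (M , S≤M) = M , λ s ¬¬Ss → decidable-stable (dotᶻ (setRow X) s ℤ.≤? M) (¬¬Ss >>= λ Ss → pure (S≤M s Ss))
  strengthen : ∀ X → BoundedSet S̄ X → BoundedSet S X
  strengthen X (M , S≤M) = M , λ s Ss → S≤M s (pure Ss)

MNat-cones : ∀ n → ConeFamily (IsMNat {n})
MNat-cones n = record
  { cones      = List.map setRows (List.filter RingFamily? (sublists (allSubsets (suc n))))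
  ; cone-class = λ B B∈ → case ∈-map⁻ setRows B∈ of λ { (G , G∈ , refl) →
      ringCone-MNat (proj₂ (∈-filter⁻ RingFamily? {xs = sublists (allSubsets (suc n))} G∈)) }
  ; recedes    = λ S-MNat S-nonempty → MNat-recedes S-MNat S-nonempty >>= λ { (G , G∈ , ring , _ , rec) →
      pure (setRows G , ∈-map⁺ setRows (∈-filter⁺ RingFamily? G∈ ring) , rec) }
  ; box-class  = Box-MNat
  }

-- M-convex sets lie in a hyperplane of constant coordinate sum.

-- Their functionals are the total and its negative; a cone with both rows lies in the hyperplane of
-- total 0.
positiveSet negativeSet : ∀ n → Subset (suc n)
positiveSet _ = false ∷ full
negativeSet _ = true ∷ empty

dotᶻ-positiveSet : ∀ {n} (x : Vec ℤ n) → dotᶻ (setRow (positiveSet n)) x ≡ total x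
dotᶻ-positiveSet [] = refl
dotᶻ-positiveSet (x ∷ xs) = cong₂ ℤ._+_ (ℤ.*-identityˡ x) (dotᶻ-positiveSet xs)

dotᶻ-negativeSet : ∀ {n} (x : Vec ℤ n) → dotᶻ (setRow (negativeSet n)) x ≡ ℤ.- total x
dotᶻ-negativeSet [] = refl
dotᶻ-negativeSet (x ∷ xs) = trans (cong₂ ℤ._+_ (lemma x) (dotᶻ-negativeSet xs)) (sym (ℤ.neg-distrib-+ x (total xs)))
  where
  lemma : ∀ x → (+ 0 ℤ.- + 1) ℤ.* x ≡ ℤ.- x
  lemma = solve-∀ ringℤ

-- If x had the larger total, some coordinate would exceed that of y. The exchange there has a real
-- partner, so it keeps the total while x comes closer to y; induction on the distance ends this.
M-total-≤ : ∀ {n} {S : ZSet n} → IsM S → ∀ x y → S x → S y → total x ℤ.≤ total y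
M-total-≤ {n} {S} S-M x y Sx Sy = subst₂ ℤ._≤_ (dotᶻ-positiveSet x) (dotᶻ-positiveSet y) (go (suc (distance y x)) x ℕ.≤-refl Sx)
  where
  X : Subset (suc n)
  X = positiveSet n
  go : ∀ k x → distance y x ℕ.< k → S x → dotᶻ (setRow X) x ℤ.≤ dotᶻ (setRow X) y
  go (suc k) x (ℕ.s≤s le) Sx = ℤ.≮⇒≥ λ lt → case set-increase X x y refl lt of λ { (i , _ , yᵢ<xᵢ) →
    case IsM⇒Exchanges S-M x y i Sx Sy yᵢ<xᵢ of λ { (j , toward , Sx′ , _) →
      ℤ.<-irrefl refl (ℤ.<-≤-trans lt (subst (ℤ._≤ dotᶻ (setRow X) y)
        (trans (setRow-transfer X x (suc j) (suc i))
          (trans (cong₂ (λ a b → dotᶻ (setRow X) x ℤ.+ (χ a ℤ.- χ b)) (lookup-replicate j true) (lookup-replicate i true)) (ℤ.+-identityʳ _)))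
        (go k _ (ℕ.<-≤-trans (transfer-closer y x (suc j) (suc i) toward (inj₂ yᵢ<xᵢ) i (inj₂ refl)) le) Sx′))) } }

BalancedRing : ∀ {n} → List (Subset (suc n)) → Set
BalancedRing {n} G = RingFamily G × positiveSet n ∈ G × negativeSet n ∈ G

BalancedRing? : ∀ {n} (G : List (Subset (suc n))) → Dec (BalancedRing G)
BalancedRing? {n} G = RingFamily? G ×-dec ((positiveSet n ∈? G) ×-dec (negativeSet n ∈? G))

balanced-total : ∀ {n} {G : List (Subset (suc n))} → BalancedRing G → ∀ x → InSets G x → ℤ.- total x ≡ + 0
balanced-total (_ , +∈ , -∈) x Gx = ℤ.≤-antisym
  (subst (ℤ._≤ + 0) (dotᶻ-negativeSet x) (All.lookup Gx -∈))
  (ℤ.neg-mono-≤ (subst (ℤ._≤ + 0) (dotᶻ-positiveSet x) (All.lookup Gx +∈)))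

-- All totals vanish, so x̂ and ŷ agree at index 0, and the partner found by `RingExchange` must be
-- a real coordinate.
balancedCone-M : ∀ {n} {G : List (Subset (suc n))} → BalancedRing G → IsM (IntCone (setRows G))
balancedCone-M {n} {G} balanced = Exchanges⇒IsM λ x y i Gx Gy lt →
  go x y i (IntCone⇒InSets G Gx) (IntCone⇒InSets G Gy) (RingExchange.exchange (proj₁ balanced) x y i (IntCone⇒InSets G Gx) (IntCone⇒InSets G Gy) lt)
  where
  go : ∀ x y i → InSets G x → InSets G y →
    ∃[ v ] (lookup (hat x) v ℤ.< lookup (hat y) v × InSets G (x +ᶻ pairRow (v , suc i)) × InSets G (y +ᶻ pairRow (suc i , v))) →
    ∃[ j ] Exchanges (IntCone (setRows G)) x y i (suc j)
  go x y i Gx Gy (zero , lt , _) = ⊥-elim (ℤ.<-irrefl (trans (balanced-total balanced x Gx) (sym (balanced-total balanced y Gy))) lt)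
  go x y i Gx Gy (suc j , lt , Gx′ , Gy′) = j , inj₂ lt , InSets⇒IntCone G Gx′ , InSets⇒IntCone G Gy′

M-cones : ∀ n → ConeFamily (IsM {n})
M-cones n = record
  { cones      = List.map setRows (List.filter BalancedRing? (sublists (allSubsets (suc n))))
  ; cone-class = λ B B∈ → case ∈-map⁻ setRows B∈ of λ { (G , G∈ , refl) →
      balancedCone-M (proj₂ (∈-filter⁻ BalancedRing? {xs = sublists (allSubsets (suc n))} G∈)) }
  ; recedes    = λ { {S} S-M (s₀ , Ss₀) → MNat-recedes (IsM⇒IsMNat S-M) (s₀ , Ss₀) >>= λ { (G , G∈ , ring , bounded∈G , rec) →
      pure (setRows G , ∈-map⁺ setRows (∈-filter⁺ BalancedRing? G∈ (ring ,
        bounded∈G (positiveSet n) (total s₀ , λ s Ss →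
          subst (ℤ._≤ total s₀) (sym (dotᶻ-positiveSet s)) (M-total-≤ S-M s s₀ Ss Ss₀)) ,
        bounded∈G (negativeSet n) (ℤ.- total s₀ , λ s Ss →
          subst (ℤ._≤ ℤ.- total s₀) (sym (dotᶻ-negativeSet s)) (ℤ.neg-mono-≤ (M-total-≤ S-M s₀ s Ss₀ Ss))))) , rec) } }
  ; box-class  = Box-M
  }

-- Intersections

_⊓ˢ_ : ∀ {n} → ZSet n → ZSet n → ZSet n
(S ⊓ˢ T) x = S x × T x

RecedesAlong-++ : ∀ {n} {S T : ZSet n} {A B} → RecedesAlong S A → RecedesAlong T B → RecedesAlong (S ⊓ˢ T) (A ++ B)
RecedesAlong-++ {A = A} recS recT = record
  { rows-bounded = All.++⁺ (All.map (λ { (M , h) → M , λ s Ss → h s (proj₁ Ss) }) S.rows-bounded)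
                           (All.map (λ { (M , h) → M , λ s Ss → h s (proj₂ Ss) }) T.rows-bounded)
  ; translates = λ { d ABd s (Ss , Ts) →
      S.translates d (All.++⁻ˡ A ABd) s Ss >>= λ Ss′ → T.translates d (All.++⁻ʳ A ABd) s Ts >>= λ Ts′ → pure (Ss′ , Ts′) }
  }
  where
  module S = RecedesAlong recS
  module T = RecedesAlong recT

-- IsMNat2 and IsM2 unfold to Intersection IsMNat and Intersection IsM.
Intersection : ∀ {n} → (ZSet n → Set₁) → ZSet n → Set₁
Intersection {n} A S = Σ (ZSet n) λ S₁ → Σ (ZSet n) λ S₂ →
  NonemptyZ S₁ × A S₁ × NonemptyZ S₂ × A S₂ × Level.Lift (Level.suc 0ℓ) (S ≐ (λ x → S₁ x × S₂ x))

decompose-intersection : ∀ {n} {A : ZSet n → Set₁} → ConeFamily A →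
  ∀ {P} → IsPolyhedron P → IsClassPolyhedron (Intersection A) P → HasDecomposition (Intersection A) P
decompose-intersection {n} {A} F P-poly
  (S , (s , Ss) , (S₁ , S₂ , S₁-nonempty , A-S₁ , S₂-nonempty , A-S₂ , lift S≐) , lift P≐conv) =
  decompose-by-search P-poly (s , Equivalence.to (S≐ s) Ss) (≐-trans P≐conv (conv-cong S≐)) truncation
    (List.cartesianProductWith _++_ cones cones)
    (λ B B∈ → case ∈-cartesianProductWith⁻ _++_ cones cones B∈ of λ { (B₁ , B₂ , B₁∈ , B₂∈ , refl) →
      IntCone B₁ , IntCone B₂ , (0ᶻ , IntCone-0 B₁) , cone-class B₁ B₁∈ , (0ᶻ , IntCone-0 B₂) , cone-class B₂ B₂∈ ,
      lift (λ x → mk⇔ (λ h → All.++⁻ˡ B₁ h , All.++⁻ʳ B₁ h) (λ { (h₁ , h₂) → All.++⁺ h₁ h₂ })) })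
    (recedes A-S₁ S₁-nonempty >>= λ { (B₁ , B₁∈ , rec₁) → recedes A-S₂ S₂-nonempty >>= λ { (B₂ , B₂∈ , rec₂) →
      pure (B₁ ++ B₂ , ∈-cartesianProductWith⁺ _++_ B₁∈ B₂∈ , RecedesAlong-++ rec₁ rec₂) } })
  where
  open ConeFamily F
  truncation : Truncation (Intersection A) (S₁ ⊓ˢ S₂)
  truncation = record
    { part          = λ N → InBox S₁ N ⊓ˢ InBox S₂ N
    ; part⊆         = λ { N x ((S₁x , _) , (S₂x , _)) → S₁x , S₂x }
    ; part-exhausts = λ { x (S₁x , S₂x) → proj₁ (in-some-box x) , λ M le →
        (S₁x , proj₂ (in-some-box x) M le) , (S₂x , proj₂ (in-some-box x) M le) }
    ; part-bounded  = λ N → + N , λ { x ((_ , x∈) , _) → x∈ }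
    ; part-class    = λ { N (x , x₁ , x₂) →
        InBox S₁ N , InBox S₂ N , (x , x₁) , box-class A-S₁ N , (x , x₂) , box-class A-S₂ N , lift (λ _ → mk⇔ id id) }
    }

-- Minkowski sums

Sum : ∀ {n} → ZSet n → ZSet n → ZSet n
Sum S₁ S₂ x = ∃[ a ] ∃[ b ] (S₁ a × S₂ b × x ≡ a +ᶻ b)

Hull-Sum : ∀ {n} {S₁ S₂ : ZSet n} {τ x} → Hull (Embedded (Sum S₁ S₂)) τ x →
  ∃[ x₁ ] ∃[ x₂ ] (Hull (Embedded S₁) τ x₁ × Hull (Embedded S₂) τ x₂ × x ≡ x₁ +ᵠ x₂)
Hull-Sum zero-hull = 0ᵠ , 0ᵠ , zero-hull , zero-hull , sym (+ᵠ-identityˡ _)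
Hull-Sum (add-point {w} 0≤w (_ , (a , b , S₁a , S₂b , refl) , refl) h) with Hull-Sum h
... | x₁ , x₂ , h₁ , h₂ , refl =
  (w ·ᵠ embed a) +ᵠ x₁ , (w ·ᵠ embed b) +ᵠ x₂ , add-point 0≤w (a , S₁a , refl) h₁ , add-point 0≤w (b , S₂b , refl) h₂ ,
  trans (cong (_+ᵠ (x₁ +ᵠ x₂)) (trans (cong (w ·ᵠ_) (embed-+ a b)) (·ᵠ-distribˡ w (embed a) (embed b))))
    (+ᵠ-interchange (w ·ᵠ embed a) (w ·ᵠ embed b) x₁ x₂)

Sum-truncation : ∀ {n} {S₁ S₂ : ZSet n} → IsLNat S₁ → IsLNat S₂ → Truncation IsLNat2 (Sum S₁ S₂)
Sum-truncation {S₁ = S₁} {S₂} S₁-LNat S₂-LNat = record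
  { part          = λ N → Sum (InBox S₁ N) (InBox S₂ N)
  ; part⊆         = λ { N x (a , b , (S₁a , _) , (S₂b , _) , eq) → a , b , S₁a , S₂b , eq }
  ; part-exhausts = λ { x (a , b , S₁a , S₂b , eq) → proj₁ (in-some-box a) ℕ.⊔ proj₁ (in-some-box b) , λ M le →
      a , b , (S₁a , proj₂ (in-some-box a) M (ℕ.m⊔n≤o⇒m≤o (proj₁ (in-some-box a)) _ le)) ,
      (S₂b , proj₂ (in-some-box b) M (ℕ.m⊔n≤o⇒n≤o (proj₁ (in-some-box a)) _ le)) , eq }
  ; part-bounded  = λ N → + N ℤ.+ + N , λ { _ (a , b , (_ , a∈) , (_ , b∈) , refl) i →
      subst (λ z → ℤ.- (+ N ℤ.+ + N) ℤ.≤ z × z ℤ.≤ + N ℤ.+ + N) (sym (lookup-zipWith ℤ._+_ i a b))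
        (subst (ℤ._≤ lookup a i ℤ.+ lookup b i) (sym (ℤ.neg-distrib-+ (+ N) (+ N))) (ℤ.+-mono-≤ (proj₁ (a∈ i)) (proj₁ (b∈ i))) ,
         ℤ.+-mono-≤ (proj₂ (a∈ i)) (proj₂ (b∈ i))) }
  ; part-class    = λ { N (_ , a , b , a∈ , b∈ , _) →
      InBox S₁ N , InBox S₂ N , (a , a∈) , Box-LNat S₁-LNat N , (b , b∈) , Box-LNat S₂-LNat N , lift (λ _ → mk⇔ id id) }
  }

-- The second summand is eliminated as x - y. For fixed x the remaining y form a polyhedron, whose
-- nonemptiness is decidable.
SumCone : ∀ {n} → List (Vec ℚ n) → List (Vec ℚ n) → QSet n
SumCone A B x = ∃[ y ] (HCone A y × HCone B (x +ᵠ ((ℚ.- 1ℚ) ·ᵠ y)))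

private
  cancel-difference : ∀ {n} (x y : Vec ℚ n) → y +ᵠ (x +ᵠ ((ℚ.- 1ℚ) ·ᵠ y)) ≡ x
  cancel-difference [] [] = refl
  cancel-difference (x ∷ xs) (y ∷ ys) = cong₂ _∷_ (lemma x y) (cancel-difference xs ys)
    where
    lemma : ∀ x y → y ℚ.+ (x ℚ.+ (ℚ.- 1ℚ) ℚ.* y) ≡ x
    lemma = solve-∀ ringℚ

  cancel-summand : ∀ {n} (y z : Vec ℚ n) → (y +ᵠ z) +ᵠ ((ℚ.- 1ℚ) ·ᵠ y) ≡ z
  cancel-summand [] [] = refl
  cancel-summand (y ∷ ys) (z ∷ zs) = cong₂ _∷_ (lemma y z) (cancel-summand ys zs)
    where
    lemma : ∀ y z → (y ℚ.+ z) ℚ.+ (ℚ.- 1ℚ) ℚ.* y ≡ z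
    lemma = solve-∀ ringℚ

SumCone-intro : ∀ {n} (A B : List (Vec ℚ n)) {y z} → HCone A y → HCone B z → SumCone A B (y +ᵠ z)
SumCone-intro A B {y} {z} Ay Bz = y , Ay , subst (HCone B) (sym (cancel-summand y z)) Bz

SumCone-elim : ∀ {n} (A B : List (Vec ℚ n)) {x} → SumCone A B x → ∃[ y ] ∃[ z ] (HCone A y × HCone B z × x ≡ y +ᵠ z)
SumCone-elim A B {x} (y , Ay , Bz) = y , x +ᵠ ((ℚ.- 1ℚ) ·ᵠ y) , Ay , Bz , sym (cancel-difference x y)

Cone⊆SumCone : ∀ {n} {G : QSet n} A B → (∀ g → G g → SumCone A B g) → ∀ {x} → Cone G x → SumCone A B x
Cone⊆SumCone A B G⊆ zero-cone = subst (SumCone A B) (+ᵠ-identityˡ 0ᵠ) (SumCone-intro A B (HCone-0 A) (HCone-0 B))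
Cone⊆SumCone A B G⊆ (add-ray {c} {g} {x} 0≤c Gg Gx) = add (SumCone-elim A B (G⊆ g Gg)) (SumCone-elim A B (Cone⊆SumCone A B G⊆ Gx))
  where
  Split : Vec ℚ _ → Set
  Split x = ∃[ y ] ∃[ z ] (HCone A y × HCone B z × x ≡ y +ᵠ z)
  add : Split g → Split x → SumCone A B ((c ·ᵠ g) +ᵠ x)
  add (y , z , Ay , Bz , refl) (y′ , z′ , Ay′ , Bz′ , refl) =
    subst (SumCone A B) (trans (+ᵠ-interchange (c ·ᵠ y) y′ (c ·ᵠ z) z′) (cong (_+ᵠ (y′ +ᵠ z′)) (sym (·ᵠ-distribˡ c y z))))
      (SumCone-intro A B (HCone-+ A (HCone-· A 0≤c Ay) Ay′) (HCone-+ B (HCone-· B 0≤c Bz) Bz′))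

private
  membership-row : ∀ {n} (r x y : Vec ℚ n) → dot r (x +ᵠ ((ℚ.- 1ℚ) ·ᵠ y)) ≡ dot r x ℚ.- dot r y
  membership-row r x y = trans (dot-+ r x _) (trans (cong (dot r x ℚ.+_) (dot-· r (ℚ.- 1ℚ) y)) (lemma (dot r x) (dot r y)))
    where
    lemma : ∀ a b → a ℚ.+ (ℚ.- 1ℚ) ℚ.* b ≡ a ℚ.- b
    lemma = solve-∀ ringℚ

SumCone? : ∀ {n} (A B : List (Vec ℚ n)) x → Dec (SumCone A B x)
SumCone? {n} A B x = map′ (λ { (y , h) → y , All.map⁻ (All.++⁻ˡ (rowsA A) h) , to-B B (All.++⁻ʳ (rowsA A) h) })
  (λ { (y , Ay , Bz) → y , All.++⁺ (All.map⁺ Ay) (from-B B Bz) }) (HPoly-nonempty? (rowsA A ++ rowsB B))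
  where
  rowsA rowsB : List (Vec ℚ n) → List (ℚ × Vec ℚ n)
  rowsA = List.map (λ r → 0ℚ , r)
  rowsB = List.map (λ r → ℚ.- dot r x , (ℚ.- 1ℚ) ·ᵠ r)
  row≡ : ∀ r y → dot ((ℚ.- 1ℚ) ·ᵠ r) y ≡ ℚ.- dot r y
  row≡ r y = trans (dot-·ˡ (ℚ.- 1ℚ) r y) (lemma (dot r y))
    where
    lemma : ∀ a → (ℚ.- 1ℚ) ℚ.* a ≡ ℚ.- a
    lemma = solve-∀ ringℚ
  to-B : ∀ B {y} → HPoly (rowsB B) y → HCone B (x +ᵠ ((ℚ.- 1ℚ) ·ᵠ y))
  to-B B {y} = All.map (λ {r} h → subst (ℚ._≤ 0ℚ) (sym (membership-row r x y))
    (≤-from-difference (p≤q⇒0≤q-p (subst (ℚ._≤ ℚ.- dot r x) (row≡ r y) h)) (lemma (dot r x) (dot r y)))) ∘ All.map⁻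
    where
    lemma : ∀ a b → 0ℚ ≡ (a ℚ.- b) ℚ.+ (ℚ.- a ℚ.- ℚ.- b)
    lemma = solve-∀ ringℚ
  from-B : ∀ B {y} → HCone B (x +ᵠ ((ℚ.- 1ℚ) ·ᵠ y)) → HPoly (rowsB B) y
  from-B B {y} = All.map⁺ ∘ All.map λ {r} h → subst (ℚ._≤ ℚ.- dot r x) (sym (row≡ r y))
    (≤-from-difference (p≤q⇒0≤q-p (subst (ℚ._≤ 0ℚ) (membership-row r x y) h)) (lemma (dot r x) (dot r y)))
    where
    lemma : ∀ a b → ℚ.- a ≡ ℚ.- b ℚ.+ (0ℚ ℚ.- (a ℚ.- b))
    lemma = solve-∀ ringℚ

SumCone≐conv : ∀ {n} (B₁ B₂ : List (Vec ℤ n)) →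
  SumCone (rationalRows B₁) (rationalRows B₂) ≐ conv (Sum (IntCone B₁) (IntCone B₂))
SumCone≐conv {n} B₁ B₂ x = mk⇔ to from
  where
  ½ 2ℚ : ℚ
  ½ = ℚ.½
  2ℚ = 1ℚ ℚ.+ 1ℚ
  V : QSet n
  V = Embedded (Sum (IntCone B₁) (IntCone B₂))
  0≤2 : 0ℚ ℚ.≤ 2ℚ
  0≤2 = 0≤p+q 0≤1 0≤1
  0≤½ : 0ℚ ℚ.≤ ½
  0≤½ = ℚ.nonNegative⁻¹ ½
  half-double : ∀ (y : Vec ℚ n) → ½ ·ᵠ (2ℚ ·ᵠ y) ≡ y
  half-double y = trans (·ᵠ-assoc ½ 2ℚ y) (·ᵠ-identity y)
  +ᶻ-0 : ∀ {m} (a : Vec ℤ m) → a ≡ a +ᶻ 0ᶻ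
  +ᶻ-0 [] = refl
  +ᶻ-0 (a ∷ as) = cong₂ _∷_ (sym (ℤ.+-identityʳ a)) (+ᶻ-0 as)
  0-+ᶻ : ∀ {m} (a : Vec ℤ m) → a ≡ 0ᶻ +ᶻ a
  0-+ᶻ [] = refl
  0-+ᶻ (a ∷ as) = cong₂ _∷_ (sym (ℤ.+-identityˡ a)) (0-+ᶻ as)
  left : ∀ y → HCone (rationalRows B₁) y → Hull V 1ℚ y
  left y h = Embedded-mono (λ a Ba → a , 0ᶻ , Ba , IntCone-0 B₂ , +ᶻ-0 a)
    (conv⇒Hull (Equivalence.to (HCone≐convIntCone B₁ y) h))
  right : ∀ z → HCone (rationalRows B₂) z → Hull V 1ℚ z
  right z h = Embedded-mono (λ b Bb → 0ᶻ , b , IntCone-0 B₁ , Bb , 0-+ᶻ b)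
    (conv⇒Hull (Equivalence.to (HCone≐convIntCone B₂ z) h))
  to : SumCone (rationalRows B₁) (rationalRows B₂) x → conv (Sum (IntCone B₁) (IntCone B₂)) x
  to h with SumCone-elim (rationalRows B₁) (rationalRows B₂) h
  -- y + z is the midpoint of 2y + 0 and 0 + 2z, each of which lies in the hull because both cones
  -- contain 0.
  ... | y , z , Ay , Bz , refl = Hull⇒conv (subst (Hull V 1ℚ) (cong₂ _+ᵠ_ (half-double y) (half-double z))
    (Hull-+ (Hull-· {c = ½} {1ℚ} 0≤½ (left (2ℚ ·ᵠ y) (HCone-· (rationalRows B₁) 0≤2 Ay)))
            (Hull-· {c = ½} {1ℚ} 0≤½ (right (2ℚ ·ᵠ z) (HCone-· (rationalRows B₂) 0≤2 Bz)))))
  from : conv (Sum (IntCone B₁) (IntCone B₂)) x → SumCone (rationalRows B₁) (rationalRows B₂) x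
  from h with Hull-Sum (conv⇒Hull h)
  ... | y , z , hy , hz , refl = SumCone-intro (rationalRows B₁) (rationalRows B₂)
    (Equivalence.from (HCone≐convIntCone B₁ y) (Hull⇒conv hy)) (Equivalence.from (HCone≐convIntCone B₂ z) (Hull⇒conv hz))

-- If s + k g lies in conv S₁ + conv S₂ for all k ≥ 0, then the polyhedron of all (k, x₁) with x₁ and s + k g − x₁ within
-- the bounds known for S₁ and S₂ is unbounded in k, and its rays with positive first coordinate decompose g.
module _ {n} {S₁ S₂ : ZSet n} where

  private
    rows₁ : ∀ B → All (BoundedOn S₁) B → List (ℚ × Vec ℚ (suc n))
    rows₁ [] [] = []
    rows₁ (r ∷ B) ((M , _) ∷ bs) = (toℚ M , 0ℚ ∷ embed r) ∷ rows₁ B bs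

    rows₂ : Vec ℚ n → Vec ℚ n → ∀ B → All (BoundedOn S₂) B → List (ℚ × Vec ℚ (suc n))
    rows₂ s g [] [] = []
    rows₂ s g (r ∷ B) ((M , _) ∷ bs) =
      (toℚ M ℚ.- dot (embed r) s , dot (embed r) g ∷ ((ℚ.- 1ℚ) ·ᵠ embed r)) ∷ rows₂ s g B bs

    zero-row : ∀ (r x : Vec ℚ n) k → dot (0ℚ ∷ r) (k ∷ x) ≡ dot r x
    zero-row r x k = trans (cong (ℚ._+ dot r x) (ℚ.*-zeroˡ k)) (ℚ.+-identityˡ _)

    difference-row : ∀ (r x g : Vec ℚ n) k → dot (dot r g ∷ ((ℚ.- 1ℚ) ·ᵠ r)) (k ∷ x) ≡ k ℚ.* dot r g ℚ.- dot r x
    difference-row r x g k = trans (cong (dot r g ℚ.* k ℚ.+_) (dot-·ˡ (ℚ.- 1ℚ) r x)) (lemma (dot r g) k (dot r x))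
      where
      lemma : ∀ a k b → a ℚ.* k ℚ.+ (ℚ.- 1ℚ) ℚ.* b ≡ k ℚ.* a ℚ.- b
      lemma = solve-∀ ringℚ

    in-rows₁ : ∀ B bs k {x₁} → Hull (Embedded S₁) 1ℚ x₁ → HPoly (rows₁ B bs) (k ∷ x₁)
    in-rows₁ [] [] k h = []
    in-rows₁ (r ∷ B) ((M , S≤M) ∷ bs) k {x₁} h =
      subst (ℚ._≤ toℚ M) (sym (zero-row (embed r) x₁ k)) (Hull-≤-bound r S≤M h) ∷ in-rows₁ B bs k h

    in-rows₂ : ∀ s g B bs k {x₁ x₂} → s +ᵠ (k ·ᵠ g) ≡ x₁ +ᵠ x₂ → Hull (Embedded S₂) 1ℚ x₂ → HPoly (rows₂ s g B bs) (k ∷ x₁)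
    in-rows₂ s g [] [] k eq h = []
    in-rows₂ s g (r ∷ B) ((M , S≤M) ∷ bs) k {x₁} {x₂} eq h =
      subst (ℚ._≤ toℚ M ℚ.- dot (embed r) s) (sym (difference-row (embed r) x₁ g k))
        (≤-from-difference (p≤q⇒0≤q-p (Hull-≤-bound r S≤M h))
          (trans (lemma (toℚ M) (dot (embed r) s) (k ℚ.* dot (embed r) g) (dot (embed r) x₁) (dot (embed r) x₂))
            (trans (cong (λ z → (k ℚ.* dot (embed r) g ℚ.- dot (embed r) x₁) ℚ.+ (toℚ M ℚ.- dot (embed r) x₂) ℚ.+ ((dot (embed r) x₁ ℚ.+ dot (embed r) x₂) ℚ.- z)) dots)
              (lemma₂ ((k ℚ.* dot (embed r) g ℚ.- dot (embed r) x₁) ℚ.+ (toℚ M ℚ.- dot (embed r) x₂)) (dot (embed r) x₁ ℚ.+ dot (embed r) x₂)))))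
      ∷ in-rows₂ s g B bs k eq h
      where
      dots : dot (embed r) s ℚ.+ k ℚ.* dot (embed r) g ≡ dot (embed r) x₁ ℚ.+ dot (embed r) x₂
      dots = trans (sym (trans (dot-+ (embed r) s (k ·ᵠ g)) (cong (dot (embed r) s ℚ.+_) (dot-· (embed r) k g))))
        (trans (cong (dot (embed r)) eq) (dot-+ (embed r) x₁ x₂))
      lemma : ∀ M s kg x₁ x₂ → M ℚ.- s ≡ ((kg ℚ.- x₁) ℚ.+ (M ℚ.- x₂)) ℚ.+ ((x₁ ℚ.+ x₂) ℚ.- (s ℚ.+ kg))
      lemma = solve-∀ ringℚ
      lemma₂ : ∀ a b → a ℚ.+ (b ℚ.- b) ≡ a
      lemma₂ = solve-∀ ringℚ

    ray₁ : ∀ B bs κ r₁ → HCone (recession (rows₁ B bs)) (κ ∷ r₁) → HCone (rationalRows B) r₁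
    ray₁ [] [] κ r₁ [] = []
    ray₁ (r ∷ B) (_ ∷ bs) κ r₁ (h ∷ hs) = subst (ℚ._≤ 0ℚ) (zero-row (embed r) r₁ κ) h ∷ ray₁ B bs κ r₁ hs

    ray₂ : ∀ s g B bs κ r₁ → HCone (recession (rows₂ s g B bs)) (κ ∷ r₁) → HCone (rationalRows B) ((κ ·ᵠ g) +ᵠ ((ℚ.- 1ℚ) ·ᵠ r₁))
    ray₂ s g [] [] κ r₁ [] = []
    ray₂ s g (r ∷ B) (_ ∷ bs) κ r₁ (h ∷ hs) =
      subst (ℚ._≤ 0ℚ) (trans (difference-row (embed r) r₁ g κ)
        (sym (trans (membership-row (embed r) (κ ·ᵠ g) r₁) (cong (ℚ._- dot (embed r) r₁) (dot-· (embed r) κ g))))) h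
      ∷ ray₂ s g B bs κ r₁ hs

  recession-splits : ∀ B₁ B₂ → All (BoundedOn S₁) B₁ → All (BoundedOn S₂) B₂ → ∀ s g →
    (∀ k → 0ℚ ℚ.≤ k → Hull (Embedded (Sum S₁ S₂)) 1ℚ (s +ᵠ (k ·ᵠ g))) → SumCone (rationalRows B₁) (rationalRows B₂) g
  recession-splits B₁ B₂ bs₁ bs₂ s g along with unbounded⇒ray rows (1ℚ ∷ 0ᵠ) unbounded
    where
    rows : List (ℚ × Vec ℚ (suc n))
    rows = rows₁ B₁ bs₁ ++ rows₂ s g B₂ bs₂
    first : ∀ k (x : Vec ℚ n) → dot (1ℚ ∷ 0ᵠ) (k ∷ x) ≡ k
    first k x = trans (cong₂ ℚ._+_ (ℚ.*-identityˡ k) (dot-0ˡ x)) (ℚ.+-identityʳ k)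
    unbounded : ∀ M → ∃[ x ] (HPoly rows x × M ℚ.< dot (1ℚ ∷ 0ᵠ) x)
    -- The multiple of g must exceed M and be nonnegative.
    unbounded M with Hull-Sum (along ((M ℚ.⊔ 0ℚ) ℚ.+ 1ℚ) (0≤p+q (ℚ.p≤q⊔p M 0ℚ) 0≤1))
    ... | x₁ , x₂ , h₁ , h₂ , eq = ((M ℚ.⊔ 0ℚ) ℚ.+ 1ℚ) ∷ x₁ ,
      All.++⁺ (in-rows₁ B₁ bs₁ ((M ℚ.⊔ 0ℚ) ℚ.+ 1ℚ) h₁) (in-rows₂ s g B₂ bs₂ ((M ℚ.⊔ 0ℚ) ℚ.+ 1ℚ) eq h₂) ,
      subst₂ ℚ._<_ (ℚ.+-identityʳ M) (sym (first ((M ℚ.⊔ 0ℚ) ℚ.+ 1ℚ) x₁)) (ℚ.+-mono-≤-< (ℚ.p≤p⊔q M 0ℚ) (ℚ.positive⁻¹ 1ℚ))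
  ... | κ ∷ r₁ , in-rec , 0<first = scale (reciprocal 0<κ)
    where
    0<κ : 0ℚ ℚ.< κ
    0<κ = subst (0ℚ ℚ.<_) (trans (cong₂ ℚ._+_ (ℚ.*-identityˡ κ) (dot-0ˡ r₁)) (ℚ.+-identityʳ κ)) 0<first
    in-rows : HCone (recession (rows₁ B₁ bs₁) ++ recession (rows₂ s g B₂ bs₂)) (κ ∷ r₁)
    in-rows = subst (λ rs → HCone rs (κ ∷ r₁)) (map-++ proj₂ (rows₁ B₁ bs₁) (rows₂ s g B₂ bs₂)) in-rec
    scale : (∃[ c ] (0ℚ ℚ.< c × c ℚ.* κ ≡ 1ℚ)) → SumCone (rationalRows B₁) (rationalRows B₂) g
    -- Scaling the ray to first coordinate 1 makes c r₁ and g - c r₁ the two summands of g.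
    scale (c , 0<c , cκ≡1) = c ·ᵠ r₁ ,
      HCone-· (rationalRows B₁) (ℚ.<⇒≤ 0<c) (ray₁ B₁ bs₁ κ r₁ (All.++⁻ˡ (recession (rows₁ B₁ bs₁)) in-rows)) ,
      subst (HCone (rationalRows B₂)) (rescale g r₁)
        (HCone-· (rationalRows B₂) (ℚ.<⇒≤ 0<c) (ray₂ s g B₂ bs₂ κ r₁ (All.++⁻ʳ (recession (rows₁ B₁ bs₁)) in-rows)))
      where
      rescale : ∀ {m} (g r : Vec ℚ m) → c ·ᵠ ((κ ·ᵠ g) +ᵠ ((ℚ.- 1ℚ) ·ᵠ r)) ≡ g +ᵠ ((ℚ.- 1ℚ) ·ᵠ (c ·ᵠ r))
      rescale [] [] = refl
      rescale (g ∷ gs) (r ∷ rs) = cong₂ _∷_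
        (trans (lemma c κ g r) (trans (cong (λ z → z ℚ.* g ℚ.+ (ℚ.- 1ℚ) ℚ.* (c ℚ.* r)) cκ≡1) (cong (ℚ._+ (ℚ.- 1ℚ) ℚ.* (c ℚ.* r)) (ℚ.*-identityˡ g))))
        (rescale gs rs)
        where
        lemma : ∀ c κ g r → c ℚ.* (κ ℚ.* g ℚ.+ (ℚ.- 1ℚ) ℚ.* r) ≡ (c ℚ.* κ) ℚ.* g ℚ.+ (ℚ.- 1ℚ) ℚ.* (c ℚ.* r)
        lemma = solve-∀ ringℚ

+ᶻ-exchange : ∀ {n} (a b d : Vec ℤ n) → (a +ᶻ d) +ᶻ b ≡ (a +ᶻ b) +ᶻ d
+ᶻ-exchange [] [] [] = refl
+ᶻ-exchange (a ∷ as) (b ∷ bs) (d ∷ ds) = cong₂ _∷_ (lemma a b d) (+ᶻ-exchange as bs ds)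
  where
  lemma : ∀ a b d → (a ℤ.+ d) ℤ.+ b ≡ (a ℤ.+ b) ℤ.+ d
  lemma = solve-∀ ringℤ

+ᶻ-assoc : ∀ {n} (a b d : Vec ℤ n) → a +ᶻ (b +ᶻ d) ≡ (a +ᶻ b) +ᶻ d
+ᶻ-assoc a b d = sym (zipWith-assoc ℤ.+-assoc a b d)

-- A pair of candidate cones is accepted if both lie in the recession cone `K` and their sum
-- contains every generator of `K`. These tests are decidable and force `K` to be the sum. The true
-- pair passes: translating one summand translates the sum, and `recession-splits` decomposes each
-- generator.
decompose-LNat2 : ∀ {n} {P : QSet n} → IsPolyhedron P → IsClassPolyhedron IsLNat2 P → HasDecomposition IsLNat2 P
decompose-LNat2 {n} {P} P-poly (S , _ , (S₁ , S₂ , (a , S₁a) , S₁-LNat , (b , S₂b) , S₂-LNat , lift S≐) , lift P≐conv)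
  with polyhedron-rows P-poly
... | rows , P≐rows = choose (HCone-generators K)
  where
  K : List (Vec ℚ n)
  K = recession rows
  Sum-nonempty : NonemptyZ (Sum S₁ S₂)
  Sum-nonempty = a +ᶻ b , a , b , S₁a , S₂b , refl
  P≐convSum : P ≐ conv (Sum S₁ S₂)
  P≐convSum = ≐-trans P≐conv (conv-cong S≐)
  Pairs : Set
  Pairs = List (Fin (suc n) × Fin (suc n))
  Q : Pairs → List (Vec ℚ n)
  Q E = rationalRows (pairRows E)
  choose : ∃[ L ] ((∀ g → g ∈ L → HCone K g) × (∀ x → HCone K x → Cone (_∈ L) x)) → HasDecomposition IsLNat2 P
  choose (L , L⊆K , K⊆L) = found (Any.any? good? candidates)
    where
    candidates : List (Pairs × Pairs)
    candidates = List.cartesianProductWith _,_ (sublists (allPairs n)) (sublists (allPairs n))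
    Good : Pairs × Pairs → Set
    Good (E₁ , E₂) = (∀ x → HCone (Q E₁) x → HCone K x) ×
      (∀ x → HCone (Q E₂) x → HCone K x) ×
      All (SumCone (Q E₁) (Q E₂)) L
    good? : ∀ E → Dec (Good E)
    good? (E₁ , E₂) = HCone-⊆? (Q E₁) K ×-dec (HCone-⊆? (Q E₂) K ×-dec
      All.all? (SumCone? (Q E₁) (Q E₂)) L)
    recedes⇒good : ∀ E₁ E₂ → RecedesAlong S₁ (pairRows E₁) → RecedesAlong S₂ (pairRows E₂) → Good (E₁ , E₂)
    recedes⇒good E₁ E₂ rec₁ rec₂ =
      HCone-from-integers (Q E₁) K (λ d Ed → translation⇒recession rows P≐rows Sum-nonempty P≐convSum d
        λ k → R₁.translates _ (IntCone-* (pairRows E₁) k (HCone⇒IntCone (pairRows E₁) Ed)) a S₁a >>= λ S₁′ →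
          pure (_ , b , S₁′ , S₂b , sym (+ᶻ-exchange a b _))) ,
      HCone-from-integers (Q E₂) K (λ d Ed → translation⇒recession rows P≐rows Sum-nonempty P≐convSum d
        λ k → R₂.translates _ (IntCone-* (pairRows E₂) k (HCone⇒IntCone (pairRows E₂) Ed)) b S₂b >>= λ S₂′ →
          pure (a , _ , S₁a , S₂′ , sym (+ᶻ-assoc a b _))) ,
      All.tabulate (λ {g} g∈ → recession-splits (pairRows E₁) (pairRows E₂) R₁.rows-bounded R₂.rows-bounded (embed (a +ᶻ b)) g
        λ k 0≤k → conv⇒Hull (Equivalence.to (P≐convSum _) (Equivalence.from (P≐rows _)
          (HPoly-+ray rows (Equivalence.to (P≐rows _) (Equivalence.from (P≐convSum _) (point∈conv (proj₂ Sum-nonempty))))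
            (HCone-· K 0≤k (L⊆K g g∈))))))
      where
      module R₁ = RecedesAlong rec₁
      module R₂ = RecedesAlong rec₂
    found : Dec (Any Good candidates) → HasDecomposition IsLNat2 P
    found (no none) = ⊥-elim ((LNat-recedes S₁-LNat >>= λ { (E₁ , E₁∈ , rec₁) → LNat-recedes S₂-LNat >>= λ { (E₂ , E₂∈ , rec₂) →
      λ _ → none (lose (∈-cartesianProductWith⁺ _,_ E₁∈ E₂∈) (recedes⇒good E₁ E₂ rec₁ rec₂)) } }) id)
    found (yes any) with find any
    ... | (E₁ , E₂) , _ , E₁⊆K , E₂⊆K , L⊆Sum =
      decompose rows P≐rows Sum-nonempty P≐convSum (Sum-truncation S₁-LNat S₂-LNat)
        (Sum (IntCone B₁) (IntCone B₂))
        (_ , 0ᶻ , 0ᶻ , IntCone-0 B₁ , IntCone-0 B₂ , refl)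
        (IntCone B₁ , IntCone B₂ , (0ᶻ , IntCone-0 B₁) , pairCone-LNat E₁ , (0ᶻ , IntCone-0 B₂) , pairCone-LNat E₂ , lift (λ _ → mk⇔ id id))
        (λ x → mk⇔
          (λ Kx → Equivalence.to (SumCone≐conv B₁ B₂ x) (Cone⊆SumCone _ _ (λ g g∈ → All.lookup L⊆Sum g∈) (K⊆L x Kx)))
          (λ h → sum⊆K x (SumCone-elim (rationalRows B₁) (rationalRows B₂) (Equivalence.from (SumCone≐conv B₁ B₂ x) h))))
      where
      B₁ B₂ : List (Vec ℤ n)
      B₁ = pairRows E₁
      B₂ = pairRows E₂
      sum⊆K : ∀ x → ∃[ y ] ∃[ z ] (HCone (rationalRows B₁) y × HCone (rationalRows B₂) z × x ≡ y +ᵠ z) → HCone K x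
      sum⊆K x (y , z , hy , hz , refl) = HCone-+ K (E₁⊆K y hy) (E₂⊆K z hz)

theorem3p6 : (n : ℕ) (P : QSet n) → IsPolyhedron P →
    (IsClassPolyhedron IsLNat P → HasDecomposition IsLNat P) ×
    (IsClassPolyhedron IsLNat2 P → HasDecomposition IsLNat2 P) ×
    (IsClassPolyhedron IsMNat P → HasDecomposition IsMNat P) ×
    (IsClassPolyhedron IsM P → HasDecomposition IsM P) ×
    (IsClassPolyhedron IsMNat2 P → HasDecomposition IsMNat2 P) ×
    (IsClassPolyhedron IsM2 P → HasDecomposition IsM2 P) ×
    (IsClassPolyhedron IsMultimodular P → HasDecomposition IsMultimodular P)
theorem3p6 n P P-poly =
  decompose-by-family (LNat-cones n) P-poly ,
  decompose-LNat2 P-poly ,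
  decompose-by-family (MNat-cones n) P-poly ,
  decompose-by-family (M-cones n) P-poly ,
  decompose-intersection (MNat-cones n) P-poly ,
  decompose-intersection (M-cones n) P-poly ,
  decompose-multimodular P-poly
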